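{- Let $a$ be a real number with $0<a<1$, and let $\alpha$ be a badly approximable real number, i.e. $\inf_{q\ge1} q\,\|q\alpha\|>0$. Then the set of real numbers $\beta$ such that $$\liminf_{q\to+\infty}\, q\,(\log q)^{2-a}\,\bigl(\log (1/\|q\alpha\|)\bigr)^a\,\|q\alpha\|\,\|q\beta\|>0$$ (where $q$ runs over positive integers) has Hausdorff dimension $1$.
   Context: For a real number $x$, $\|x\|$ denotes the distance from $x$ to the nearest integer. -}

module Defs where

open import Level using (Level; 0ℓ; suc)
open import Algebra.Bundles using (CommutativeRing; Semiring)
open import Algebra.Core using (Op₁; Op₂)
open import Algebra.Structures using (IsCommutativeRing)
open import Axiom.ExcludedMiddle using (ExcludedMiddle)
open import Data.Bool.Base using (if_then_else_)
open import Data.Fin.Base using (toℕ)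
open import Data.Integer.Base as ℤ using (ℤ)
open import Data.Nat.Base as ℕ using (ℕ; _!)
open import Data.Product.Base using (∃; _×_; _,_; proj₁)
open import Relation.Binary.Bundles using (TotalOrder)
open import Relation.Binary.Core using (Rel)
open import Relation.Binary.Structures using (IsTotalOrder)
open import Relation.Nullary.Construct.Add.Extrema using (_±; ⊥±; ⊤±; [_])
open import Relation.Nullary.Decidable.Core using (yes; no; does)
open import Relation.Nullary.Negation.Core using (¬_)
open import Relation.Unary using (Pred; _⊆_; ⋃)

import Algebra.Construct.NaturalChoice.Max as Max
import Algebra.Definitions.RawSemiring as RawSemiringDefs
import Relation.Binary.Construct.Add.Extrema.Equality as AddExtremaEq
import Relation.Binary.Construct.Add.Extrema.NonStrict as AddExtrema
import Relation.Binary.Construct.Add.Extrema.Strict as AddExtremaStrict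
import Relation.Binary.Construct.NonStrictToStrict as ToStrict

IsUpperBound IsLowerBound IsSupremum IsInfimum :
  ∀ {a i} {A : Set a} {I : Set i} → Rel A 0ℓ → (I → A) → A → Set _
IsUpperBound _≤_ f u = ∀ i → f i ≤ u
IsLowerBound _≤_ f l = ∀ i → l ≤ f i
IsSupremum   _≤_ f s = IsUpperBound _≤_ f s × (∀ u → IsUpperBound _≤_ f u → s ≤ u)
IsInfimum    _≤_ f s = IsLowerBound _≤_ f s × (∀ l → IsLowerBound _≤_ f l → l ≤ s)

-- The real numbers, presented axiomatically.  Classically these axioms
-- determine them up to unique isomorphism; equality is the setoid
-- equality _≈_.

record CompleteOrderedField : Set (suc 0ℓ) where
  infix  4 _≈_ _≤_
  infixl 6 _+_
  infixl 7 _*_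
  infix  8 -_
  field
    Carrier           : Set
    _≈_               : Rel Carrier 0ℓ
    _≤_               : Rel Carrier 0ℓ
    _+_               : Op₂ Carrier
    _*_               : Op₂ Carrier
    -_                : Op₁ Carrier
    0#                : Carrier
    1#                : Carrier
    isCommutativeRing : IsCommutativeRing _≈_ _+_ _*_ -_ 0# 1#
    1≉0               : ¬ (1# ≈ 0#)
    inverse           : ∀ x → ¬ (x ≈ 0#) → ∃ λ y → x * y ≈ 1#
    isTotalOrder      : IsTotalOrder _≈_ _≤_
    +-monoˡ-≤         : ∀ z {x y} → x ≤ y → x + z ≤ y + z
    *-nonNeg          : ∀ {x y} → 0# ≤ x → 0# ≤ y → 0# ≤ x * y
    complete          : (P : Pred Carrier 0ℓ) → ∃ P →
                        ∃ (IsUpperBound _≤_ (proj₁ {B = P})) →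
                        ∃ (IsSupremum _≤_ (proj₁ {B = P}))

  commutativeRing : CommutativeRing 0ℓ 0ℓ
  commutativeRing = record { isCommutativeRing = isCommutativeRing }

  totalOrder : TotalOrder 0ℓ 0ℓ 0ℓ
  totalOrder = record { isTotalOrder = isTotalOrder }

module RealAnalysis
  (em : ∀ {ℓ} → ExcludedMiddle ℓ) (R : CompleteOrderedField) where

  open CompleteOrderedField R renaming (Carrier to ℝ) public
  open ToStrict _≈_ _≤_ using (_<_) public
  open Max totalOrder using (_⊔_) public
  open RawSemiringDefs
    (Semiring.rawSemiring (CommutativeRing.semiring commutativeRing))
    using (sum) renaming (_×_ to _·_; _^_ to _^ⁿ_) public

  infixl 6 _-_
  infix  8 _⁻¹
  infixr 8 _^_ _^±_
  infix  4 _⟶_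

  -- Definite description: some element satisfying P, and d if there is
  -- none.  Below, P always determines its solution up to equality.

  the : ∀ {a p} {A : Set a} → A → (A → Set p) → A
  the d P with em {P = ∃ P}
  ... | yes (x , _) = x
  ... | no _        = d

  _-_ : Op₂ ℝ
  x - y = x + - y

  ∣_∣ : Op₁ ℝ
  ∣ x ∣ = x ⊔ - x

  fromℕ : ℕ → ℝ
  fromℕ n = n · 1#

  fromℤ : ℤ → ℝ
  fromℤ (ℤ.+ n)    = fromℕ n
  fromℤ ℤ.-[1+ n ] = - fromℕ (ℕ.suc n)

  -- Junk value 0 at 0.
  _⁻¹ : Op₁ ℝ
  x ⁻¹ = the 0# λ y → x * y ≈ 1#

  _⟶_ : (ℕ → ℝ) → ℝ → Set
  u ⟶ l = ∀ ε → 0# < ε → ∃ λ N → ∀ n → N ℕ.≤ n → ∣ u n - l ∣ < ε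

  exp : Op₁ ℝ
  exp x = the 0# (partialSum ⟶_)
    where
    partialSum : ℕ → ℝ
    partialSum n = sum {n} λ k → x ^ⁿ toℕ k * fromℕ (toℕ k !) ⁻¹

  -- Junk value 0 at x ≤ 0.
  log : Op₁ ℝ
  log x = the 0# λ y → exp y ≈ x

  -- Real powers of x ≥ 0, with 0 ^ 0 = 1 and 0 ^ s = 0 for s > 0.
  _^_ : Op₂ ℝ
  x ^ s = if does (em {P = x ≈ 0#})
          then (if does (em {P = s ≈ 0#}) then 1# else 0#)
          else exp (s * log x)

  ‖_‖ : Op₁ ℝ
  ‖ x ‖ = the 0# (IsInfimum _≤_ λ (m : ℤ) → ∣ x - fromℤ m ∣)

  -- The extended reals ℝ ±, with ⊥± = -∞ and ⊤± = +∞.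

  open AddExtrema       _≤_ using (_≤±_) public
  open AddExtremaStrict _<_ using (_<±_) public
  open AddExtremaEq     _≈_ using (_≈±_) public

  ⨆ ⨅ : ∀ {i} (I : Set i) → (I → ℝ ±) → ℝ ±
  ⨆ I f = the ⊥± (IsSupremum _≤±_ f)
  ⨅ I f = the ⊤± (IsInfimum  _≤±_ f)

  liminf : (ℕ → ℝ) → ℝ ±
  liminf u = ⨆ ℕ λ N → ⨅ (∃ λ q → N ℕ.≤ q) λ (q , _) → [ u q ]

  BadlyApproximable : Pred ℝ 0ℓ
  BadlyApproximable α =
    [ 0# ] <± ⨅ (∃ λ q → 1 ℕ.≤ q) λ (q , _) → [ fromℕ q * ‖ fromℕ q * α ‖ ]

  -- The supremum is over the extended reals, so the empty set has
  -- diameter ⊥±.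
  diam : Pred ℝ 0ℓ → ℝ ±
  diam U = ⨆ (∃ U × ∃ U) λ ((x , _) , (y , _)) → [ ∣ x - y ∣ ]

  -- The empty set (diameter ⊥±) contributes 0 for every s.  The value
  -- at ⊤± is junk: it is only used for sets of finite diameter.
  _^±_ : ℝ ± → ℝ → ℝ
  ⊥±    ^± s = 0#
  [ d ] ^± s = d ^ s
  ⊤±    ^± s = 0#

  -- Countable covers by arbitrary sets of diameter at most δ.
  record Cover (δ : ℝ) (E : Pred ℝ 0ℓ) : Set (suc 0ℓ) where
    field
      piece  : ℕ → Pred ℝ 0ℓ
      covers : E ⊆ ⋃ ℕ piece
      small  : ∀ i → diam (piece i) ≤± [ δ ]

  cost : ∀ {δ E} → ℝ → Cover δ E → ℝ ±
  cost s C = ⨆ ℕ λ n → [ sum {n} (λ i → diam (piece (toℕ i)) ^± s) ]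
    where open Cover C

  hausdorffMeasure : ℝ → Pred ℝ 0ℓ → ℝ ±
  hausdorffMeasure s E =
    ⨆ (∃ λ δ → 0# < δ) λ (δ , _) → ⨅ (Cover δ E) (cost s)

  dimH : Pred ℝ 0ℓ → ℝ ±
  dimH E = ⨅ (∃ λ s → 0# ≤ s × hausdorffMeasure s E ≈± [ 0# ]) λ (s , _) → [ s ]

{-# OPTIONS --safe #-}
-- Write w q for the factor in front of ‖qβ‖.  Because α is badly
-- approximable, the numbers qα with 2^n ≤ q < 2^{n+1} are separated modulo 1
-- by a multiple of 2^{-n}; sorting them by the dyadic size 2^{-j} of ‖qα‖
-- gives ∑ 1/w q ≪ n^{a-2} ∑_{j ≪ n} j^{-a} ≪ 1/n over the block.
--
-- Following Peres and Schlag, remove from [0, 1], at stage n, all β with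
-- ‖qβ‖ < ε/w q for q in the n-th block.  These intervals are well distributed
-- at scale 8^{-m}, m = ⌊n/3⌋, so stage n takes at most a proportion
-- 1/(8n) of what survives stage m, and n times the surviving proportion is
-- nondecreasing.  So little is lost that one can also remove, at the stages
-- matching their diameters, the members of any cover with ∑ diam^s small,
-- s < 1.  A surviving point lies in the set but in no member of the
-- cover, so the set is not null in any dimension s < 1.
--
-- For s > 1, intervals of lengths below 1/m, m > N, cover ℝ, and the sum of
-- the s-th powers of their lengths tends to 0 as N grows.
module Submission where

open import Level using (0ℓ)
open import Algebra.Bundles using (CommutativeRing)
open import Axiom.ExcludedMiddle using (ExcludedMiddle)
open import Data.Bool.Base using (T; if_then_else_)
open import Data.Empty using (⊥; ⊥-elim)
open import Data.Fin.Base as Fin using (Fin; toℕ)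
open import Data.Integer.Base as ℤ using (ℤ)
open import Data.List.Base as List using (List; []; _∷_)
open import Data.Nat.Base as ℕ using (ℕ; zero; suc; _!)
open import Data.Nat.Combinatorics using (nCk≡n!/k![n-k]!; k![n∸k]!∣n!) renaming (_C_ to _choose_)
open import Data.Nat.DivMod using (m/n*n≡m; m*n/n≡m; m<n⇒m/n≡0; m<n*o⇒m/o<n; m%n<n; m≡m%n+[m/n]*n; +-distrib-/-∣ˡ; /-monoˡ-≤; m/n*n≤m; m/n<m)
open import Data.Nat.Divisibility using (n∣m*n)
open import Data.Product.Base using (∃; _×_; _,_; proj₁; proj₂; swap)
open import Data.Sum.Base using (_⊎_; inj₁; inj₂; [_,_]′)
open import Data.Unit.Base using (⊤; tt)
open import Data.Vec.Base as Vec using (Vec; []; _∷_)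
open import Data.Vec.N-ary using (N-ary; _$ⁿ_; curryⁿ; curryⁿ-cong; Eq)
open import Function.Base using (_∘_; id)
open import Relation.Binary.Bundles using (Poset; TotalOrder)
open import Relation.Binary.PropositionalEquality as ≡ using (_≡_)
open import Relation.Binary.Structures using (IsTotalOrder)
open import Relation.Nullary.Construct.Add.Extrema using (_±; ⊥±; ⊤±; [_])
open import Relation.Nullary.Decidable.Core using (Dec; yes; no; does)
open import Relation.Nullary.Negation.Core using (¬_)
open import Relation.Unary using (Pred)
import Algebra.Construct.NaturalChoice.Max as Max
import Algebra.Construct.NaturalChoice.MaxOp as MaxOp
import Algebra.Properties.CommutativeSemiring.Exp as Exp
import Algebra.Properties.CommutativeSemiring.Binomial as Binomial
import Algebra.Properties.Ring as RingProperties
import Algebra.Properties.Semiring.Mult as Mult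
import Data.Integer.Properties as ℤ
import Data.Nat.Properties as ℕ
import Data.Vec.Properties as Vec
import Relation.Binary.Construct.Add.Extrema.Equality as AddExtremaEq
import Relation.Binary.Construct.Add.Extrema.NonStrict as AddExtrema
import Relation.Binary.Construct.Add.Extrema.Strict as AddExtremaStrict
import Relation.Binary.Construct.Add.Supremum.NonStrict as AddSupremum
import Relation.Binary.Construct.Add.Supremum.Strict as AddSupremumStrict
import Relation.Binary.Construct.NonStrictToStrict as ToStrict
import Relation.Binary.Reasoning.PartialOrder as PosetReasoning
open import Defs

-- The obstacle is that stage n cannot be compared with the stage just before it. For q near 2^n the
-- fractions j/q are about 2^(-n) apart, so they are evenly spread only in cells of length at least
-- 2^(-n). Hence 8^m ≤ 2^n, and the loss is measured against the survivors of stage m, which may be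
-- far more than those of stage n - 1. The monotonicity of n times the proportion is the induction
-- hypothesis that repairs this: as n - 1 ≤ 4 m, the ratio is at most 4, and the loss 1/(8 n)
-- becomes 1/(2 n) of the current survivors. A loss of 1/n is what leaves n times the proportion
-- unchanged, so a second share of 1/(2 n) is free for the cover. The surviving proportion is at
-- least 1/n, while cover members of diameter near 8^(-n) meet only about 8^(s n) of the 8^n cells;
-- this exponential gap takes the place of a mass distribution on the surviving set.
--
-- Base 8 is used because block n has about 4^n fractions, each of which may touch two cells more
-- than its length warrants. This rounding costs a proportion of about 2^(-n), harmless beside 1/n.

module Proof (em : ∀ {ℓ} → ExcludedMiddle ℓ) (R : CompleteOrderedField) where

  open RealAnalysis em R
  open CommutativeRing commutativeRing
    using ( refl; sym; trans; reflexive; setoid; +-cong; +-congˡ; +-congʳ; +-assoc; +-comm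
          ; +-identityˡ; +-identityʳ; *-cong; *-congˡ; *-congʳ; *-assoc; *-comm; *-identityˡ
          ; *-identityʳ; distribˡ; distribʳ; zeroˡ; zeroʳ; -‿cong; -‿inverseˡ; -‿inverseʳ
          ; semiring; ring; commutativeSemiring )
  open RingProperties ring using (-‿+-comm; -‿distribˡ-*; -‿distribʳ-*; -‿involutive; -0#≈0#)
  open Mult semiring using (×-homo-+; ×1-homo-*; ×-assoc-*; ×-congʳ)
  open Exp commutativeSemiring using (^-homo-*; ^-congˡ)

  -- Definite description, numerals and a ring solver

  the-spec : ∀ {a p} {A : Set a} (d : A) (P : A → Set p) → ∃ P → P (the d P)
  the-spec d P p with em {P = ∃ P}
  ... | yes (_ , px) = px
  ... | no ¬p        = ⊥-elim (¬p p)

  fromℕ-+ : ∀ m n → fromℕ (m ℕ.+ n) ≈ fromℕ m + fromℕ n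
  fromℕ-+ = ×-homo-+ 1#

  fromℕ-* : ∀ m n → fromℕ (m ℕ.* n) ≈ fromℕ m * fromℕ n
  fromℕ-* = ×1-homo-*

  fromℕ-cong : ∀ {m n} → m ≡ n → fromℕ m ≈ fromℕ n
  fromℕ-cong = reflexive ∘ ≡.cong fromℕ

  -- A coefficient (p , q) stands for p − q.  An equation holds if all
  -- coefficients of the difference of its sides vanish, a closed computation.
  module Solver where

    infixl 6 _:+_ _:-_
    infixl 7 _:*_
    infix  8 :-_
    infix  4 _:=_

    -- `:1` is separate from `con 1` because `fromℕ 1` unfolds to `1# + 0#`. For the same reason
    -- `fromℕ (suc n)` enters the equations below as `:1 :+ n`, with `n` a variable for `fromℕ n`.
    data Expr (n : ℕ) : Set where
      var       : Fin n → Expr n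
      con       : ℕ → Expr n
      :0 :1     : Expr n
      _:+_ _:*_ : Expr n → Expr n → Expr n
      :-_       : Expr n → Expr n

    _:-_ : ∀ {n} → Expr n → Expr n → Expr n
    e :- f = e :+ :- f

    _:=_ : ∀ {n} → Expr n → Expr n → Expr n × Expr n
    _:=_ = _,_

    ⟦_⟧ : ∀ {n} → Expr n → Vec ℝ n → ℝ
    ⟦ var i ⟧  ρ = Vec.lookup ρ i
    ⟦ con k ⟧  ρ = fromℕ k
    ⟦ :0 ⟧     ρ = 0#
    ⟦ :1 ⟧     ρ = 1#
    ⟦ e :+ f ⟧ ρ = ⟦ e ⟧ ρ + ⟦ f ⟧ ρ
    ⟦ e :* f ⟧ ρ = ⟦ e ⟧ ρ * ⟦ f ⟧ ρ
    ⟦ :- e ⟧   ρ = - ⟦ e ⟧ ρ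

    Coeff : Set
    Coeff = ℕ × ℕ

    Mono Poly : ℕ → Set
    Mono n = Vec ℕ n
    Poly n = List (Coeff × Mono n)

    coeff : Coeff → ℝ
    coeff (p , q) = fromℕ p - fromℕ q

    mono : ∀ {n} → Mono n → Vec ℝ n → ℝ
    mono []      []      = 1#
    mono (e ∷ m) (x ∷ ρ) = x ^ⁿ e * mono m ρ

    poly : ∀ {n} → Poly n → Vec ℝ n → ℝ
    poly []            ρ = 0#
    poly ((c , m) ∷ p) ρ = coeff c * mono m ρ + poly p ρ

    _+ᶜ_ _*ᶜ_ : Coeff → Coeff → Coeff
    (p , q) +ᶜ (r , s) = p ℕ.+ r , q ℕ.+ s
    (p , q) *ᶜ (r , s) = p ℕ.* r ℕ.+ q ℕ.* s , p ℕ.* s ℕ.+ q ℕ.* r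

    _*ᵐ_ : ∀ {n} → Mono n → Mono n → Mono n
    _*ᵐ_ = Vec.zipWith ℕ._+_

    insert : ∀ {n} → Coeff × Mono n → Poly n → Poly n
    insert t       []             = t ∷ []
    insert (c , m) ((d , m′) ∷ p) with Vec.≡-dec ℕ._≟_ m m′
    ... | yes _ = (c +ᶜ d , m′) ∷ p
    ... | no  _ = (d , m′) ∷ insert (c , m) p

    _+ᵖ_ _*ᵖ_ : ∀ {n} → Poly n → Poly n → Poly n
    p +ᵖ q = List.foldr insert q p

    scale : ∀ {n} → Coeff × Mono n → Poly n → Poly n
    scale t       []            = []
    scale (c , m) ((d , l) ∷ p) = (c *ᶜ d , m *ᵐ l) ∷ scale (c , m) p

    []      *ᵖ q = []
    (t ∷ p) *ᵖ q = scale t q +ᵖ (p *ᵖ q)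

    -ᵖ_ : ∀ {n} → Poly n → Poly n
    -ᵖ []            = []
    -ᵖ ((c , m) ∷ p) = (swap c , m) ∷ -ᵖ p

    constant : ∀ {n} → ℕ → Poly n
    constant k = ((k , 0) , Vec.replicate _ 0) ∷ []

    unit : ∀ {n} → Fin n → Mono n
    unit Fin.zero    = 1 ∷ Vec.replicate _ 0
    unit (Fin.suc i) = 0 ∷ unit i

    norm : ∀ {n} → Expr n → Poly n
    norm (var i)  = ((1 , 0) , unit i) ∷ []
    norm (con k)  = constant k
    norm :0       = []
    norm :1       = constant 1
    norm (e :+ f) = norm e +ᵖ norm f
    norm (e :* f) = norm e *ᵖ norm f
    norm (:- e)   = -ᵖ norm e

    IsZero : ∀ {n} → Poly n → Set
    IsZero []                  = ⊤
    IsZero (((p , q) , _) ∷ r) = T (p ℕ.≡ᵇ q) × IsZero r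

    open import Relation.Binary.Reasoning.Setoid setoid

    +-interchange : ∀ a b c d → (a + b) + (c + d) ≈ (a + c) + (b + d)
    +-interchange a b c d = begin
      (a + b) + (c + d) ≈⟨ +-assoc a b _ ⟩
      a + (b + (c + d)) ≈⟨ +-congˡ (+-assoc b c d) ⟨
      a + ((b + c) + d) ≈⟨ +-congˡ (+-congʳ (+-comm b c)) ⟩
      a + ((c + b) + d) ≈⟨ +-congˡ (+-assoc c b d) ⟩
      a + (c + (b + d)) ≈⟨ +-assoc a c _ ⟨
      (a + c) + (b + d) ∎

    *-interchange : ∀ a b c d → (a * b) * (c * d) ≈ (a * c) * (b * d)
    *-interchange a b c d = begin
      (a * b) * (c * d) ≈⟨ *-assoc a b _ ⟩
      a * (b * (c * d)) ≈⟨ *-congˡ (*-assoc b c d) ⟨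
      a * ((b * c) * d) ≈⟨ *-congˡ (*-congʳ (*-comm b c)) ⟩
      a * ((c * b) * d) ≈⟨ *-congˡ (*-assoc c b d) ⟩
      a * (c * (b * d)) ≈⟨ *-assoc a c _ ⟨
      (a * c) * (b * d) ∎

    coeff-+ : ∀ c d → coeff (c +ᶜ d) ≈ coeff c + coeff d
    coeff-+ (p , q) (r , s) = begin
      fromℕ (p ℕ.+ r) - fromℕ (q ℕ.+ s) ≈⟨ +-cong (fromℕ-+ p r) (-‿cong (fromℕ-+ q s)) ⟩
      (fromℕ p + fromℕ r) - (fromℕ q + fromℕ s)       ≈⟨ +-congˡ (-‿+-comm _ _) ⟨
      (fromℕ p + fromℕ r) + (- fromℕ q + - fromℕ s)   ≈⟨ +-interchange _ _ _ _ ⟩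
      (fromℕ p - fromℕ q) + (fromℕ r - fromℕ s)       ∎

    coeff-* : ∀ c d → coeff (c *ᶜ d) ≈ coeff c * coeff d
    coeff-* (p , q) (r , s) = sym (begin
      (P - Q) * (V - S)                               ≈⟨ distribʳ _ _ _ ⟩
      P * (V - S) + - Q * (V - S) ≈⟨ +-cong (distribˡ _ _ _) (distribˡ _ _ _) ⟩
      (P * V + P * - S) + (- Q * V + - Q * - S)       ≈⟨ +-congˡ (+-comm _ _) ⟩
      (P * V + P * - S) + (- Q * - S + - Q * V)       ≈⟨ +-interchange _ _ _ _ ⟩
      (P * V + - Q * - S) + (P * - S + - Q * V)
        ≈⟨ +-cong (+-congˡ (trans (sym (-‿distribˡ-* _ _)) (trans (-‿cong (sym (-‿distribʳ-* _ _))) (-‿involutive _))))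
                  (+-cong (sym (-‿distribʳ-* _ _)) (sym (-‿distribˡ-* _ _))) ⟩
      (P * V + Q * S) + (- (P * S) + - (Q * V))       ≈⟨ +-congˡ (-‿+-comm _ _) ⟩
      (P * V + Q * S) - (P * S + Q * V)
        ≈⟨ +-cong (trans (fromℕ-+ (p ℕ.* r) (q ℕ.* s)) (+-cong (fromℕ-* p r) (fromℕ-* q s)))
                  (-‿cong (trans (fromℕ-+ (p ℕ.* s) (q ℕ.* r)) (+-cong (fromℕ-* p s) (fromℕ-* q r)))) ⟨
      fromℕ (p ℕ.* r ℕ.+ q ℕ.* s) - fromℕ (p ℕ.* s ℕ.+ q ℕ.* r) ∎)
      where
      P = fromℕ p
      Q = fromℕ q
      V = fromℕ r
      S = fromℕ s

    coeff-neg : ∀ c → coeff (swap c) ≈ - coeff c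
    coeff-neg (p , q) = begin
      fromℕ q - fromℕ p         ≈⟨ +-comm _ _ ⟩
      - fromℕ p + fromℕ q       ≈⟨ +-congˡ (-‿involutive _) ⟨
      - fromℕ p + - - fromℕ q   ≈⟨ -‿+-comm _ _ ⟩
      - (fromℕ p - fromℕ q)     ∎

    coeff-ℕ : ∀ k → coeff (k , 0) ≈ fromℕ k
    coeff-ℕ k = trans (+-congˡ -0#≈0#) (+-identityʳ _)

    mono-* : ∀ {n} (m l : Mono n) ρ → mono (m *ᵐ l) ρ ≈ mono m ρ * mono l ρ
    mono-* []      []      []      = sym (*-identityˡ 1#)
    mono-* (d ∷ m) (e ∷ l) (x ∷ ρ) = trans (*-cong (^-homo-* x d e) (mono-* m l ρ)) (*-interchange _ _ _ _)

    mono-0 : ∀ {n} (ρ : Vec ℝ n) → mono (Vec.replicate n 0) ρ ≈ 1#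
    mono-0 []      = refl
    mono-0 (x ∷ ρ) = trans (*-identityˡ _) (mono-0 ρ)

    mono-unit : ∀ {n} (i : Fin n) ρ → mono (unit i) ρ ≈ Vec.lookup ρ i
    mono-unit Fin.zero    (x ∷ ρ) = trans (*-cong (*-identityʳ x) (mono-0 ρ)) (*-identityʳ x)
    mono-unit (Fin.suc i) (x ∷ ρ) = trans (*-identityˡ _) (mono-unit i ρ)

    poly-insert : ∀ {n} (c : Coeff) (m : Mono n) p ρ →
                  poly (insert (c , m) p) ρ ≈ coeff c * mono m ρ + poly p ρ
    poly-insert c m []             ρ = refl
    poly-insert c m ((d , m′) ∷ p) ρ with Vec.≡-dec ℕ._≟_ m m′
    ... | yes ≡.refl = trans (+-congʳ (trans (*-congʳ (coeff-+ c d)) (distribʳ _ _ _))) (+-assoc _ _ _)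
    ... | no  _      = begin
      coeff d * mono m′ ρ + poly (insert (c , m) p) ρ       ≈⟨ +-congˡ (poly-insert c m p ρ) ⟩
      coeff d * mono m′ ρ + (coeff c * mono m ρ + poly p ρ) ≈⟨ +-assoc _ _ _ ⟨
      coeff d * mono m′ ρ + coeff c * mono m ρ + poly p ρ   ≈⟨ +-congʳ (+-comm _ _) ⟩
      coeff c * mono m ρ + coeff d * mono m′ ρ + poly p ρ   ≈⟨ +-assoc _ _ _ ⟩
      coeff c * mono m ρ + (coeff d * mono m′ ρ + poly p ρ) ∎

    poly-+ : ∀ {n} (p q : Poly n) ρ → poly (p +ᵖ q) ρ ≈ poly p ρ + poly q ρ
    poly-+ []            q ρ = sym (+-identityˡ _)
    poly-+ ((c , m) ∷ p) q ρ =
      trans (poly-insert c m (p +ᵖ q) ρ) (trans (+-congˡ (poly-+ p q ρ)) (sym (+-assoc _ _ _)))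

    poly-scale : ∀ {n} c (m : Mono n) p ρ → poly (scale (c , m) p) ρ ≈ (coeff c * mono m ρ) * poly p ρ
    poly-scale c m []            ρ = sym (zeroʳ _)
    poly-scale c m ((d , l) ∷ p) ρ = sym (trans (distribˡ _ _ _) (+-cong
      (trans (*-interchange _ _ _ _) (sym (*-cong (coeff-* c d) (mono-* m l ρ))))
      (sym (poly-scale c m p ρ))))

    poly-* : ∀ {n} (p q : Poly n) ρ → poly (p *ᵖ q) ρ ≈ poly p ρ * poly q ρ
    poly-* []            q ρ = sym (zeroˡ _)
    poly-* ((c , m) ∷ p) q ρ = trans (poly-+ (scale (c , m) q) (p *ᵖ q) ρ)
      (trans (+-cong (poly-scale c m q ρ) (poly-* p q ρ)) (sym (distribʳ _ _ _)))

    poly-neg : ∀ {n} (p : Poly n) ρ → poly (-ᵖ p) ρ ≈ - poly p ρ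
    poly-neg []            ρ = sym -0#≈0#
    poly-neg ((c , m) ∷ p) ρ = trans
      (+-cong (trans (*-congʳ (coeff-neg c)) (sym (-‿distribˡ-* _ _))) (poly-neg p ρ)) (-‿+-comm _ _)

    poly-constant : ∀ {n} k (ρ : Vec ℝ n) → poly (constant k) ρ ≈ fromℕ k
    poly-constant k ρ = trans (+-identityʳ _) (trans (*-cong (coeff-ℕ k) (mono-0 ρ)) (*-identityʳ _))

    correct : ∀ {n} (e : Expr n) ρ → poly (norm e) ρ ≈ ⟦ e ⟧ ρ
    correct (var i)  ρ = trans (+-identityʳ _) (trans
      (*-cong (trans (coeff-ℕ 1) (+-identityʳ 1#)) (mono-unit i ρ)) (*-identityˡ _))
    correct (con k)  ρ = poly-constant k ρ
    correct :0       ρ = refl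
    correct :1       ρ = trans (poly-constant 1 ρ) (+-identityʳ 1#)
    correct (e :+ f) ρ = trans (poly-+ (norm e) (norm f) ρ) (+-cong (correct e ρ) (correct f ρ))
    correct (e :* f) ρ = trans (poly-* (norm e) (norm f) ρ) (*-cong (correct e ρ) (correct f ρ))
    correct (:- e)   ρ = trans (poly-neg (norm e) ρ) (-‿cong (correct e ρ))

    isZero-correct : ∀ {n} (p : Poly n) ρ → IsZero p → poly p ρ ≈ 0#
    isZero-correct []                  ρ _           = refl
    isZero-correct (((p , q) , m) ∷ r) ρ (p≡q , r≡0) with ≡.refl ← ℕ.≡ᵇ⇒≡ p q p≡q =
      trans (+-cong (trans (*-congʳ (-‿inverseʳ _)) (zeroˡ _)) (isZero-correct r ρ r≡0)) (+-identityˡ 0#)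

    prove : ∀ {n} (e f : Expr n) ρ → IsZero (norm (e :- f)) → ⟦ e ⟧ ρ ≈ ⟦ f ⟧ ρ
    prove e f ρ e-f≡0 = begin
      ⟦ e ⟧ ρ                         ≈⟨ +-identityʳ _ ⟨
      ⟦ e ⟧ ρ + 0#                    ≈⟨ +-congˡ (-‿inverseˡ _) ⟨
      ⟦ e ⟧ ρ + (- ⟦ f ⟧ ρ + ⟦ f ⟧ ρ) ≈⟨ +-assoc _ _ _ ⟨
      ⟦ e :- f ⟧ ρ + ⟦ f ⟧ ρ ≈⟨ +-congʳ (trans (sym (correct (e :- f) ρ)) (isZero-correct (norm (e :- f)) ρ e-f≡0)) ⟩
      0# + ⟦ f ⟧ ρ                    ≈⟨ +-identityˡ _ ⟩
      ⟦ f ⟧ ρ                         ∎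

    close : ∀ {a} {A : Set a} n → N-ary n (Expr n) A → A
    close n f = f $ⁿ Vec.map var (Vec.allFin n)

    -- Once `f` is known, the implicit `IsZero` argument computes to a product of unit types and is
    -- filled in by eta; a false equation fails to type-check.
    solve : ∀ n (f : N-ary n (Expr n) (Expr n × Expr n)) → let (e₁ , e₂) = close n f in
            {IsZero (norm (e₁ :- e₂))} → Eq n _≈_ (curryⁿ ⟦ e₁ ⟧) (curryⁿ ⟦ e₂ ⟧)
    solve n f {e₁-e₂≡0} = let (e₁ , e₂) = close n f in
      curryⁿ-cong _≈_ ⟦ e₁ ⟧ ⟦ e₂ ⟧ (λ ρ → prove e₁ e₂ ρ e₁-e₂≡0)

  open Solver using (solve; con; :0; :1; _:+_; _:*_; _:-_; :-_; _:=_)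

  -- Ordered fields

  module ≤ = IsTotalOrder isTotalOrder
  open ≤ using ()
    renaming ( refl to ≤-refl; reflexive to ≤-reflexive; trans to ≤-trans
             ; antisym to ≤-antisym; total to ≤-total )

  poset : Poset 0ℓ 0ℓ 0ℓ
  poset = TotalOrder.poset totalOrder

  open PosetReasoning poset

  <⇒≤ : ∀ {x y} → x < y → x ≤ y
  <⇒≤ = proj₁

  <⇒≱ : ∀ {x y} → x < y → ¬ (y ≤ x)
  <⇒≱ = ToStrict.<⇒≱ _≈_ _≤_ ≤-antisym

  ≰⇒> : ∀ {x y} → ¬ (x ≤ y) → y < x
  ≰⇒> = ToStrict.≰⇒> _≈_ _≤_ sym ≤-reflexive ≤-total

  ≮⇒≥ : ∀ {x y} → ¬ (x < y) → y ≤ x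
  ≮⇒≥ {x} {y} x≮y with em {P = y ≤ x}
  ... | yes y≤x = y≤x
  ... | no  y≰x = ⊥-elim (x≮y (≰⇒> y≰x))

  ≤-or-> : ∀ x y → x ≤ y ⊎ y < x
  ≤-or-> x y with em {P = x ≤ y}
  ... | yes x≤y = inj₁ x≤y
  ... | no  x≰y = inj₂ (≰⇒> x≰y)

  ≤-<-trans : ∀ {x y z} → x ≤ y → y < z → x < z
  ≤-<-trans x≤y y<z = ≤-trans x≤y (<⇒≤ y<z) , λ x≈z → <⇒≱ y<z (≤-trans (≤-reflexive (sym x≈z)) x≤y)

  <-≤-trans : ∀ {x y z} → x < y → y ≤ z → x < z
  <-≤-trans x<y y≤z = ≤-trans (<⇒≤ x<y) y≤z , λ x≈z → <⇒≱ x<y (≤-trans y≤z (≤-reflexive (sym x≈z)))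

  <-trans : ∀ {x y z} → x < y → y < z → x < z
  <-trans x<y y<z = <-≤-trans x<y (<⇒≤ y<z)

  >⇒≉0 : ∀ {x} → 0# < x → ¬ (x ≈ 0#)
  >⇒≉0 0<x x≈0 = proj₂ 0<x (sym x≈0)

  +-mono-≤ : ∀ {x y u v} → x ≤ y → u ≤ v → x + u ≤ y + v
  +-mono-≤ {x} {y} {u} {v} x≤y u≤v = begin
    x + u ≤⟨ +-monoˡ-≤ u x≤y ⟩
    y + u ≈⟨ +-comm y u ⟩
    u + y ≤⟨ +-monoˡ-≤ y u≤v ⟩
    v + y ≈⟨ +-comm v y ⟩
    y + v ∎

  +-monoʳ-≤ : ∀ x {u v} → u ≤ v → x + u ≤ x + v
  +-monoʳ-≤ x = +-mono-≤ ≤-refl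

  diff : ∀ {x y} → x ≤ y → 0# ≤ y - x
  diff {x} {y} x≤y = ≤-trans (≤-reflexive (sym (-‿inverseʳ x))) (+-monoˡ-≤ (- x) x≤y)

  diff⁻¹ : ∀ {x y} → 0# ≤ y - x → x ≤ y
  diff⁻¹ {x} {y} 0≤y-x = begin
    x           ≈⟨ +-identityˡ x ⟨
    0# + x      ≤⟨ +-monoˡ-≤ x 0≤y-x ⟩
    y - x + x   ≈⟨ solve 2 (λ x y → y :- x :+ x := y) x y ⟩
    y           ∎

  ≤-by : ∀ {x y p} → y - x ≈ p → 0# ≤ p → x ≤ y
  ≤-by y-x≈p 0≤p = diff⁻¹ (≤-trans 0≤p (≤-reflexive (sym y-x≈p)))

  diff-< : ∀ {x y} → x < y → 0# < y - x
  diff-< {x} {y} (x≤y , x≉y) = diff x≤y , λ 0≈y-x → x≉y (≤-antisym x≤y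
    (≤-by (solve 2 (λ x y → x :- y := :- (y :- x)) x y)
          (≤-reflexive (trans (sym -0#≈0#) (-‿cong 0≈y-x)))))

  diff-<⁻¹ : ∀ {x y} → 0# < y - x → x < y
  diff-<⁻¹ {x} {y} (0≤y-x , 0≉y-x) = diff⁻¹ 0≤y-x ,
    λ x≈y → 0≉y-x (trans (sym (-‿inverseʳ x)) (+-congʳ x≈y))

  <-by : ∀ {x y p} → y - x ≈ p → 0# < p → x < y
  <-by y-x≈p 0<p = diff-<⁻¹ (<-≤-trans 0<p (≤-reflexive (sym y-x≈p)))

  0<+ : ∀ {x y} → 0# < x → 0# ≤ y → 0# < x + y
  0<+ {x} {y} 0<x 0≤y = <-≤-trans 0<x
    (≤-by (solve 2 (λ x y → x :+ y :- x := y) x y) 0≤y)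

  infixl 7 _0≤*_ _0<*_
  infixl 6 _0≤+_

  _0≤*_ : ∀ {x y} → 0# ≤ x → 0# ≤ y → 0# ≤ x * y
  _0≤*_ = *-nonNeg

  _0≤+_ : ∀ {x y} → 0# ≤ x → 0# ≤ y → 0# ≤ x + y
  0≤x 0≤+ 0≤y = ≤-trans (≤-reflexive (sym (+-identityˡ 0#))) (+-mono-≤ 0≤x 0≤y)

  _0<*_ : ∀ {x y} → 0# < x → 0# < y → 0# < x * y
  _0<*_ {x} {y} 0<x 0<y = *-nonNeg (<⇒≤ 0<x) (<⇒≤ 0<y) , λ 0≈xy →
    let (z , xz≈1) = inverse x (>⇒≉0 0<x) in >⇒≉0 0<y (begin-equality
      y           ≈⟨ *-identityˡ y ⟨
      1# * y      ≈⟨ *-congʳ xz≈1 ⟨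
      x * z * y   ≈⟨ solve 3 (λ x y z → x :* z :* y := x :* y :* z) x y z ⟩
      x * y * z   ≈⟨ *-congʳ 0≈xy ⟨
      0# * z      ≈⟨ zeroˡ z ⟩
      0#          ∎)

  0≤1 : 0# ≤ 1#
  0≤1 with ≤-total 0# 1#
  ... | inj₁ 0≤1 = 0≤1
  ... | inj₂ 1≤0 = ≤-trans (diff 1≤0 0≤* diff 1≤0)
    (≤-reflexive (solve 0 ((:0 :- :1) :* (:0 :- :1) := :1)))

  0<1 : 0# < 1#
  0<1 = 0≤1 , 1≉0 ∘ sym

  *-monoˡ-≤ : ∀ {x y} z → 0# ≤ z → x ≤ y → z * x ≤ z * y
  *-monoˡ-≤ {x} {y} z 0≤z x≤y =
    ≤-by (solve 3 (λ x y z → z :* y :- z :* x := z :* (y :- x)) x y z) (0≤z 0≤* diff x≤y)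

  *-monoʳ-≤ : ∀ {x y} z → 0# ≤ z → x ≤ y → x * z ≤ y * z
  *-monoʳ-≤ {x} {y} z 0≤z x≤y =
    ≤-by (solve 3 (λ x y z → y :* z :- x :* z := z :* (y :- x)) x y z) (0≤z 0≤* diff x≤y)

  *-mono-≤ : ∀ {x y u v} → 0# ≤ x → 0# ≤ v → x ≤ y → u ≤ v → x * u ≤ y * v
  *-mono-≤ {x} {y} {u} {v} 0≤x 0≤v x≤y u≤v = ≤-trans (*-monoˡ-≤ x 0≤x u≤v) (*-monoʳ-≤ v 0≤v x≤y)

  *-monoˡ-< : ∀ {x y} z → 0# < z → x < y → z * x < z * y
  *-monoˡ-< {x} {y} z 0<z x<y =
    <-by (solve 3 (λ x y z → z :* y :- z :* x := z :* (y :- x)) x y z) (0<z 0<* diff-< x<y)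

  *-cancelˡ-≤ : ∀ {x y} z → 0# < z → z * x ≤ z * y → x ≤ y
  *-cancelˡ-≤ z 0<z zx≤zy = ≮⇒≥ λ y<x → <⇒≱ (*-monoˡ-< z 0<z y<x) zx≤zy

  *-cancelʳ-≤ : ∀ {x y} z → 0# < z → x * z ≤ y * z → x ≤ y
  *-cancelʳ-≤ {x} {y} z 0<z xz≤yz =
    *-cancelˡ-≤ z 0<z (≤-trans (≤-reflexive (*-comm z x)) (≤-trans xz≤yz (≤-reflexive (*-comm y z))))

  *-cancelˡ : ∀ {x y} z → ¬ (z ≈ 0#) → z * x ≈ z * y → x ≈ y
  *-cancelˡ {x} {y} z z≉0 zx≈zy = let (w , zw≈1) = inverse z z≉0 in begin-equality
    x            ≈⟨ *-identityˡ x ⟨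
    1# * x       ≈⟨ *-congʳ zw≈1 ⟨
    z * w * x    ≈⟨ solve 3 (λ x z w → z :* w :* x := w :* (z :* x)) x z w ⟩
    w * (z * x)  ≈⟨ *-congˡ zx≈zy ⟩
    w * (z * y)  ≈⟨ solve 3 (λ x z w → z :* w :* x := w :* (z :* x)) y z w ⟨
    z * w * y    ≈⟨ *-congʳ zw≈1 ⟩
    1# * y       ≈⟨ *-identityˡ y ⟩
    y            ∎

  -‿mono-≤ : ∀ {x y} → x ≤ y → - y ≤ - x
  -‿mono-≤ {x} {y} x≤y = ≤-by (solve 2 (λ x y → :- x :- :- y := y :- x) x y) (diff x≤y)

  *-inverse : ∀ {x} → ¬ (x ≈ 0#) → x * x ⁻¹ ≈ 1#
  *-inverse {x} x≉0 = the-spec 0# (λ y → x * y ≈ 1#) (inverse x x≉0)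

  *-inverse-pos : ∀ {x} → 0# < x → x * x ⁻¹ ≈ 1#
  *-inverse-pos = *-inverse ∘ >⇒≉0

  ⁻¹-unique : ∀ {x y} → 0# < x → x * y ≈ 1# → y ≈ x ⁻¹
  ⁻¹-unique {x} 0<x xy≈1 = *-cancelˡ x (>⇒≉0 0<x) (trans xy≈1 (sym (*-inverse-pos 0<x)))

  ⁻¹-cong : ∀ {x y} → 0# < x → x ≈ y → x ⁻¹ ≈ y ⁻¹
  ⁻¹-cong 0<x x≈y = ⁻¹-unique (<-≤-trans 0<x (≤-reflexive x≈y)) (trans (*-congʳ (sym x≈y)) (*-inverse-pos 0<x))

  0<⁻¹ : ∀ {x} → 0# < x → 0# < x ⁻¹
  0<⁻¹ {x} 0<x = ≰⇒> λ x⁻¹≤0 → <⇒≱ 0<1 (begin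
    1#          ≈⟨ *-inverse-pos 0<x ⟨
    x * x ⁻¹    ≤⟨ *-monoˡ-≤ x (<⇒≤ 0<x) x⁻¹≤0 ⟩
    x * 0#      ≈⟨ zeroʳ x ⟩
    0#          ∎)

  0≤⁻¹ : ∀ {x} → 0# < x → 0# ≤ x ⁻¹
  0≤⁻¹ = <⇒≤ ∘ 0<⁻¹

  1⁻¹≈1 : 1# ⁻¹ ≈ 1#
  1⁻¹≈1 = sym (⁻¹-unique 0<1 (*-identityˡ 1#))

  ⁻¹-* : ∀ {x y} → 0# < x → 0# < y → (x * y) ⁻¹ ≈ x ⁻¹ * y ⁻¹
  ⁻¹-* {x} {y} 0<x 0<y = sym (⁻¹-unique (0<x 0<* 0<y) (begin-equality
    x * y * (x ⁻¹ * y ⁻¹)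
      ≈⟨ solve 4 (λ x y z w → x :* y :* (z :* w) := x :* z :* (y :* w)) x y _ _ ⟩
    x * x ⁻¹ * (y * y ⁻¹)   ≈⟨ *-cong (*-inverse-pos 0<x) (*-inverse-pos 0<y) ⟩
    1# * 1#                 ≈⟨ *-identityˡ 1# ⟩
    1#                      ∎))

  ⁻¹-involutive : ∀ {x} → 0# < x → x ⁻¹ ⁻¹ ≈ x
  ⁻¹-involutive {x} 0<x = sym (⁻¹-unique (0<⁻¹ 0<x) (trans (*-comm _ _) (*-inverse-pos 0<x)))

  x≤y⁻¹*z : ∀ {x y z} → 0# < y → y * x ≤ z → x ≤ y ⁻¹ * z
  x≤y⁻¹*z {x} {y} {z} 0<y yx≤z = *-cancelˡ-≤ y 0<y (begin
    y * x           ≤⟨ yx≤z ⟩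
    z               ≈⟨ *-identityˡ z ⟨
    1# * z          ≈⟨ *-congʳ (*-inverse-pos 0<y) ⟨
    y * y ⁻¹ * z    ≈⟨ *-assoc _ _ _ ⟩
    y * (y ⁻¹ * z)  ∎)

  y⁻¹*z≤x : ∀ {x y z} → 0# < y → z ≤ y * x → y ⁻¹ * z ≤ x
  y⁻¹*z≤x {x} {y} {z} 0<y z≤yx = *-cancelˡ-≤ y 0<y (begin
    y * (y ⁻¹ * z)  ≈⟨ *-assoc _ _ _ ⟨
    y * y ⁻¹ * z    ≈⟨ *-congʳ (*-inverse-pos 0<y) ⟩
    1# * z          ≈⟨ *-identityˡ z ⟩
    z               ≤⟨ z≤yx ⟩
    y * x           ∎)

  ⁻¹-antimono-≤ : ∀ {x y} → 0# < x → x ≤ y → y ⁻¹ ≤ x ⁻¹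
  ⁻¹-antimono-≤ {x} {y} 0<x x≤y = begin
    y ⁻¹                ≈⟨ *-identityʳ _ ⟨
    y ⁻¹ * 1#           ≤⟨ y⁻¹*z≤x (<-≤-trans 0<x x≤y) (begin
      1#                ≈⟨ *-inverse-pos 0<x ⟨
      x * x ⁻¹          ≤⟨ *-monoʳ-≤ (x ⁻¹) (0≤⁻¹ 0<x) x≤y ⟩
      y * x ⁻¹          ∎) ⟩
    x ⁻¹                ∎

  0≤fromℕ : ∀ n → 0# ≤ fromℕ n
  0≤fromℕ zero    = ≤-refl
  0≤fromℕ (suc n) = 0≤1 0≤+ 0≤fromℕ n

  fromℕ-mono-≤ : ∀ {m n} → m ℕ.≤ n → fromℕ m ≤ fromℕ n
  fromℕ-mono-≤ {n = n} ℕ.z≤n   = 0≤fromℕ n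
  fromℕ-mono-≤ (ℕ.s≤s m≤n)     = +-monoʳ-≤ 1# (fromℕ-mono-≤ m≤n)

  fromℕ-mono-< : ∀ {m n} → m ℕ.< n → fromℕ m < fromℕ n
  fromℕ-mono-< {m} {n} m<n = <-≤-trans
    (<-by (solve 1 (λ m → :1 :+ m :- m := :1) (fromℕ m)) 0<1) (fromℕ-mono-≤ m<n)

  fromℕ-cancel-< : ∀ {m n} → fromℕ m < fromℕ n → m ℕ.< n
  fromℕ-cancel-< fm<fn = ℕ.≰⇒> λ n≤m → <⇒≱ fm<fn (fromℕ-mono-≤ n≤m)

  0<fromℕ : ∀ {n} → 0 ℕ.< n → 0# < fromℕ n
  0<fromℕ = fromℕ-mono-<

  1≤fromℕ : ∀ {n} → 0 ℕ.< n → 1# ≤ fromℕ n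
  1≤fromℕ 0<n = ≤-trans (≤-reflexive (sym (+-identityʳ 1#))) (fromℕ-mono-≤ {1} 0<n)

  fromℕ-∸ : ∀ {m n} → m ℕ.≤ n → fromℕ (n ℕ.∸ m) ≈ fromℕ n - fromℕ m
  fromℕ-∸ {m} {n} m≤n = begin-equality
    fromℕ (n ℕ.∸ m)                     ≈⟨ solve 2 (λ d m → d := m :+ d :- m) _ (fromℕ m) ⟩
    fromℕ m + fromℕ (n ℕ.∸ m) - fromℕ m ≈⟨ +-congʳ (fromℕ-+ m _) ⟨
    fromℕ (m ℕ.+ (n ℕ.∸ m)) - fromℕ m   ≈⟨ +-congʳ (fromℕ-cong (ℕ.m+[n∸m]≡n m≤n)) ⟩
    fromℕ n - fromℕ m                   ∎

  -- If s = sup ℕ, then s − 1 is an upper bound of ℕ as well.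
  ℕ-unbounded : ∀ x → ∃ λ n → x ≤ fromℕ n
  ℕ-unbounded x with em {P = ∃ λ n → x ≤ fromℕ n}
  ... | yes p = p
  ... | no ¬p = ⊥-elim (<⇒≱ s-1<s (s-least (s - 1#) s-1-bound))
    where
    IsNat : Pred ℝ 0ℓ
    IsNat y = ∃ λ n → y ≈ fromℕ n

    sup = complete IsNat (0# , 0 , refl)
      (x , λ { (y , n , y≈n) → ≤-trans (≤-reflexive y≈n) (<⇒≤ (≰⇒> λ x≤n → ¬p (n , x≤n))) })

    s = proj₁ sup
    s-least = proj₂ (proj₂ sup)

    s-1<s : s - 1# < s
    s-1<s = <-by (solve 1 (λ s → s :- (s :- :1) := :1) s) 0<1

    s-1-bound : IsUpperBound _≤_ (proj₁ {B = IsNat}) (s - 1#)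
    s-1-bound (y , n , y≈n) = begin
      y                     ≈⟨ y≈n ⟩
      fromℕ n               ≈⟨ solve 1 (λ n → n := :1 :+ n :- :1) _ ⟩
      fromℕ (suc n) - 1# ≤⟨ +-monoˡ-≤ (- 1#) (proj₁ (proj₂ sup) (fromℕ (suc n) , suc n , refl)) ⟩
      s - 1#                ∎

  -- Abstract, lest the number found be unfolded down to an instance of em.
  abstract
    archimedean : ∀ x → ∃ λ n → x ≤ fromℕ n
    archimedean = ℕ-unbounded

  least : (P : ℕ → Set) → ∀ n → P n → ∃ λ m → P m × (∀ k → k ℕ.< m → ¬ P k)
  least P zero    p = 0 , p , λ _ ()
  least P (suc n) p with em {P = P 0}
  ... | yes p₀ = 0 , p₀ , λ _ ()
  ... | no ¬p₀ = let (m , pm , min) = least (P ∘ suc) n p in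
    suc m , pm , λ { zero _ → ¬p₀ ; (suc k) (ℕ.s≤s k<m) → min k k<m }

  floor : ∀ x → 0# ≤ x → ∃ λ n → fromℕ n ≤ x × x < fromℕ (suc n)
  floor x 0≤x = let (n , x+1≤n) = archimedean (x + 1#) in
    below (least (λ k → x < fromℕ k) n (<-≤-trans (<-by (solve 1 (λ x → x :+ :1 :- x := :1) x) 0<1) x+1≤n))
    where
    below : (∃ λ m → x < fromℕ m × (∀ k → k ℕ.< m → ¬ (x < fromℕ k))) → ∃ λ n → fromℕ n ≤ x × x < fromℕ (suc n)
    below (zero  , x<0 , _)   = ⊥-elim (<⇒≱ x<0 0≤x)
    below (suc m , x<m , min) = m , ≮⇒≥ (min m ℕ.≤-refl) , x<m

  -- Absolute value

  open MaxOp (Max.maxOperator totalOrder) using (x≤x⊔y; x≤y⊔x; ⊔-lub)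

  ∣∣-lub : ∀ {x y} → x ≤ y → - x ≤ y → ∣ x ∣ ≤ y
  ∣∣-lub = ⊔-lub

  x≤∣x∣ : ∀ x → x ≤ ∣ x ∣
  x≤∣x∣ x = x≤x⊔y x (- x)

  -x≤∣x∣ : ∀ x → - x ≤ ∣ x ∣
  -x≤∣x∣ x = x≤y⊔x x (- x)

  0≤∣x∣ : ∀ x → 0# ≤ ∣ x ∣
  0≤∣x∣ x with ≤-total 0# x
  ... | inj₁ 0≤x = ≤-trans 0≤x (x≤∣x∣ x)
  ... | inj₂ x≤0 = ≤-trans (≤-trans (≤-reflexive (sym -0#≈0#)) (-‿mono-≤ x≤0)) (-x≤∣x∣ x)

  ∣∣-nonNeg : ∀ {x} → 0# ≤ x → ∣ x ∣ ≈ x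
  ∣∣-nonNeg {x} 0≤x = ≤-antisym
    (∣∣-lub ≤-refl (≤-by (solve 1 (λ x → x :- :- x := x :+ x) x) (0≤x 0≤+ 0≤x))) (x≤∣x∣ x)

  ∣∣-cong : ∀ {x y} → x ≈ y → ∣ x ∣ ≈ ∣ y ∣
  ∣∣-cong {x} {y} x≈y = ≤-antisym (half x≈y) (half (sym x≈y))
    where
    half : ∀ {x y} → x ≈ y → ∣ x ∣ ≤ ∣ y ∣
    half {x} {y} x≈y = ∣∣-lub (≤-trans (≤-reflexive x≈y) (x≤∣x∣ y))
      (≤-trans (≤-reflexive (-‿cong x≈y)) (-x≤∣x∣ y))

  ∣-x∣≈∣x∣ : ∀ x → ∣ - x ∣ ≈ ∣ x ∣
  ∣-x∣≈∣x∣ x = ≤-antisym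
    (∣∣-lub (-x≤∣x∣ x) (≤-trans (≤-reflexive (-‿involutive x)) (x≤∣x∣ x)))
    (∣∣-lub (≤-trans (≤-reflexive (sym (-‿involutive x))) (-x≤∣x∣ (- x))) (x≤∣x∣ (- x)))

  ∣x-y∣≈∣y-x∣ : ∀ x y → ∣ x - y ∣ ≈ ∣ y - x ∣
  ∣x-y∣≈∣y-x∣ x y = trans (sym (∣-x∣≈∣x∣ (x - y)))
    (∣∣-cong (solve 2 (λ x y → :- (x :- y) := y :- x) x y))

  ∣x+y∣≤∣x∣+∣y∣ : ∀ x y → ∣ x + y ∣ ≤ ∣ x ∣ + ∣ y ∣
  ∣x+y∣≤∣x∣+∣y∣ x y = ∣∣-lub (+-mono-≤ (x≤∣x∣ x) (x≤∣x∣ y))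
    (≤-trans (≤-reflexive (sym (-‿+-comm x y))) (+-mono-≤ (-x≤∣x∣ x) (-x≤∣x∣ y)))

  ∣x*y∣≤∣x∣*∣y∣ : ∀ x y → ∣ x * y ∣ ≤ ∣ x ∣ * ∣ y ∣
  ∣x*y∣≤∣x∣*∣y∣ x y with ≤-total 0# x
  ... | inj₁ 0≤x = ≤-trans (∣∣-lub
      (*-monoˡ-≤ x 0≤x (x≤∣x∣ y))
      (≤-trans (≤-reflexive (-‿distribʳ-* x y)) (*-monoˡ-≤ x 0≤x (-x≤∣x∣ y))))
    (*-monoʳ-≤ ∣ y ∣ (0≤∣x∣ y) (x≤∣x∣ x))
  ... | inj₂ x≤0 = ≤-trans (∣∣-lub
      (≤-trans (≤-reflexive (solve 2 (λ x y → x :* y := (:0 :- x) :* (:- y)) x y))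
               (*-monoˡ-≤ (0# - x) (diff x≤0) (-x≤∣x∣ y)))
      (≤-trans (≤-reflexive (solve 2 (λ x y → :- (x :* y) := (:0 :- x) :* y) x y))
               (*-monoˡ-≤ (0# - x) (diff x≤0) (x≤∣x∣ y))))
    (*-monoʳ-≤ ∣ y ∣ (0≤∣x∣ y) (≤-trans (≤-reflexive (+-identityˡ (- x))) (-x≤∣x∣ x)))

  half : ℝ
  half = fromℕ 2 ⁻¹

  0<2 : 0# < fromℕ 2
  0<2 = 0<fromℕ {2} (ℕ.s≤s ℕ.z≤n)

  0<half : 0# < half
  0<half = 0<⁻¹ 0<2

  half+half : half + half ≈ 1#
  half+half = trans (solve 1 (λ h → h :+ h := con 2 :* h) half) (*-inverse-pos 0<2)

  -- Finite sums and indicator functions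

  ∑ : ℕ → (ℕ → ℝ) → ℝ
  ∑ zero    f = 0#
  ∑ (suc n) f = ∑ n f + f n

  ∑-mono : ∀ n {f g} → (∀ i → i ℕ.< n → f i ≤ g i) → ∑ n f ≤ ∑ n g
  ∑-mono zero    f≤g = ≤-refl
  ∑-mono (suc n) f≤g = +-mono-≤ (∑-mono n (λ i i<n → f≤g i (ℕ.m<n⇒m<1+n i<n))) (f≤g n (ℕ.n<1+n n))

  ∑-cong : ∀ n {f g} → (∀ i → i ℕ.< n → f i ≈ g i) → ∑ n f ≈ ∑ n g
  ∑-cong n f≈g = ≤-antisym (∑-mono n (λ i i<n → ≤-reflexive (f≈g i i<n)))
                           (∑-mono n (λ i i<n → ≤-reflexive (sym (f≈g i i<n))))

  ∑-const : ∀ n c → ∑ n (λ _ → c) ≈ fromℕ n * c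
  ∑-const zero    c = sym (zeroˡ c)
  ∑-const (suc n) c = trans (+-congʳ (∑-const n c))
    (solve 2 (λ n c → n :* c :+ c := (:1 :+ n) :* c) (fromℕ n) c)

  ∑-≤ : ∀ n {f c} → (∀ i → i ℕ.< n → f i ≤ c) → ∑ n f ≤ fromℕ n * c
  ∑-≤ n {c = c} f≤c = ≤-trans (∑-mono n f≤c) (≤-reflexive (∑-const n c))

  ∑-nonNeg : ∀ n {f} → (∀ i → i ℕ.< n → 0# ≤ f i) → 0# ≤ ∑ n f
  ∑-nonNeg n 0≤f = ≤-trans (≤-reflexive (sym (trans (∑-const n 0#) (zeroʳ _)))) (∑-mono n 0≤f)

  ∑-+ : ∀ n f g → ∑ n (λ i → f i + g i) ≈ ∑ n f + ∑ n g
  ∑-+ zero    f g = sym (+-identityˡ 0#)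
  ∑-+ (suc n) f g = trans (+-congʳ (∑-+ n f g))
    (solve 4 (λ a b c d → a :+ b :+ (c :+ d) := a :+ c :+ (b :+ d)) _ _ _ _)

  ∑-*ˡ : ∀ n c f → ∑ n (λ i → c * f i) ≈ c * ∑ n f
  ∑-*ˡ zero    c f = sym (zeroʳ c)
  ∑-*ˡ (suc n) c f = trans (+-congʳ (∑-*ˡ n c f)) (sym (distribˡ c _ _))

  ∑-*ʳ : ∀ n c f → ∑ n (λ i → f i * c) ≈ ∑ n f * c
  ∑-*ʳ n c f = trans (∑-cong n (λ i _ → *-comm _ _)) (trans (∑-*ˡ n c f) (*-comm _ _))

  ∑-swap : ∀ m n (f : ℕ → ℕ → ℝ) → ∑ m (λ i → ∑ n (f i)) ≈ ∑ n (λ j → ∑ m (λ i → f i j))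
  ∑-swap zero    n f = sym (trans (∑-const n 0#) (zeroʳ _))
  ∑-swap (suc m) n f = trans (+-congʳ (∑-swap m n f)) (sym (∑-+ n _ _))

  ∑-split : ∀ m n f → ∑ (m ℕ.+ n) f ≈ ∑ m f + ∑ n (λ i → f (m ℕ.+ i))
  ∑-split m zero f = trans (reflexive (≡.cong (λ k → ∑ k f) (ℕ.+-identityʳ m))) (sym (+-identityʳ _))
  ∑-split m (suc n) f = trans (reflexive (≡.cong (λ k → ∑ k f) (ℕ.+-suc m n)))
    (trans (+-congʳ (∑-split m n f)) (+-assoc _ _ _))

  ∑-blocks : ∀ m n f → ∑ (m ℕ.* n) f ≈ ∑ m (λ d → ∑ n (λ r → f (d ℕ.* n ℕ.+ r)))
  ∑-blocks zero    n f = refl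
  ∑-blocks (suc m) n f = begin-equality
    ∑ (n ℕ.+ m ℕ.* n) f ≡⟨ ≡.cong (λ k → ∑ k f) (ℕ.+-comm n (m ℕ.* n)) ⟩
    ∑ (m ℕ.* n ℕ.+ n) f                                 ≈⟨ ∑-split (m ℕ.* n) n f ⟩
    ∑ (m ℕ.* n) f + ∑ n (λ r → f (m ℕ.* n ℕ.+ r))       ≈⟨ +-congʳ (∑-blocks m n f) ⟩
    ∑ (suc m) (λ d → ∑ n (λ r → f (d ℕ.* n ℕ.+ r)))     ∎

  ∑-front : ∀ n f → ∑ (suc n) f ≈ f 0 + ∑ n (f ∘ suc)
  ∑-front zero    f = +-comm _ _
  ∑-front (suc n) f = trans (+-congʳ (∑-front n f)) (+-assoc _ _ _)

  ∑-monoˡ : ∀ {m n f} → m ℕ.≤ n → (∀ i → 0# ≤ f i) → ∑ m f ≤ ∑ n f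
  ∑-monoˡ {m} {n} {f} m≤n 0≤f = begin
    ∑ m f                                     ≈⟨ +-identityʳ _ ⟨
    ∑ m f + 0# ≤⟨ +-monoʳ-≤ _ (∑-nonNeg (n ℕ.∸ m) (λ i _ → 0≤f _)) ⟩
    ∑ m f + ∑ (n ℕ.∸ m) (λ i → f (m ℕ.+ i))   ≈⟨ ∑-split m (n ℕ.∸ m) f ⟨
    ∑ (m ℕ.+ (n ℕ.∸ m)) f                     ≡⟨ ≡.cong (λ k → ∑ k f) (ℕ.m+[n∸m]≡n m≤n) ⟩
    ∑ n f                                     ∎

  term≤∑ : ∀ {n f i} → i ℕ.< n → (∀ i → 0# ≤ f i) → f i ≤ ∑ n f
  term≤∑ {n} {f} {i} i<n 0≤f = begin
    f i            ≈⟨ +-identityˡ _ ⟨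
    0# + f i       ≤⟨ +-monoˡ-≤ (f i) (∑-nonNeg i (λ j _ → 0≤f j)) ⟩
    ∑ (suc i) f    ≤⟨ ∑-monoˡ i<n 0≤f ⟩
    ∑ n f          ∎

  ∑-telescope : ∀ n {f} (g : ℕ → ℝ) → (∀ i → i ℕ.< n → f i ≤ g i - g (suc i)) → ∑ n f ≤ g 0 - g n
  ∑-telescope zero    g f≤ = ≤-reflexive (sym (-‿inverseʳ _))
  ∑-telescope (suc n) g f≤ = ≤-trans
    (+-mono-≤ (∑-telescope n g (λ i i<n → f≤ i (ℕ.m<n⇒m<1+n i<n))) (f≤ n (ℕ.n<1+n n)))
    (≤-reflexive (solve 3 (λ a b c → a :- b :+ (b :- c) := a :- c) _ _ _))

  sum≈∑ : ∀ n f → sum {n} (f ∘ toℕ) ≈ ∑ n f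
  sum≈∑ zero    f = refl
  sum≈∑ (suc n) f = trans (+-congˡ (sum≈∑ n (f ∘ suc))) (sym (∑-front n f))

  ∣∑∣≤∑∣∣ : ∀ n f → ∣ ∑ n f ∣ ≤ ∑ n (λ i → ∣ f i ∣)
  ∣∑∣≤∑∣∣ zero    f = ≤-reflexive (∣∣-nonNeg ≤-refl)
  ∣∑∣≤∑∣∣ (suc n) f = ≤-trans (∣x+y∣≤∣x∣+∣y∣ _ _) (+-monoˡ-≤ _ (∣∑∣≤∑∣∣ n f))

  -- Finite sets are counted by summing indicators in `ℝ`. The predicates counted are decided only
  -- by `em`, and every counting argument becomes an inequality between double sums.
  𝟙 : ∀ {p} → Set p → ℝ
  𝟙 P = if does (em {P = P}) then 1# else 0#

  𝟙-true : ∀ {p} {P : Set p} → P → 𝟙 P ≈ 1#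
  𝟙-true {P = P} p with em {P = P}
  ... | yes _ = refl
  ... | no ¬p = ⊥-elim (¬p p)

  𝟙-false : ∀ {p} {P : Set p} → ¬ P → 𝟙 P ≈ 0#
  𝟙-false {P = P} ¬p with em {P = P}
  ... | yes p = ⊥-elim (¬p p)
  ... | no  _ = refl

  𝟙≤ : ∀ {p} {P : Set p} {x} → 0# ≤ x → (P → 1# ≤ x) → 𝟙 P ≤ x
  𝟙≤ {P = P} 0≤x 1≤x with em {P = P}
  ... | yes p = 1≤x p
  ... | no  _ = 0≤x

  0≤𝟙 : ∀ {p} (P : Set p) → 0# ≤ 𝟙 P
  0≤𝟙 P with em {P = P}
  ... | yes _ = 0≤1
  ... | no  _ = ≤-refl

  𝟙-mono : ∀ {p q} {P : Set p} {Q : Set q} → (P → Q) → 𝟙 P ≤ 𝟙 Q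
  𝟙-mono P⇒Q = 𝟙≤ (0≤𝟙 _) (λ p → ≤-reflexive (sym (𝟙-true (P⇒Q p))))

  ≤𝟙* : ∀ {p} {P : Set p} {x y} → (P → x ≤ y) → (¬ P → x ≤ 0#) → x ≤ 𝟙 P * y
  ≤𝟙* {P = P} x≤y x≤0 with em {P = P}
  ... | yes p = ≤-trans (x≤y p) (≤-reflexive (sym (*-identityˡ _)))
  ... | no ¬p = ≤-trans (x≤0 ¬p) (≤-reflexive (sym (zeroˡ _)))

  𝟙-⊎ : ∀ {p q} (P : Set p) (Q : Set q) → 𝟙 (P ⊎ Q) ≤ 𝟙 P + 𝟙 Q
  𝟙-⊎ P Q = 𝟙≤ (0≤𝟙 P 0≤+ 0≤𝟙 Q) λ
    { (inj₁ p) → ≤-by (trans (+-congʳ (+-congʳ (𝟙-true p))) (solve 1 (λ q → :1 :+ q :- :1 := q) _)) (0≤𝟙 Q)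
    ; (inj₂ q) → ≤-by (trans (+-congʳ (+-congˡ (𝟙-true q))) (solve 1 (λ p → p :+ :1 :- :1 := p) _)) (0≤𝟙 P) }

  𝟙-∃ : ∀ {p} n (P : ℕ → Set p) → 𝟙 (∃ λ i → i ℕ.< n × P i) ≤ ∑ n (λ i → 𝟙 (P i))
  𝟙-∃ n P = 𝟙≤ (∑-nonNeg n (λ i _ → 0≤𝟙 (P i)))
    λ { (i , i<n , p) → ≤-trans (≤-reflexive (sym (𝟙-true p))) (term≤∑ i<n (λ i → 0≤𝟙 (P i))) }

  𝟙-× : ∀ {p q} (P : Set p) (Q : Set q) → 𝟙 (P × Q) ≤ 𝟙 P * 𝟙 Q
  𝟙-× P Q = ≤𝟙* (λ _ → 𝟙-mono proj₂) (λ ¬p → ≤-reflexive (𝟙-false (¬p ∘ proj₁)))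

  𝟙-∖ : ∀ {p q} (P : Set p) (Q : Set q) → 𝟙 P - 𝟙 (P × Q) ≤ 𝟙 (P × ¬ Q)
  𝟙-∖ P Q = ≤-by (solve 3 (λ a b c → a :- (b :- c) := a :+ c :- b) _ _ _)
    (diff (𝟙≤ (0≤𝟙 _ 0≤+ 0≤𝟙 _) λ p → case p (em {P = Q})))
    where
    case : P → Dec Q → 1# ≤ 𝟙 (P × ¬ Q) + 𝟙 (P × Q)
    case p (yes q) = ≤-by (trans (+-congʳ (+-congˡ (𝟙-true (p , q)))) (solve 1 (λ p → p :+ :1 :- :1 := p) _)) (0≤𝟙 _)
    case p (no ¬q) = ≤-by (trans (+-congʳ (+-congʳ (𝟙-true (p , ¬q)))) (solve 1 (λ p → :1 :+ p :- :1 := p) _)) (0≤𝟙 _)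

  ∑𝟙≤1 : ∀ {p} n (P : ℕ → Set p) → (∀ i j → i ℕ.< j → j ℕ.< n → P i → P j → ⊥) → ∑ n (λ i → 𝟙 (P i)) ≤ 1#
  ∑𝟙≤1 zero    P unique = 0≤1
  ∑𝟙≤1 (suc n) P unique with em {P = P n}
  ... | no  _ = ≤-trans (≤-reflexive (+-identityʳ _))
    (∑𝟙≤1 n P (λ i j i<j j<n → unique i j i<j (ℕ.m<n⇒m<1+n j<n)))
  ... | yes p = ≤-reflexive (trans (+-congʳ (trans
    (∑-cong n (λ i i<n → 𝟙-false (λ pᵢ → unique i n i<n (ℕ.n<1+n n) pᵢ p)))
    (trans (∑-const n 0#) (zeroʳ _)))) (+-identityˡ 1#))

  -- Each bucket [x + b s, x + (b + 1) s) holds at most one of the points.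
  separated-count : ∀ {p} n (P : ℕ → Set p) (f : ℕ → ℝ) {s x y} → 0# < s → x ≤ y →
    (∀ i j → i ℕ.< j → j ℕ.< n → P i → P j → s ≤ ∣ f j - f i ∣) →
    (∀ i → i ℕ.< n → P i → x ≤ f i × f i ≤ y) →
    s * ∑ n (λ i → 𝟙 (P i)) ≤ y - x + s
  separated-count n P f {s} {x} {y} 0<s x≤y sep bounds = begin
    s * ∑ n (λ i → 𝟙 (P i))                               ≤⟨ *-monoˡ-≤ s (<⇒≤ 0<s) count≤ ⟩
    s * fromℕ (suc B) ≈⟨ solve 2 (λ s b → s :* (:1 :+ b) := s :* b :+ s) s _ ⟩
    s * fromℕ B + s ≤⟨ +-monoˡ-≤ s (*-monoˡ-≤ s (<⇒≤ 0<s) B≤) ⟩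
    s * (s ⁻¹ * (y - x)) + s                              ≈⟨ +-congʳ (s*[s⁻¹*z] (y - x)) ⟩
    y - x + s                                             ∎
    where
    ⌊y-x/s⌋ = floor (s ⁻¹ * (y - x)) (0≤⁻¹ 0<s 0≤* diff x≤y)
    B    = proj₁ ⌊y-x/s⌋
    B≤   = proj₁ (proj₂ ⌊y-x/s⌋)
    <1+B = proj₂ (proj₂ ⌊y-x/s⌋)

    s*[s⁻¹*z] : ∀ z → s * (s ⁻¹ * z) ≈ z
    s*[s⁻¹*z] z = trans (sym (*-assoc _ _ _)) (trans (*-congʳ (*-inverse-pos 0<s)) (*-identityˡ z))

    g : ℕ → ℝ
    g i = s ⁻¹ * (f i - x)

    Bucket : ℕ → ℕ → Set _
    Bucket b i = P i × fromℕ b ≤ g i × g i < fromℕ (suc b)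

    s*g-diff : ∀ i j → s * (g i - g j) ≈ f i - f j
    s*g-diff i j = begin-equality
      s * (g i - g j)           ≈⟨ solve 3 (λ s a b → s :* (a :- b) := s :* a :- s :* b) s _ _ ⟩
      s * g i - s * g j         ≈⟨ +-cong (s*[s⁻¹*z] _) (-‿cong (s*[s⁻¹*z] _)) ⟩
      f i - x - (f j - x)       ≈⟨ solve 3 (λ a b x → a :- x :- (b :- x) := a :- b) _ _ x ⟩
      f i - f j                 ∎

    close-in-bucket : ∀ {b i j} → fromℕ b ≤ g j → g i < fromℕ (suc b) → f i - f j < s
    close-in-bucket {b} {i} {j} b≤ <1+b = ≤-<-trans (≤-reflexive (sym (s*g-diff i j)))
      (<-≤-trans (*-monoˡ-< s 0<s (<-by
        (solve 3 (λ u v b → :1 :- (u :- v) := (:1 :+ b :- u) :+ (v :- b)) _ _ (fromℕ b))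
        (0<+ (diff-< <1+b) (diff b≤)))) (≤-reflexive (*-identityʳ s)))

    bucket≤1 : ∀ b → ∑ n (λ i → 𝟙 (Bucket b i)) ≤ 1#
    bucket≤1 b = ∑𝟙≤1 n (Bucket b) λ { i j i<j j<n (pᵢ , b≤ᵢ , <bᵢ) (pⱼ , b≤ⱼ , <bⱼ) →
      [ (λ ≤s → <⇒≱ (close-in-bucket {b} b≤ᵢ <bⱼ) (≤-trans (sep i j i<j j<n pᵢ pⱼ) ≤s))
      , (λ ≤s → <⇒≱ (close-in-bucket {b} b≤ⱼ <bᵢ) (≤-trans (sep i j i<j j<n pᵢ pⱼ) ≤s))
      ]′ (∣∣-cases (f j - f i) (f i - f j) (solve 2 (λ a b → :- (a :- b) := b :- a) _ _)) }
      where
      ∣∣-cases : ∀ u v → - u ≈ v → ∣ u ∣ ≤ u ⊎ ∣ u ∣ ≤ v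
      ∣∣-cases u v -u≈v with ≤-total u (- u)
      ... | inj₁ u≤-u = inj₂ (≤-trans (∣∣-lub u≤-u ≤-refl) (≤-reflexive -u≈v))
      ... | inj₂ -u≤u = inj₁ (∣∣-lub ≤-refl -u≤u)

    count≤ : ∑ n (λ i → 𝟙 (P i)) ≤ fromℕ (suc B)
    count≤ = begin
      ∑ n (λ i → 𝟙 (P i))
        ≤⟨ ∑-mono n (λ i i<n → ≤-trans (𝟙-mono (in-bucket i i<n)) (𝟙-∃ (suc B) (λ b → Bucket b i))) ⟩
      ∑ n (λ i → ∑ (suc B) (λ b → 𝟙 (Bucket b i)))    ≈⟨ ∑-swap n (suc B) _ ⟩
      ∑ (suc B) (λ b → ∑ n (λ i → 𝟙 (Bucket b i)))    ≤⟨ ∑-≤ (suc B) (λ b _ → bucket≤1 b) ⟩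
      fromℕ (suc B) * 1#                              ≈⟨ *-identityʳ _ ⟩
      fromℕ (suc B)                                   ∎
      where
      in-bucket : ∀ i → i ℕ.< n → P i → ∃ λ b → b ℕ.< suc B × Bucket b i
      in-bucket i i<n p =
        let (x≤ , ≤y) = bounds i i<n p
            (b , b≤ , <b) = floor (g i) (0≤⁻¹ 0<s 0≤* diff x≤)
        in b , fromℕ-cancel-< (≤-<-trans b≤ (≤-<-trans (*-monoˡ-≤ _ (0≤⁻¹ 0<s) (+-monoˡ-≤ (- x) ≤y)) <1+B))
         , p , b≤ , <b

  -- Limits

  ≤-by-ε : ∀ {x y} → (∀ ε → 0# < ε → x ≤ y + ε) → x ≤ y
  ≤-by-ε {x} {y} x≤y+ε with ≤-or-> x y
  ... | inj₁ x≤y = x≤y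
  ... | inj₂ y<x = ⊥-elim (<⇒≱ y+ε<x (x≤y+ε _ 0<ε))
    where
    0<ε : 0# < half * (x - y)
    0<ε = 0<half 0<* diff-< y<x

    y+ε<x : y + half * (x - y) < x
    y+ε<x = <-by (begin-equality
      x - (y + half * (x - y)) ≈⟨ solve 3 (λ x y h → x :- (y :+ h :* (x :- y)) := (:1 :- h) :* (x :- y)) x y half ⟩
      (1# - half) * (x - y)                               ≈⟨ *-congʳ (+-congʳ half+half) ⟨
      (half + half - half) * (x - y) ≈⟨ solve 3 (λ x y h → (h :+ h :- h) :* (x :- y) := h :* (x :- y)) x y half ⟩
      half * (x - y)                                      ∎) 0<ε

  ∣∣<-upper : ∀ {x y ε} → ∣ x - y ∣ < ε → x ≤ y + ε
  ∣∣<-upper {x} {y} {ε} p = ≤-by (solve 3 (λ x y ε → y :+ ε :- x := ε :- (x :- y)) x y ε)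
    (diff (≤-trans (x≤∣x∣ _) (<⇒≤ p)))

  ∣∣<-lower : ∀ {x y ε} → ∣ x - y ∣ < ε → y ≤ x + ε
  ∣∣<-lower {x} {y} {ε} p = ∣∣<-upper (≤-<-trans (≤-reflexive (∣x-y∣≈∣y-x∣ y x)) p)

  ⟶-cong : ∀ {u v l} → (∀ n → u n ≈ v n) → u ⟶ l → v ⟶ l
  ⟶-cong u≈v u⟶l ε 0<ε = let (N , close) = u⟶l ε 0<ε in
    N , λ n N≤n → ≤-<-trans (≤-reflexive (∣∣-cong (+-congʳ (sym (u≈v n))))) (close n N≤n)

  ⟶-upper : ∀ {u l c} N → u ⟶ l → (∀ n → N ℕ.≤ n → u n ≤ c) → l ≤ c
  ⟶-upper {u} N u⟶l u≤c = ≤-by-ε λ ε 0<ε → let (M , close) = u⟶l ε 0<ε ; n = N ℕ.⊔ M in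
    ≤-trans (∣∣<-lower (close n (ℕ.m≤n⊔m N M))) (+-monoˡ-≤ ε (u≤c n (ℕ.m≤m⊔n N M)))

  ⟶-lower : ∀ {u l c} N → u ⟶ l → (∀ n → N ℕ.≤ n → c ≤ u n) → c ≤ l
  ⟶-lower {u} N u⟶l c≤u = ≤-by-ε λ ε 0<ε → let (M , close) = u⟶l ε 0<ε ; n = N ℕ.⊔ M in
    ≤-trans (c≤u n (ℕ.m≤m⊔n N M)) (∣∣<-upper (close n (ℕ.m≤n⊔m N M)))

  ⟶-unique : ∀ {u l m} → u ⟶ l → u ⟶ m → l ≈ m
  ⟶-unique p q = ≤-antisym (half-unique p q) (half-unique q p)
    where
    half-unique : ∀ {u l m} → u ⟶ l → u ⟶ m → l ≤ m
    half-unique p q = ≤-by-ε λ ε 0<ε → let (N , close) = q ε 0<ε in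
      ⟶-upper N p (λ n N≤n → ∣∣<-upper (close n N≤n))

  ε/2+ε/2 : ∀ ε → half * ε + half * ε ≈ ε
  ε/2+ε/2 ε = trans (sym (distribʳ ε half half)) (trans (*-congʳ half+half) (*-identityˡ ε))

  ⟶-- : ∀ {u v l m} → u ⟶ l → v ⟶ m → (λ n → u n - v n) ⟶ (l - m)
  ⟶-- {u} {v} {l} {m} u⟶l v⟶m ε 0<ε =
    let (N , u-close) = u⟶l (half * ε) (0<half 0<* 0<ε) ; (M , v-close) = v⟶m (half * ε) (0<half 0<* 0<ε) in
    N ℕ.⊔ M , λ n N⊔M≤n → begin-strict
      ∣ u n - v n - (l - m) ∣
        ≈⟨ ∣∣-cong (solve 4 (λ u v l m → u :- v :- (l :- m) := u :- l :+ (m :- v)) (u n) (v n) l m) ⟩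
      ∣ u n - l + (m - v n) ∣             ≤⟨ ∣x+y∣≤∣x∣+∣y∣ _ _ ⟩
      ∣ u n - l ∣ + ∣ m - v n ∣           ≈⟨ +-congˡ (∣x-y∣≈∣y-x∣ m (v n)) ⟩
      ∣ u n - l ∣ + ∣ v n - m ∣ ≤⟨ +-monoʳ-≤ _ (<⇒≤ (v-close n (ℕ.≤-trans (ℕ.m≤n⊔m N M) N⊔M≤n))) ⟩
      ∣ u n - l ∣ + half * ε <⟨ diff-<⁻¹ (<-≤-trans (diff-< (u-close n (ℕ.≤-trans (ℕ.m≤m⊔n N M) N⊔M≤n)))
                                              (≤-reflexive (solve 2 (λ h a → h :- a := h :+ h :- (a :+ h)) (half * ε) ∣ u n - l ∣))) ⟩
      half * ε + half * ε                 ≈⟨ ε/2+ε/2 ε ⟩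
      ε                                   ∎

  ⟶-* : ∀ {u v l m} → u ⟶ l → v ⟶ m → (λ n → u n * v n) ⟶ (l * m)
  ⟶-* {u} {v} {l} {m} u⟶l v⟶m ε 0<ε =
    let (N , u-close) = u⟶l δ 0<δ ; (M , v-close) = v⟶m δ 0<δ in N ℕ.⊔ M , λ n N⊔M≤n →
      let p = <⇒≤ (u-close n (ℕ.≤-trans (ℕ.m≤m⊔n N M) N⊔M≤n))
          q = <⇒≤ (v-close n (ℕ.≤-trans (ℕ.m≤n⊔m N M) N⊔M≤n))
      in begin-strict
      ∣ u n * v n - l * m ∣
        ≈⟨ ∣∣-cong (solve 4 (λ u v l m → u :* v :- l :* m := (u :- l) :* (v :- m) :+ (l :* (v :- m) :+ m :* (u :- l))) (u n) (v n) l m) ⟩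
      ∣ (u n - l) * (v n - m) + (l * (v n - m) + m * (u n - l)) ∣
        ≤⟨ ≤-trans (∣x+y∣≤∣x∣+∣y∣ _ _) (+-monoʳ-≤ _ (∣x+y∣≤∣x∣+∣y∣ _ _)) ⟩
      ∣ (u n - l) * (v n - m) ∣ + (∣ l * (v n - m) ∣ + ∣ m * (u n - l) ∣)
        ≤⟨ +-mono-≤ (∣x*y∣≤∣x∣*∣y∣ _ _) (+-mono-≤ (∣x*y∣≤∣x∣*∣y∣ _ _) (∣x*y∣≤∣x∣*∣y∣ _ _)) ⟩
      ∣ u n - l ∣ * ∣ v n - m ∣ + (∣ l ∣ * ∣ v n - m ∣ + ∣ m ∣ * ∣ u n - l ∣)
        ≤⟨ +-mono-≤ (*-mono-≤ (0≤∣x∣ _) (<⇒≤ 0<δ) (≤-trans p δ≤1) q)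
             (+-mono-≤ (*-monoˡ-≤ _ (0≤∣x∣ l) q) (*-monoˡ-≤ _ (0≤∣x∣ m) p)) ⟩
      1# * δ + (∣ l ∣ * δ + ∣ m ∣ * δ)
        <⟨ <-by (solve 4 (λ ε l m δ → ε :* δ :+ (:1 :+ l :+ m) :* δ :- (:1 :* δ :+ (l :* δ :+ m :* δ)) := ε :* δ) ε ∣ l ∣ ∣ m ∣ δ) (0<ε 0<* 0<δ) ⟩
      ε * δ + (1# + ∣ l ∣ + ∣ m ∣) * δ      ≈⟨ distribʳ _ _ _ ⟨
      D * (ε * D ⁻¹) ≈⟨ solve 3 (λ d ε i → d :* (ε :* i) := d :* i :* ε) D ε _ ⟩
      D * D ⁻¹ * ε                        ≈⟨ *-congʳ (*-inverse-pos 0<D) ⟩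
      1# * ε                              ≈⟨ *-identityˡ ε ⟩
      ε                                   ∎
    where
    D δ : ℝ
    D = ε + (1# + ∣ l ∣ + ∣ m ∣)
    δ = ε * D ⁻¹

    0<D : 0# < D
    0<D = 0<+ 0<ε (0≤1 0≤+ 0≤∣x∣ l 0≤+ 0≤∣x∣ m)

    0<δ : 0# < δ
    0<δ = 0<ε 0<* 0<⁻¹ 0<D

    δ≤1 : δ ≤ 1#
    δ≤1 = ≤-trans (*-monoʳ-≤ _ (0≤⁻¹ 0<D) (≤-by (solve 2 (λ ε d → ε :+ d :- ε := d) ε _)
      (0≤1 0≤+ 0≤∣x∣ l 0≤+ 0≤∣x∣ m))) (≤-reflexive (*-inverse-pos 0<D))

  ⟶-subseq : ∀ {u l} (φ : ℕ → ℕ) → (∀ n → n ℕ.≤ φ n) → u ⟶ l → (u ∘ φ) ⟶ l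
  ⟶-subseq φ n≤φ u⟶l ε 0<ε = let (N , close) = u⟶l ε 0<ε in
    N , λ n N≤n → close (φ n) (ℕ.≤-trans N≤n (n≤φ n))

  ⟶-congʳ : ∀ {u l m} → l ≈ m → u ⟶ l → u ⟶ m
  ⟶-congʳ l≈m u⟶l ε 0<ε = let (N , close) = u⟶l ε 0<ε in
    N , λ n N≤n → ≤-<-trans (≤-reflexive (∣∣-cong (+-congˡ (-‿cong (sym l≈m))))) (close n N≤n)

  ⟶-mono-+ : ∀ {u v w l m} → u ⟶ l → v ⟶ m → w ⟶ 0# → (∀ n → u n ≤ v n + w n) → l ≤ m
  ⟶-mono-+ {u} {v} {w} {l} {m} u⟶l v⟶m w⟶0 u≤v+w = diff⁻¹ (⟶-lower 0
    (⟶-congʳ (solve 2 (λ l m → m :- (l :- :0) := m :- l) l m) (⟶-- v⟶m (⟶-- u⟶l w⟶0)))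
    (λ n _ → ≤-trans (diff (u≤v+w n))
      (≤-reflexive (solve 3 (λ u v w → v :+ w :- u := v :- (u :- w)) (u n) (v n) (w n)))))

  ⟶-monotone : ∀ {u c} → (∀ n → u n ≤ u (suc n)) → (∀ n → u n ≤ c) → ∃ λ l → u ⟶ l
  ⟶-monotone {u} {c} u-mono u≤c = l , λ ε 0<ε → convergent ε 0<ε
    where
    Range : Pred ℝ 0ℓ
    Range y = ∃ λ n → y ≈ u n

    sup = complete Range (u 0 , 0 , refl) (c , λ { (y , n , y≈u) → ≤-trans (≤-reflexive y≈u) (u≤c n) })
    l = proj₁ sup

    u≤l : ∀ n → u n ≤ l
    u≤l n = proj₁ (proj₂ sup) (u n , n , refl)

    mono : ∀ {m n} → m ℕ.≤′ n → u m ≤ u n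
    mono ℕ.≤′-refl       = ≤-refl
    mono (ℕ.≤′-step m≤n) = ≤-trans (mono m≤n) (u-mono _)

    convergent : u ⟶ l
    convergent ε 0<ε with em {P = ∃ λ N → l - ε < u N}
    ... | yes (N , l-ε<u) = N , λ n N≤n → ≤-<-trans
      (∣∣-lub (≤-trans (≤-by (solve 2 (λ u l → :0 :- (u :- l) := l :- u) _ l) (diff (u≤l n))) (diff (u≤l n)))
        (≤-reflexive (solve 2 (λ u l → :- (u :- l) := l :- u) _ l)))
      (<-by (solve 3 (λ u l ε → ε :- (l :- u) := u :- (l :- ε)) _ l ε)
        (diff-< (<-≤-trans l-ε<u (mono (ℕ.≤⇒≤′ N≤n)))))
    ... | no  ¬p = ⊥-elim (<⇒≱ (<-by (solve 2 (λ l ε → l :- (l :- ε) := ε) l ε) 0<ε)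
      (proj₂ (proj₂ sup) (l - ε) λ { (y , n , y≈u) →
        ≤-trans (≤-reflexive y≈u) (≮⇒≥ λ lt → ¬p (n , lt)) }))

  -- The exponential series

  expTerm : ℝ → ℕ → ℝ
  expTerm x k = x ^ⁿ k * fromℕ (k !) ⁻¹

  expSum : ℝ → ℕ → ℝ
  expSum x n = ∑ n (expTerm x)

  0<n! : ∀ n → 0# < fromℕ (n !)
  0<n! n = 0<fromℕ (ℕ.1≤n! n)

  ^ⁿ-nonNeg : ∀ {x} n → 0# ≤ x → 0# ≤ x ^ⁿ n
  ^ⁿ-nonNeg zero    0≤x = 0≤1
  ^ⁿ-nonNeg (suc n) 0≤x = 0≤x 0≤* ^ⁿ-nonNeg n 0≤x

  ∣^ⁿ∣≤ : ∀ x n → ∣ x ^ⁿ n ∣ ≤ ∣ x ∣ ^ⁿ n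
  ∣^ⁿ∣≤ x zero    = ≤-reflexive (∣∣-nonNeg 0≤1)
  ∣^ⁿ∣≤ x (suc n) = ≤-trans (∣x*y∣≤∣x∣*∣y∣ x (x ^ⁿ n)) (*-monoˡ-≤ ∣ x ∣ (0≤∣x∣ x) (∣^ⁿ∣≤ x n))

  expTerm-nonNeg : ∀ {x} k → 0# ≤ x → 0# ≤ expTerm x k
  expTerm-nonNeg k 0≤x = ^ⁿ-nonNeg k 0≤x 0≤* 0≤⁻¹ (0<n! k)

  ∣expTerm∣≤ : ∀ x k → ∣ expTerm x k ∣ ≤ expTerm (∣ x ∣) k
  ∣expTerm∣≤ x k = begin
    ∣ x ^ⁿ k * fromℕ (k !) ⁻¹ ∣       ≤⟨ ∣x*y∣≤∣x∣*∣y∣ (x ^ⁿ k) (fromℕ (k !) ⁻¹) ⟩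
    ∣ x ^ⁿ k ∣ * ∣ fromℕ (k !) ⁻¹ ∣   ≈⟨ *-congˡ (∣∣-nonNeg (0≤⁻¹ (0<n! k))) ⟩
    ∣ x ^ⁿ k ∣ * fromℕ (k !) ⁻¹       ≤⟨ *-monoʳ-≤ _ (0≤⁻¹ (0<n! k)) (∣^ⁿ∣≤ x k) ⟩
    expTerm (∣ x ∣) k                   ∎

  expTerm-0 : ∀ x → expTerm x 0 ≈ 1#
  expTerm-0 x = trans (*-identityˡ _) (trans (⁻¹-cong (0<n! 0) (+-identityʳ 1#)) 1⁻¹≈1)

  expTerm-suc : ∀ x k → fromℕ (suc k) * expTerm x (suc k) ≈ x * expTerm x k
  expTerm-suc x k = begin-equality
    fromℕ (suc k) * (x * x ^ⁿ k * fromℕ (suc k !) ⁻¹)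
      ≈⟨ *-congˡ (*-congˡ (trans (⁻¹-cong (0<n! (suc k)) (fromℕ-* (suc k) (k !))) (⁻¹-* 0<1+k (0<n! k)))) ⟩
    fromℕ (suc k) * (x * x ^ⁿ k * (fromℕ (suc k) ⁻¹ * fromℕ (k !) ⁻¹))
      ≈⟨ solve 5 (λ n x p i j → n :* (x :* p :* (i :* j)) := n :* i :* (x :* (p :* j)))
           (fromℕ (suc k)) x (x ^ⁿ k) (fromℕ (suc k) ⁻¹) (fromℕ (k !) ⁻¹) ⟩
    fromℕ (suc k) * fromℕ (suc k) ⁻¹ * (x * expTerm x k)   ≈⟨ *-congʳ (*-inverse-pos 0<1+k) ⟩
    1# * (x * expTerm x k)                                  ≈⟨ *-identityˡ _ ⟩
    x * expTerm x k                                         ∎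
    where
    0<1+k : 0# < fromℕ (suc k)
    0<1+k = 0<fromℕ {suc k} (ℕ.s≤s ℕ.z≤n)

  expTerm-cong : ∀ {x y} k → x ≈ y → expTerm x k ≈ expTerm y k
  expTerm-cong k x≈y = *-congʳ (^-congˡ k x≈y)

  -- From index m ≥ 2x on, consecutive terms at least halve, so that
  -- expSum x n + 2 expTerm x n decreases.
  expSum-bounded : ∀ x → 0# ≤ x → ∃ λ c → ∀ n → expSum x n ≤ c
  expSum-bounded x 0≤x = bound m , λ n → begin
    expSum x n            ≤⟨ ∑-monoˡ (ℕ.m≤n+m n m) (λ k → expTerm-nonNeg k 0≤x) ⟩
    expSum x (m ℕ.+ n)    ≤⟨ ≤-by (solve 2 (λ s t → s :+ con 2 :* t :- s := con 2 :* t) _ _)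
                               (0≤fromℕ 2 0≤* expTerm-nonNeg (m ℕ.+ n) 0≤x) ⟩
    bound (m ℕ.+ n)       ≤⟨ decreasing n ⟩
    bound m               ∎
    where
    m = proj₁ (archimedean (fromℕ 2 * x))
    2x≤m = proj₂ (archimedean (fromℕ 2 * x))

    bound : ℕ → ℝ
    bound n = expSum x n + fromℕ 2 * expTerm x n

    halve : ∀ n → m ℕ.≤ n → fromℕ 2 * expTerm x (suc n) ≤ expTerm x n
    halve n m≤n = *-cancelˡ-≤ (fromℕ (suc n)) (0<fromℕ {suc n} (ℕ.s≤s ℕ.z≤n)) (begin
      fromℕ (suc n) * (fromℕ 2 * expTerm x (suc n))
        ≈⟨ solve 2 (λ n t → n :* (con 2 :* t) := con 2 :* (n :* t)) _ _ ⟩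
      fromℕ 2 * (fromℕ (suc n) * expTerm x (suc n))     ≈⟨ *-congˡ (expTerm-suc x n) ⟩
      fromℕ 2 * (x * expTerm x n)                       ≈⟨ *-assoc _ _ _ ⟨
      fromℕ 2 * x * expTerm x n
        ≤⟨ *-monoʳ-≤ _ (expTerm-nonNeg n 0≤x) (≤-trans 2x≤m (fromℕ-mono-≤ (ℕ.m≤n⇒m≤1+n m≤n))) ⟩
      fromℕ (suc n) * expTerm x n                       ∎)

    decreasing : ∀ n → bound (m ℕ.+ n) ≤ bound m
    decreasing zero    = ≤-reflexive (reflexive (≡.cong bound (ℕ.+-identityʳ m)))
    decreasing (suc n) = begin
      bound (m ℕ.+ suc n)     ≡⟨ ≡.cong bound (ℕ.+-suc m n) ⟩
      bound (suc (m ℕ.+ n))   ≤⟨ +-monoʳ-≤ _ (halve (m ℕ.+ n) (ℕ.m≤m+n m n)) ⟩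
      expSum x (m ℕ.+ n) + expTerm x (m ℕ.+ n) + expTerm x (m ℕ.+ n)
        ≈⟨ solve 2 (λ s t → s :+ t :+ t := s :+ con 2 :* t) _ _ ⟩
      bound (m ℕ.+ n)         ≤⟨ decreasing n ⟩
      bound m                 ∎

  expSum-mono : ∀ {x} → 0# ≤ x → ∀ n → expSum x n ≤ expSum x (suc n)
  expSum-mono 0≤x n = ∑-monoˡ (ℕ.n≤1+n n) (λ k → expTerm-nonNeg k 0≤x)

  expSum≤expSum∣∣ : ∀ x n → expSum x n ≤ expSum (∣ x ∣) n
  expSum≤expSum∣∣ x n = ∑-mono n (λ k _ → ≤-trans (x≤∣x∣ _) (∣expTerm∣≤ x k))

  -- Both expSum x + expSum ∣x∣ and expSum ∣x∣ are monotone.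
  expSum-convergent : ∀ x → ∃ λ l → expSum x ⟶ l
  expSum-convergent x = l - l′ , ⟶-cong (λ n → solve 2 (λ s t → s :+ t :- t := s) _ _) (⟶-- s+t⟶l t⟶l′)
    where
    c  = proj₁ (expSum-bounded ∣ x ∣ (0≤∣x∣ x))
    ≤c = proj₂ (expSum-bounded ∣ x ∣ (0≤∣x∣ x))

    abs-limit : ∃ λ l′ → expSum (∣ x ∣) ⟶ l′
    abs-limit = ⟶-monotone (expSum-mono (0≤∣x∣ x)) ≤c
    l′ = proj₁ abs-limit
    t⟶l′ = proj₂ abs-limit

    sum-limit : ∃ λ l → (λ n → expSum x n + expSum (∣ x ∣) n) ⟶ l
    sum-limit = ⟶-monotone
      (λ n → ≤-by (solve 4 (λ s t a b → s :+ a :+ (t :+ b) :- (s :+ t) := b :- :- a) _ _ _ _)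
        (diff (≤-trans (-x≤∣x∣ _) (∣expTerm∣≤ x n))))
      (λ n → +-mono-≤ (≤-trans (expSum≤expSum∣∣ x n) (≤c n)) (≤c n))
    l = proj₁ sum-limit
    s+t⟶l = proj₂ sum-limit

  expSum⟶exp : ∀ x → expSum x ⟶ exp x
  expSum⟶exp x = ⟶-cong (λ n → sum≈∑ n (expTerm x))
    (the-spec 0# ((λ n → sum {n} (expTerm x ∘ toℕ)) ⟶_)
      (let (l , s⟶l) = expSum-convergent x in l , ⟶-cong (λ n → sym (sum≈∑ n (expTerm x))) s⟶l))

  exp-cong : ∀ {x y} → x ≈ y → exp x ≈ exp y
  exp-cong {x} {y} x≈y = ⟶-unique (expSum⟶exp x)
    (⟶-cong (λ n → ∑-cong n (λ k _ → expTerm-cong k (sym x≈y))) (expSum⟶exp y))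

  binomial-factorials : ∀ {n k} → k ℕ.≤ n →
    fromℕ (n choose k) * fromℕ (n !) ⁻¹ ≈ fromℕ (k !) ⁻¹ * fromℕ ((n ℕ.∸ k) !) ⁻¹
  binomial-factorials {n} {k} k≤n = trans (*-cancelˡ (fromℕ (n !) * (K * L)) (>⇒≉0 (0<n! n 0<* (0<n! k 0<* 0<n! (n ℕ.∸ k)))) (begin-equality
    N * (K * L) * (fromℕ (n choose k) * N ⁻¹)
      ≈⟨ solve 5 (λ n k l c i → n :* (k :* l) :* (c :* i) := (c :* (k :* l)) :* (n :* i)) N K L _ _ ⟩
    fromℕ (n choose k) * (K * L) * (N * N ⁻¹)      ≈⟨ *-cong C*K*L≈N (*-inverse-pos (0<n! n)) ⟩
    N * 1# ≈⟨ *-congˡ (*-inverse-pos (0<n! k 0<* 0<n! (n ℕ.∸ k))) ⟨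
    N * (K * L * (K * L) ⁻¹)                  ≈⟨ *-assoc _ _ _ ⟨
    N * (K * L) * (K * L) ⁻¹                  ∎)) (⁻¹-* (0<n! k) (0<n! (n ℕ.∸ k)))
    where
    N = fromℕ (n !)
    K = fromℕ (k !)
    L = fromℕ ((n ℕ.∸ k) !)

    instance
      k!*[n∸k]!≢0 : ℕ.NonZero (k ! ℕ.* (n ℕ.∸ k) !)
      k!*[n∸k]!≢0 = ℕ._!*_!≢0 k (n ℕ.∸ k)

    C*K*L≈N : fromℕ (n choose k) * (K * L) ≈ N
    C*K*L≈N = begin-equality
      fromℕ (n choose k) * (K * L)                     ≈⟨ *-congˡ (fromℕ-* (k !) ((n ℕ.∸ k) !)) ⟨
      fromℕ (n choose k) * fromℕ (k ! ℕ.* (n ℕ.∸ k) !) ≈⟨ fromℕ-* (n choose k) (k ! ℕ.* (n ℕ.∸ k) !) ⟨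
      fromℕ ((n choose k) ℕ.* (k ! ℕ.* (n ℕ.∸ k) !)) ≡⟨ ≡.cong fromℕ (≡.trans (≡.cong (ℕ._* (k ! ℕ.* (n ℕ.∸ k) !)) (nCk≡n!/k![n-k]! k≤n)) (m/n*n≡m (k![n∸k]!∣n! k≤n))) ⟩
      N                                           ∎

  expTerm-+ : ∀ x y n → expTerm (x + y) n ≈ ∑ (suc n) (λ k → expTerm x k * expTerm y (n ℕ.∸ k))
  expTerm-+ x y n = begin-equality
    (x + y) ^ⁿ n * N⁻¹ ≈⟨ *-congʳ (Binomial.theorem commutativeSemiring n x y) ⟩
    sum {suc n} (t ∘ toℕ) * N⁻¹                     ≈⟨ *-congʳ (sum≈∑ (suc n) t) ⟩
    ∑ (suc n) t * N⁻¹                               ≈⟨ ∑-*ʳ (suc n) N⁻¹ t ⟨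
    ∑ (suc n) (λ k → t k * N⁻¹) ≈⟨ ∑-cong (suc n) (λ k k<1+n → term k (ℕ.≤-pred k<1+n)) ⟩
    ∑ (suc n) (λ k → expTerm x k * expTerm y (n ℕ.∸ k)) ∎
    where
    N⁻¹ = fromℕ (n !) ⁻¹

    t : ℕ → ℝ
    t k = (n choose k) · (x ^ⁿ k * y ^ⁿ (n ℕ.∸ k))

    term : ∀ k → k ℕ.≤ n → t k * N⁻¹ ≈ expTerm x k * expTerm y (n ℕ.∸ k)
    term k k≤n = begin-equality
      t k * N⁻¹ ≈⟨ *-congʳ (trans (×-congʳ (n choose k) (sym (*-identityˡ _))) (sym (×-assoc-* (n choose k) 1# _))) ⟩
      fromℕ (n choose k) * (X * Y) * N⁻¹ ≈⟨ solve 4 (λ c x y i → c :* (x :* y) :* i := x :* y :* (c :* i)) _ X Y N⁻¹ ⟩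
      X * Y * (fromℕ (n choose k) * N⁻¹)   ≈⟨ *-congˡ (binomial-factorials k≤n) ⟩
      X * Y * (fromℕ (k !) ⁻¹ * fromℕ ((n ℕ.∸ k) !) ⁻¹)
        ≈⟨ solve 4 (λ x y i j → x :* y :* (i :* j) := x :* i :* (y :* j)) X Y _ _ ⟩
      expTerm x k * expTerm y (n ℕ.∸ k) ∎
      where
      X = x ^ⁿ k
      Y = y ^ⁿ (n ℕ.∸ k)

  -- The right side is the sum of all products of terms over the triangle `j + k < n`; passing from
  -- `n` to `n + 1` adds one antidiagonal, which is the binomial theorem.
  expSum-+ : ∀ x y n → expSum (x + y) n ≈ ∑ n (λ k → expTerm x k * expSum y (n ℕ.∸ k))
  expSum-+ x y zero    = refl
  expSum-+ x y (suc n) = begin-equality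
    expSum (x + y) n + expTerm (x + y) n ≈⟨ +-cong (expSum-+ x y n) (expTerm-+ x y n) ⟩
    ∑ n (λ k → expTerm x k * expSum y (n ℕ.∸ k)) + ∑ (suc n) conv ≈⟨ +-congʳ extend ⟨
    ∑ (suc n) (λ k → expTerm x k * expSum y (n ℕ.∸ k)) + ∑ (suc n) conv
      ≈⟨ ∑-+ (suc n) (λ k → expTerm x k * expSum y (n ℕ.∸ k)) conv ⟨
    ∑ (suc n) (λ k → expTerm x k * expSum y (n ℕ.∸ k) + conv k)
      ≈⟨ ∑-cong (suc n) (λ k k<1+n → trans (sym (distribˡ _ _ _))
           (reflexive (≡.cong (λ m → expTerm x k * expSum y m) (≡.sym (ℕ.+-∸-assoc 1 (ℕ.≤-pred k<1+n)))))) ⟩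
    ∑ (suc n) (λ k → expTerm x k * expSum y (suc n ℕ.∸ k))        ∎
    where
    conv : ℕ → ℝ
    conv k = expTerm x k * expTerm y (n ℕ.∸ k)

    extend : ∑ (suc n) (λ k → expTerm x k * expSum y (n ℕ.∸ k)) ≈ ∑ n (λ k → expTerm x k * expSum y (n ℕ.∸ k))
    extend = trans (+-congˡ (trans (*-congˡ (reflexive (≡.cong (expSum y) (ℕ.n∸n≡0 n)))) (zeroʳ _))) (+-identityʳ _)

  -- Square minus triangle: what remains are the products with `j, k < n` and `j + k ≥ n`.
  expSum-product : ∀ x y n → expSum x n * expSum y n - expSum (x + y) n
                           ≈ ∑ n (λ k → expTerm x k * (expSum y n - expSum y (n ℕ.∸ k)))
  expSum-product x y n = sym (begin-equality
    ∑ n (λ k → expTerm x k * (expSum y n - expSum y (n ℕ.∸ k)))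
      ≈⟨ solve 2 (λ s t → s := s :+ t :- t) _ tri ⟩
    ∑ n (λ k → expTerm x k * (expSum y n - expSum y (n ℕ.∸ k))) + tri - tri
      ≈⟨ +-cong (sym (∑-+ n _ _)) (-‿cong (sym (expSum-+ x y n))) ⟩
    ∑ n (λ k → expTerm x k * (expSum y n - expSum y (n ℕ.∸ k)) + expTerm x k * expSum y (n ℕ.∸ k)) - expSum (x + y) n
      ≈⟨ +-congʳ (∑-cong n (λ k _ → solve 3 (λ e a b → e :* (a :- b) :+ e :* b := e :* a) _ _ _)) ⟩
    ∑ n (λ k → expTerm x k * expSum y n) - expSum (x + y) n
      ≈⟨ +-congʳ (∑-*ʳ n (expSum y n) (expTerm x)) ⟩
    expSum x n * expSum y n - expSum (x + y) n ∎)
    where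
    tri = ∑ n (λ k → expTerm x k * expSum y (n ℕ.∸ k))

  ∣expSum-tail∣≤ : ∀ y {m n} → m ℕ.≤ n → ∣ expSum y n - expSum y m ∣ ≤ expSum (∣ y ∣) n - expSum (∣ y ∣) m
  ∣expSum-tail∣≤ y {m} {n} m≤n = begin
    ∣ expSum y n - expSum y m ∣                             ≈⟨ ∣∣-cong (tail y) ⟩
    ∣ ∑ (n ℕ.∸ m) (λ i → expTerm y (m ℕ.+ i)) ∣             ≤⟨ ∣∑∣≤∑∣∣ (n ℕ.∸ m) _ ⟩
    ∑ (n ℕ.∸ m) (λ i → ∣ expTerm y (m ℕ.+ i) ∣) ≤⟨ ∑-mono (n ℕ.∸ m) (λ i _ → ∣expTerm∣≤ y (m ℕ.+ i)) ⟩
    ∑ (n ℕ.∸ m) (λ i → expTerm (∣ y ∣) (m ℕ.+ i))             ≈⟨ tail ∣ y ∣ ⟨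
    expSum (∣ y ∣) n - expSum (∣ y ∣) m                         ∎
    where
    tail : ∀ y → expSum y n - expSum y m ≈ ∑ (n ℕ.∸ m) (λ i → expTerm y (m ℕ.+ i))
    tail y = begin-equality
      expSum y n - expSum y m ≡⟨ ≡.cong (λ k → expSum y k - expSum y m) (ℕ.m+[n∸m]≡n m≤n) ⟨
      expSum y (m ℕ.+ (n ℕ.∸ m)) - expSum y m     ≈⟨ +-congʳ (∑-split m (n ℕ.∸ m) (expTerm y)) ⟩
      expSum y m + ∑ (n ℕ.∸ m) (λ i → expTerm y (m ℕ.+ i)) - expSum y m
        ≈⟨ solve 2 (λ a b → a :+ b :- a := b) _ _ ⟩
      ∑ (n ℕ.∸ m) (λ i → expTerm y (m ℕ.+ i))     ∎

  -- The square of side `n` lies inside the triangle of side `2 n`, and all terms are nonnegative.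
  expSum-product-≤ : ∀ {a b} n → 0# ≤ a → 0# ≤ b → expSum a n * expSum b n ≤ expSum (a + b) (n ℕ.+ n)
  expSum-product-≤ {a} {b} n 0≤a 0≤b = begin
    expSum a n * expSum b n ≈⟨ ∑-*ʳ n (expSum b n) (expTerm a) ⟨
    ∑ n (λ k → expTerm a k * expSum b n)
      ≤⟨ ∑-mono n (λ k k<n → *-monoˡ-≤ _ (expTerm-nonNeg k 0≤a)
           (∑-monoˡ (ℕ.m+n≤o⇒m≤o∸n n (ℕ.+-monoʳ-≤ n (ℕ.<⇒≤ k<n))) (λ j → expTerm-nonNeg j 0≤b))) ⟩
    ∑ n (λ k → expTerm a k * expSum b (n ℕ.+ n ℕ.∸ k))
      ≤⟨ ∑-monoˡ (ℕ.m≤m+n n n) (λ k → expTerm-nonNeg k 0≤a 0≤* ∑-nonNeg (n ℕ.+ n ℕ.∸ k) (λ j _ → expTerm-nonNeg j 0≤b)) ⟩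
    ∑ (n ℕ.+ n) (λ k → expTerm a k * expSum b (n ℕ.+ n ℕ.∸ k))    ≈⟨ expSum-+ a b (n ℕ.+ n) ⟨
    expSum (a + b) (n ℕ.+ n)                                      ∎

  -- Square minus triangle is dominated by its version for `∣ x ∣` and `∣ y ∣`. By
  -- `expSum-product-≤` that version is at most the difference of the partial sums of one convergent
  -- series at `2 n` and `n`, so the error `w` tends to 0.
  exp-+ : ∀ x y → exp (x + y) ≈ exp x * exp y
  exp-+ x y = ≤-antisym
    (⟶-mono-+ (expSum⟶exp (x + y)) product⟶ w⟶0 (λ n → ≤-by
      (solve 3 (λ p s w → p :+ w :- s := w :- (s :- p)) (P n) (S n) (w n))
      (diff (≤-trans (x≤∣x∣ _) (≤-trans (≤-reflexive (∣x-y∣≈∣y-x∣ _ _)) (close n))))))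
    (⟶-mono-+ product⟶ (expSum⟶exp (x + y)) w⟶0 (λ n → ≤-by
      (solve 3 (λ p s w → s :+ w :- p := w :- (p :- s)) (P n) (S n) (w n))
      (diff (≤-trans (x≤∣x∣ _) (close n)))))
    where
    X = ∣ x ∣ + ∣ y ∣

    P S w : ℕ → ℝ
    P n = expSum x n * expSum y n
    S n = expSum (x + y) n
    w n = expSum X (n ℕ.+ n) - expSum X n

    product⟶ : P ⟶ (exp x * exp y)
    product⟶ = ⟶-* (expSum⟶exp x) (expSum⟶exp y)

    w⟶0 : w ⟶ 0#
    w⟶0 = ⟶-congʳ (-‿inverseʳ (exp X))
      (⟶-- (⟶-subseq (λ n → n ℕ.+ n) (λ n → ℕ.m≤m+n n n) (expSum⟶exp X)) (expSum⟶exp X))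

    close : ∀ n → ∣ P n - S n ∣ ≤ w n
    close n = begin
      ∣ P n - S n ∣           ≈⟨ ∣∣-cong (expSum-product x y n) ⟩
      ∣ ∑ n (λ k → expTerm x k * (expSum y n - expSum y (n ℕ.∸ k))) ∣
        ≤⟨ ≤-trans (∣∑∣≤∑∣∣ n _) (∑-mono n (λ k _ → ≤-trans (∣x*y∣≤∣x∣*∣y∣ _ _)
             (*-mono-≤ (0≤∣x∣ _) (≤-trans (0≤∣x∣ _) (∣expSum-tail∣≤ y (ℕ.m∸n≤m n k)))
               (∣expTerm∣≤ x k) (∣expSum-tail∣≤ y (ℕ.m∸n≤m n k))))) ⟩
      ∑ n (λ k → expTerm (∣ x ∣) k * (expSum (∣ y ∣) n - expSum (∣ y ∣) (n ℕ.∸ k)))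
        ≈⟨ expSum-product ∣ x ∣ ∣ y ∣ n ⟨
      expSum (∣ x ∣) n * expSum (∣ y ∣) n - expSum X n
        ≤⟨ +-monoˡ-≤ _ (expSum-product-≤ n (0≤∣x∣ x) (0≤∣x∣ y)) ⟩
      w n                     ∎

  -- Exponential, logarithm and powers

  expSum≥1+x : ∀ {x} n → 0# ≤ x → 2 ℕ.≤ n → 1# + x ≤ expSum x n
  expSum≥1+x {x} n 0≤x 2≤n = begin
    1# + x                                  ≈⟨ +-cong (expTerm-0 x) (*-identityʳ x) ⟨
    expTerm x 0 + x * 1#                    ≈⟨ +-congˡ (*-congˡ (expTerm-0 x)) ⟨
    expTerm x 0 + x * expTerm x 0           ≈⟨ +-congˡ (expTerm-suc x 0) ⟨
    expTerm x 0 + fromℕ 1 * expTerm x 1 ≈⟨ solve 2 (λ s t → s :+ con 1 :* t := :0 :+ s :+ t) (expTerm x 0) (expTerm x 1) ⟩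
    expSum x 2                              ≤⟨ ∑-monoˡ 2≤n (λ k → expTerm-nonNeg k 0≤x) ⟩
    expSum x n                              ∎

  1+x≤exp-nonNeg : ∀ {x} → 0# ≤ x → 1# + x ≤ exp x
  1+x≤exp-nonNeg {x} 0≤x = ⟶-lower 2 (expSum⟶exp x) (λ n 2≤n → expSum≥1+x n 0≤x 2≤n)

  expTerm≤^ⁿ : ∀ {x} k → 0# ≤ x → expTerm x k ≤ x ^ⁿ k
  expTerm≤^ⁿ {x} k 0≤x = ≤-trans
    (*-monoˡ-≤ _ (^ⁿ-nonNeg k 0≤x) (≤-trans (⁻¹-antimono-≤ 0<1 (1≤fromℕ {k !} (ℕ.1≤n! k))) (≤-reflexive 1⁻¹≈1)))
    (≤-reflexive (*-identityʳ _))

  -- For the geometric series, `(1 - x) * Σ x^k + x^n = 1`; the factorials only lower the sum.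
  -- Carrying `x ^ⁿ n` along makes the induction go through.
  expSum-geometric : ∀ {x} n → 0# ≤ x → x ≤ 1# → expSum x n * (1# - x) + x ^ⁿ n ≤ 1#
  expSum-geometric {x} zero 0≤x x≤1 = ≤-reflexive (solve 1 (λ x → :0 :* (:1 :- x) :+ :1 := :1) x)
  expSum-geometric {x} (suc n) 0≤x x≤1 = ≤-trans (≤-by
    (solve 4 (λ s t x p → s :* (:1 :- x) :+ p :- ((s :+ t) :* (:1 :- x) :+ x :* p) := (p :- t) :* (:1 :- x)) (expSum x n) (expTerm x n) x (x ^ⁿ n))
    (diff (expTerm≤^ⁿ n 0≤x) 0≤* diff x≤1)) (expSum-geometric n 0≤x x≤1)

  [1-x]*exp≤1-nonNeg : ∀ {x} → 0# ≤ x → x < 1# → (1# - x) * exp x ≤ 1#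
  [1-x]*exp≤1-nonNeg {x} 0≤x x<1 = begin
    (1# - x) * exp x ≤⟨ *-monoˡ-≤ _ (diff (<⇒≤ x<1)) (⟶-upper 0 (expSum⟶exp x) (λ n _ →
                                        x≤y⁻¹*z (diff-< x<1) (≤-trans (≤-by
                                          (solve 3 (λ s x p → s :* (:1 :- x) :+ p :- (:1 :- x) :* s := p) (expSum x n) x (x ^ⁿ n))
                                          (^ⁿ-nonNeg n 0≤x)) (expSum-geometric n 0≤x (<⇒≤ x<1))))) ⟩
    (1# - x) * ((1# - x) ⁻¹ * 1#)   ≈⟨ *-assoc _ _ _ ⟨
    (1# - x) * (1# - x) ⁻¹ * 1#     ≈⟨ trans (*-identityʳ _) (*-inverse-pos (diff-< x<1)) ⟩
    1#                              ∎

  exp-0 : exp 0# ≈ 1#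
  exp-0 = ≤-antisym
    (≤-trans (≤-reflexive (solve 1 (λ e → e := (:1 :- :0) :* e) _)) ([1-x]*exp≤1-nonNeg ≤-refl 0<1))
    (≤-trans (≤-reflexive (sym (+-identityʳ 1#))) (1+x≤exp-nonNeg ≤-refl))

  exp-neg : ∀ x → exp (- x) * exp x ≈ 1#
  exp-neg x = trans (sym (exp-+ (- x) x)) (trans (exp-cong (-‿inverseˡ x)) exp-0)

  0<exp : ∀ x → 0# < exp x
  0<exp x = [ nonneg , nonpos ]′ (≤-total 0# x)
    where
    nonneg : ∀ {x} → 0# ≤ x → 0# < exp x
    nonneg 0≤x = <-≤-trans (0<+ 0<1 0≤x) (1+x≤exp-nonNeg 0≤x)

    nonpos : x ≤ 0# → 0# < exp x
    nonpos x≤0 = ≰⇒> λ exp≤0 → <⇒≱ 0<1 (begin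
      1#                    ≈⟨ exp-neg x ⟨
      exp (- x) * exp x ≤⟨ *-monoˡ-≤ _ (<⇒≤ (nonneg (≤-trans (diff x≤0) (≤-reflexive (+-identityˡ (- x)))))) exp≤0 ⟩
      exp (- x) * 0#        ≈⟨ zeroʳ _ ⟩
      0#                    ∎)

  -- For `-1 < x ≤ 0` this is the reciprocal of `(1 - y) * exp y ≤ 1` at `y = - x`; for `x ≤ -1` the
  -- left side is not positive. With `exp-+` this inequality yields monotonicity, convexity and
  -- surjectivity of `exp` and the bounds on `log`, without derivatives or continuity.
  1+x≤exp : ∀ x → 1# + x ≤ exp x
  1+x≤exp x = [ 1+x≤exp-nonNeg , nonpos ]′ (≤-total 0# x)
    where
    nonpos : x ≤ 0# → 1# + x ≤ exp x
    nonpos x≤0 = [ below-1 , above-1 ]′ (≤-or-> 1# (- x))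
      where
      below-1 : 1# ≤ - x → 1# + x ≤ exp x
      below-1 1≤-x = ≤-trans (≤-by (solve 1 (λ x → :0 :- (:1 :+ x) := :- x :- :1) x) (diff 1≤-x)) (<⇒≤ (0<exp x))

      above-1 : - x < 1# → 1# + x ≤ exp x
      above-1 -x<1 = *-cancelʳ-≤ (exp (- x)) (0<exp (- x)) (begin
        (1# + x) * exp (- x)      ≈⟨ solve 2 (λ x e → (:1 :+ x) :* e := (:1 :- :- x) :* e) x _ ⟩
        (1# - - x) * exp (- x) ≤⟨ [1-x]*exp≤1-nonNeg (≤-trans (diff x≤0) (≤-reflexive (+-identityˡ (- x)))) -x<1 ⟩
        1#                        ≈⟨ exp-neg x ⟨
        exp (- x) * exp x         ≈⟨ *-comm _ _ ⟩
        exp x * exp (- x)         ∎)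

  [1-x]*exp≤1 : ∀ x → (1# - x) * exp x ≤ 1#
  [1-x]*exp≤1 x = ≤-trans (*-monoʳ-≤ _ (<⇒≤ (0<exp x)) (1+x≤exp (- x))) (≤-reflexive (exp-neg x))

  exp-mono-< : ∀ {x y} → x < y → exp x < exp y
  exp-mono-< {x} {y} x<y = begin-strict
    exp x                     ≈⟨ *-identityʳ _ ⟨
    exp x * 1# <⟨ *-monoˡ-< (exp x) (0<exp x) (<-by (solve 1 (λ d → :1 :+ d :- :1 := d) _) (diff-< x<y)) ⟩
    exp x * (1# + (y - x))    ≤⟨ *-monoˡ-≤ _ (<⇒≤ (0<exp x)) (1+x≤exp (y - x)) ⟩
    exp x * exp (y - x)       ≈⟨ exp-+ x (y - x) ⟨
    exp (x + (y - x))         ≈⟨ exp-cong (solve 2 (λ x y → x :+ (y :- x) := y) x y) ⟩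
    exp y                     ∎

  exp-cancel-≤ : ∀ {x y} → exp x ≤ exp y → x ≤ y
  exp-cancel-≤ ex≤ey = ≮⇒≥ λ y<x → <⇒≱ (exp-mono-< y<x) ex≤ey

  exp-mono-≤ : ∀ {x y} → x ≤ y → exp x ≤ exp y
  exp-mono-≤ {x} {y} x≤y = ≮⇒≥ λ ey<ex → ey<ex .proj₂ (exp-cong (≤-antisym (exp-cancel-≤ (<⇒≤ ey<ex)) x≤y))

  exp-injective : ∀ {x y} → exp x ≈ exp y → x ≈ y
  exp-injective ex≈ey = ≤-antisym (exp-cancel-≤ (≤-reflexive ex≈ey)) (exp-cancel-≤ (≤-reflexive (sym ex≈ey)))

  -- From the tangent line at t u.
  exp-convex : ∀ t u → 0# ≤ t → t ≤ 1# → exp (t * u) ≤ 1# + t * (exp u - 1#)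
  exp-convex t u 0≤t t≤1 = begin
    A
      ≈⟨ solve 3 (λ a t u → a := t :* (a :* (:1 :+ (:1 :- t) :* u)) :+ (:1 :- t) :* (a :* (:1 :+ :- (t :* u)))) A t u ⟩
    t * (A * (1# + (1# - t) * u)) + (1# - t) * (A * (1# + - (t * u)))
      ≤⟨ +-mono-≤ (*-monoˡ-≤ t 0≤t (*-monoˡ-≤ A 0≤A (1+x≤exp _))) (*-monoˡ-≤ _ (diff t≤1) (*-monoˡ-≤ A 0≤A (1+x≤exp _))) ⟩
    t * (A * exp ((1# - t) * u)) + (1# - t) * (A * exp (- (t * u)))
      ≈⟨ +-cong (*-congˡ (trans (sym (exp-+ _ _)) (exp-cong (solve 2 (λ t u → t :* u :+ (:1 :- t) :* u := u) t u))))
                (*-congˡ (trans (*-comm _ _) (exp-neg (t * u)))) ⟩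
    t * exp u + (1# - t) * 1#
      ≈⟨ solve 2 (λ t e → t :* e :+ (:1 :- t) :* :1 := :1 :+ t :* (e :- :1)) t (exp u) ⟩
    1# + t * (exp u - 1#) ∎
    where
    A = exp (t * u)
    0≤A : 0# ≤ A
    0≤A = <⇒≤ (0<exp (t * u))

  -- The solution is `s = sup Below`. The tangent inequalities replace continuity by an explicit
  -- step: `h = 1 - y / exp s` if `exp s` is too large, `h = 1 - exp s / y` if it is too small.
  -- `Below` is inhabited since `exp (1 / y) ≥ 1 / y`, and bounded by `y` since `x ≤ exp x`.
  exp-surjective : ∀ {y} → 0# < y → ∃ λ x → exp x ≈ y
  exp-surjective {y} 0<y = s , ≤-antisym (≮⇒≥ not-above) (≮⇒≥ not-below)
    where
    Below : Pred ℝ 0ℓ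
    Below x = exp x ≤ y

    exp-y⁻¹≤y : exp (- (y ⁻¹)) ≤ y
    exp-y⁻¹≤y = *-cancelʳ-≤ (exp (y ⁻¹)) (0<exp _) (begin
      exp (- (y ⁻¹)) * exp (y ⁻¹)   ≈⟨ exp-neg (y ⁻¹) ⟩
      1#                            ≈⟨ *-inverse-pos 0<y ⟨
      y * y ⁻¹ ≤⟨ *-monoˡ-≤ y (<⇒≤ 0<y) (≤-trans (≤-by (solve 1 (λ z → :1 :+ z :- z := :1) _) 0≤1) (1+x≤exp (y ⁻¹))) ⟩
      y * exp (y ⁻¹)                ∎)

    sup = complete Below (- (y ⁻¹) , exp-y⁻¹≤y)
      (y , λ { (x , ex≤y) → ≤-trans (≤-by (solve 1 (λ x → :1 :+ x :- x := :1) x) 0≤1) (≤-trans (1+x≤exp x) ex≤y) })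
    s = proj₁ sup

    not-above : ¬ (y < exp s)
    not-above y<es = <⇒≱ s-h<s (proj₂ (proj₂ sup) (s - h) λ { (x , ex≤y) → bound x ex≤y })
      where
      h = 1# - (exp s) ⁻¹ * y

      s-h<s : s - h < s
      s-h<s = <-by (solve 2 (λ s i → s :- (s :- (:1 :- i)) := :1 :- i) s _)
        (diff-< (≰⇒> λ 1≤ → <⇒≱ y<es (begin
          exp s                     ≈⟨ *-identityʳ _ ⟨
          exp s * 1#                ≤⟨ *-monoˡ-≤ _ (<⇒≤ (0<exp s)) 1≤ ⟩
          exp s * (exp s ⁻¹ * y)    ≈⟨ *-assoc _ _ _ ⟨
          exp s * exp s ⁻¹ * y      ≈⟨ *-congʳ (*-inverse-pos (0<exp s)) ⟩
          1# * y                    ≈⟨ *-identityˡ y ⟩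
          y                         ∎)))

      bound : ∀ x → exp x ≤ y → x ≤ s - h
      bound x ex≤y = ≤-by (solve 3 (λ x s i → s :- (:1 :- i) :- x := i :- (:1 :+ (x :- s))) x s _)
        (diff (x≤y⁻¹*z (0<exp s) (begin
          exp s * (1# + (x - s))    ≤⟨ *-monoˡ-≤ _ (<⇒≤ (0<exp s)) (1+x≤exp (x - s)) ⟩
          exp s * exp (x - s)       ≈⟨ exp-+ s (x - s) ⟨
          exp (s + (x - s))         ≈⟨ exp-cong (solve 2 (λ x s → s :+ (x :- s) := x) x s) ⟩
          exp x                     ≤⟨ ex≤y ⟩
          y                         ∎)))

    not-below : ¬ (exp s < y)
    not-below es<y = <⇒≱ (<-by (solve 2 (λ s h → s :+ h :- s := h) s h) 0<h)
      (proj₁ (proj₂ sup) (s + h , es+h≤y))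
      where
      h = 1# - y ⁻¹ * exp s

      0<h : 0# < h
      0<h = diff-< (≰⇒> λ 1≤ → <⇒≱ es<y (begin
        y                       ≈⟨ *-identityʳ _ ⟨
        y * 1#                  ≤⟨ *-monoˡ-≤ _ (<⇒≤ 0<y) 1≤ ⟩
        y * (y ⁻¹ * exp s)      ≈⟨ *-assoc _ _ _ ⟨
        y * y ⁻¹ * exp s        ≈⟨ *-congʳ (*-inverse-pos 0<y) ⟩
        1# * exp s              ≈⟨ *-identityˡ _ ⟩
        exp s                   ∎))

      es+h≤y : exp (s + h) ≤ y
      es+h≤y = begin
        exp (s + h)                           ≈⟨ exp-+ s h ⟩
        exp s * exp h ≈⟨ *-congʳ (trans (sym (*-identityˡ _)) (*-congʳ (sym (*-inverse-pos 0<y)))) ⟩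
        y * y ⁻¹ * exp s * exp h ≈⟨ solve 4 (λ y i e f → y :* i :* e :* f := y :* ((:1 :- (:1 :- i :* e)) :* f)) y (y ⁻¹) (exp s) (exp h) ⟩
        y * ((1# - h) * exp h)                ≤⟨ *-monoˡ-≤ y (<⇒≤ 0<y) ([1-x]*exp≤1 h) ⟩
        y * 1#                                ≈⟨ *-identityʳ y ⟩
        y                                     ∎

  exp-log : ∀ {x} → 0# < x → exp (log x) ≈ x
  exp-log {x} 0<x = the-spec 0# (λ y → exp y ≈ x) (exp-surjective 0<x)

  log-exp : ∀ x → log (exp x) ≈ x
  log-exp x = exp-injective (exp-log (0<exp x))

  log-mono-≤ : ∀ {x y} → 0# < x → x ≤ y → log x ≤ log y
  log-mono-≤ 0<x x≤y = exp-cancel-≤ (≤-trans (≤-reflexive (exp-log 0<x))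
    (≤-trans x≤y (≤-reflexive (sym (exp-log (<-≤-trans 0<x x≤y))))))

  log-cong : ∀ {x y} → 0# < x → x ≈ y → log x ≈ log y
  log-cong 0<x x≈y = ≤-antisym (log-mono-≤ 0<x (≤-reflexive x≈y))
    (log-mono-≤ (<-≤-trans 0<x (≤-reflexive x≈y)) (≤-reflexive (sym x≈y)))

  log-1 : log 1# ≈ 0#
  log-1 = trans (log-cong 0<1 (sym exp-0)) (log-exp 0#)

  log-* : ∀ {x y} → 0# < x → 0# < y → log (x * y) ≈ log x + log y
  log-* 0<x 0<y = exp-injective (trans (exp-log (0<x 0<* 0<y))
    (sym (trans (exp-+ _ _) (*-cong (exp-log 0<x) (exp-log 0<y)))))

  log-⁻¹ : ∀ {x} → 0# < x → log (x ⁻¹) ≈ - log x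
  log-⁻¹ {x} 0<x = begin-equality
    log (x ⁻¹)                    ≈⟨ solve 2 (λ a b → a := b :+ a :- b) _ (log x) ⟩
    log x + log (x ⁻¹) - log x    ≈⟨ +-congʳ (trans (sym (log-* 0<x (0<⁻¹ 0<x)))
                                      (trans (log-cong (0<x 0<* 0<⁻¹ 0<x) (*-inverse-pos 0<x)) log-1)) ⟩
    0# - log x                    ≈⟨ +-identityˡ _ ⟩
    - log x                       ∎

  log≤x-1 : ∀ {x} → 0# < x → log x ≤ x - 1#
  log≤x-1 {x} 0<x = ≤-by (solve 2 (λ x l → x :- :1 :- l := x :- (:1 :+ l)) x (log x))
    (diff (≤-trans (1+x≤exp (log x)) (≤-reflexive (exp-log 0<x))))

  0<log : ∀ {x} → 1# < x → 0# < log x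
  0<log {x} 1<x = ≰⇒> λ log≤0 → <⇒≱ 1<x (begin
    x             ≈⟨ exp-log (<-trans 0<1 1<x) ⟨
    exp (log x)   ≤⟨ exp-mono-≤ log≤0 ⟩
    exp 0#        ≈⟨ exp-0 ⟩
    1#            ∎)

  fromℕ-^ : ∀ b n → fromℕ (b ℕ.^ suc n) ≈ fromℕ b * fromℕ (b ℕ.^ n)
  fromℕ-^ b n = fromℕ-* b (b ℕ.^ n)

  log-^ : ∀ b n → 0 ℕ.< b → log (fromℕ (b ℕ.^ n)) ≈ fromℕ n * log (fromℕ b)
  log-^ b zero 0<b = trans (trans (log-cong (0<fromℕ {1} (ℕ.s≤s ℕ.z≤n)) (+-identityʳ 1#)) log-1) (sym (zeroˡ _))
  log-^ b (suc n) 0<b = begin-equality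
    log (fromℕ (b ℕ.^ suc n)) ≈⟨ log-cong (0<fromℕ (ℕ.m^n>0 b {{ℕ.>-nonZero 0<b}} (suc n))) (fromℕ-^ b n) ⟩
    log (fromℕ b * fromℕ (b ℕ.^ n)) ≈⟨ log-* (0<fromℕ 0<b) (0<fromℕ (ℕ.m^n>0 b {{ℕ.>-nonZero 0<b}} n)) ⟩
    log (fromℕ b) + log (fromℕ (b ℕ.^ n))       ≈⟨ +-congˡ (log-^ b n 0<b) ⟩
    log (fromℕ b) + fromℕ n * log (fromℕ b) ≈⟨ solve 2 (λ l n → l :+ n :* l := (:1 :+ n) :* l) _ (fromℕ n) ⟩
    fromℕ (suc n) * log (fromℕ b)               ∎

  if-yes : ∀ {p a} {P : Set p} {A : Set a} {x y : A} (P? : Dec P) → P → (if does P? then x else y) ≡ x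
  if-yes (yes _) _ = ≡.refl
  if-yes (no ¬p) p = ⊥-elim (¬p p)

  if-no : ∀ {p a} {P : Set p} {A : Set a} {x y : A} (P? : Dec P) → ¬ P → (if does P? then x else y) ≡ y
  if-no (yes p) ¬p = ⊥-elim (¬p p)
  if-no (no _)  _  = ≡.refl

  if-all : ∀ {p a q} {P : Set p} {A : Set a} {x y : A} (Q : A → Set q) (P? : Dec P) → Q x → Q y → Q (if does P? then x else y)
  if-all Q (yes _) qx qy = qx
  if-all Q (no _)  qx qy = qy

  ^-pos : ∀ {x} s → 0# < x → x ^ s ≈ exp (s * log x)
  ^-pos {x} s 0<x = reflexive (if-no em (>⇒≉0 0<x))

  ^-zero : ∀ {x s} → x ≈ 0# → ¬ (s ≈ 0#) → x ^ s ≈ 0#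
  ^-zero x≈0 s≉0 = reflexive (≡.trans (if-yes em x≈0) (if-no em s≉0))

  ^-nonNeg : ∀ x s → 0# ≤ x ^ s
  ^-nonNeg x s = if-all (0# ≤_) (em {P = x ≈ 0#}) (if-all (0# ≤_) (em {P = s ≈ 0#}) 0≤1 ≤-refl) (<⇒≤ (0<exp (s * log x)))

  -- Extended reals, Hausdorff measure and dimension

  module ≤± = AddExtrema _≤_
  module <± = AddExtremaStrict _<_
  module ≈± = AddExtremaEq _≈_

  ≤±-trans : ∀ {k l m} → k ≤± l → l ≤± m → k ≤± m
  ≤±-trans = ≤±.≤±-trans ≤-trans

  ≤±-antisym : ∀ {k l} → k ≤± l → l ≤± k → k ≈± l
  ≤±-antisym = ≤±.≤±-antisym ≤-antisym

  ≤±-total : ∀ k l → k ≤± l ⊎ l ≤± k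
  ≤±-total = ≤±.≤±-total ≤-total

  ≤±-reflexive : ∀ {k l} → k ≈± l → k ≤± l
  ≤±-reflexive = ≤±.≤±-reflexive ≤-reflexive

  ≤±-by-ε : ∀ l {x} → (∀ ε → 0# < ε → l ≤± [ x + ε ]) → l ≤± [ x ]
  ≤±-by-ε ⊥±    l≤ = ≤±.⊥±≤ _
  ≤±-by-ε [ r ] l≤ = ≤±.[ ≤-by-ε (λ ε 0<ε → ≤±.[≤]-injective (l≤ ε 0<ε)) ]
  ≤±-by-ε ⊤±    l≤ with () ← l≤ 1# 0<1

  []≰⊥ : ∀ {x} → ¬ ([ x ] ≤± ⊥±)
  []≰⊥ AddSupremum.[ () ]

  []≤±-positive : ∀ {c} v → 0# < c → [ c ] ≤± v → [ 0# ] <± v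
  []≤±-positive ⊥±    0<c c≤⊥ = ⊥-elim ([]≰⊥ c≤⊥)
  []≤±-positive [ r ] 0<c c≤r = <±.[ <-≤-trans 0<c (≤±.[≤]-injective c≤r) ]
  []≤±-positive ⊤±    0<c _   = <±.[ 0# ]<⊤±

  -- Excluded middle makes propositions small, as completeness requires.
  Small : ∀ {ℓ} → Set ℓ → Set
  Small P = T (does (em {P = P}))

  toSmall : ∀ {ℓ} {P : Set ℓ} → P → Small P
  toSmall {P = P} p with em {P = P}
  ... | yes _ = tt
  ... | no ¬p = ⊥-elim (¬p p)

  fromSmall : ∀ {ℓ} {P : Set ℓ} → Small P → P
  fromSmall {P = P} _ with em {P = P}
  fromSmall _  | yes p = p
  fromSmall () | no _

  supremum-exists : ∀ {i} {I : Set i} (f : I → ℝ ±) → ∃ (IsSupremum _≤±_ f)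
  supremum-exists {I = I} f with em {P = ∃ λ i → f i ≡ ⊤±}
  ... | yes (i , fi≡⊤) = ⊤± , (λ j → f j ≤±.≤⊤±) , λ u f≤u → ≡.subst (_≤± u) fi≡⊤ (f≤u i)
  ... | no  f≢⊤ with em {P = ∃ λ x → ∃ λ i → f i ≡ [ x ]}
  ...   | no  f≢[] = ⊥± , (λ i → value≤⊥ (f i) ≡.refl) , λ u _ → ≤±.⊥±≤ u
    where
    value≤⊥ : ∀ {i} v → f i ≡ v → v ≤± ⊥±
    value≤⊥ ⊥±    _  = ≤±.⊥±≤⊥±
    value≤⊥ [ x ] eq = ⊥-elim (f≢[] (x , _ , eq))
    value≤⊥ ⊤±    eq = ⊥-elim (f≢⊤ (_ , eq))
  ...   | yes (x₀ , i₀ , eq₀) with em {P = ∃ λ b → ∀ i x → f i ≡ [ x ] → x ≤ b}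
  ...     | no  unbounded = ⊤± , (λ j → f j ≤±.≤⊤±) , λ { u f≤u → top u f≤u }
    where
    top : ∀ u → IsUpperBound _≤±_ f u → ⊤± ≤± u
    top ⊥±    f≤u = ⊥-elim ([]≰⊥ (≡.subst (_≤± ⊥±) eq₀ (f≤u i₀)))
    top [ b ] f≤u = ⊥-elim (unbounded (b , λ i x eq → ≤±.[≤]-injective (≡.subst (_≤± [ b ]) eq (f≤u i))))
    top ⊤±    f≤u = ≤±.⊤±≤⊤±
  ...     | yes (b , bounded) = [ s ] , (λ i → upper (f i) ≡.refl) , least-bound
    where
    Value : Pred ℝ 0ℓ
    Value x = Small (∃ λ i → f i ≡ [ x ])

    sup = complete Value (x₀ , toSmall (i₀ , eq₀))
      (b , λ { (x , v) → let (i , eq) = fromSmall {P = ∃ λ i → f i ≡ [ x ]} v in bounded i x eq })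
    s = proj₁ sup

    upper : ∀ {i} v → f i ≡ v → v ≤± [ s ]
    upper ⊥±    _  = ≤±.⊥±≤[ s ]
    upper [ x ] eq = ≤±.[ proj₁ (proj₂ sup) (x , toSmall (_ , eq)) ]
    upper ⊤±    eq = ⊥-elim (f≢⊤ (_ , eq))

    least-bound : ∀ u → IsUpperBound _≤±_ f u → [ s ] ≤± u
    least-bound ⊥±    f≤u = ⊥-elim ([]≰⊥ (≡.subst (_≤± ⊥±) eq₀ (f≤u i₀)))
    least-bound [ c ] f≤u = ≤±.[ proj₂ (proj₂ sup) c (λ { (x , v) →
      let (i , eq) = fromSmall {P = ∃ λ i → f i ≡ [ x ]} v in ≤±.[≤]-injective (≡.subst (_≤± [ c ]) eq (f≤u i)) }) ]
    least-bound ⊤±    f≤u = ≤±.[ s ]≤⊤±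

  infimum-exists : ∀ {i} {I : Set i} (f : I → ℝ ±) → ∃ (IsInfimum _≤±_ f)
  infimum-exists f =
    let (s , s-upper , s-least) = supremum-exists (proj₁ {B = IsLowerBound _≤±_ f}) in
    s , (λ i → s-least (f i) λ { (l , l≤f) → l≤f i }) , λ l l≤f → s-upper (l , l≤f)

  ⨆-isSupremum : ∀ {i} {I : Set i} (f : I → ℝ ±) → IsSupremum _≤±_ f (⨆ I f)
  ⨆-isSupremum f = the-spec ⊥± (IsSupremum _≤±_ f) (supremum-exists f)

  ⨅-isInfimum : ∀ {i} {I : Set i} (f : I → ℝ ±) → IsInfimum _≤±_ f (⨅ I f)
  ⨅-isInfimum f = the-spec ⊤± (IsInfimum _≤±_ f) (infimum-exists f)

  badlyApproximable-const : ∀ {α} → BadlyApproximable α →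
    ∃ λ κ → 0# < κ × (∀ q → 1 ℕ.≤ q → κ ≤ fromℕ q * ‖ fromℕ q * α ‖)
  badlyApproximable-const {α} 0<⨅ = extract _ 0<⨅ (proj₁ (⨅-isInfimum f))
    where
    f : (∃ λ q → 1 ℕ.≤ q) → ℝ ±
    f (q , _) = [ fromℕ q * ‖ fromℕ q * α ‖ ]

    extract : ∀ v → [ 0# ] <± v → IsLowerBound _≤±_ f v →
      ∃ λ κ → 0# < κ × (∀ q → 1 ℕ.≤ q → κ ≤ fromℕ q * ‖ fromℕ q * α ‖)
    extract ⊥±    AddSupremumStrict.[ () ] _
    extract [ κ ] 0<κ κ≤f = κ , <±.[<]-injective 0<κ , λ q 1≤q → ≤±.[≤]-injective (κ≤f (q , 1≤q))
    extract ⊤±    _   ⊤≤f with () ← ⊤≤f (1 , ℕ.≤-refl)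

  liminf-positive : ∀ {u c} N → 0# < c → (∀ q → N ℕ.≤ q → c ≤ u q) → [ 0# ] <± liminf u
  liminf-positive {u} {c} N 0<c c≤u = []≤±-positive (liminf u) 0<c
    (≤±-trans (proj₂ (⨅-isInfimum (tail N)) [ c ] (λ { (q , N≤q) → ≤±.[ c≤u q N≤q ] }))
              (proj₁ (⨆-isSupremum (λ N → ⨅ (∃ λ q → N ℕ.≤ q) (tail N))) N))
    where
    tail : ∀ N → (∃ λ q → N ℕ.≤ q) → ℝ ±
    tail N (q , _) = [ u q ]

  diam-upper : ∀ {U : Pred ℝ 0ℓ} {x y} → U x → U y → [ ∣ x - y ∣ ] ≤± diam U
  diam-upper {U} ux uy = proj₁ (⨆-isSupremum {I = ∃ U × ∃ U} _) ((_ , ux) , (_ , uy))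

  diam-least : ∀ {U : Pred ℝ 0ℓ} {d} → (∀ x y → U x → U y → ∣ x - y ∣ ≤ d) → diam U ≤± [ d ]
  diam-least {U} {d} ≤d = proj₂ (⨆-isSupremum {I = ∃ U × ∃ U} _) [ d ]
    λ { ((x , ux) , (y , uy)) → ≤±.[ ≤d x y ux uy ] }

  ^±-nonNeg : ∀ v s → 0# ≤ v ^± s
  ^±-nonNeg ⊥±    s = ≤-refl
  ^±-nonNeg ⊤±    s = ≤-refl
  ^±-nonNeg [ d ] s = ^-nonNeg d s

  -- The strict inequality `r < d` keeps `d` positive, away from the special values of `_^_` at 0,
  -- which depend on whether `s` is 0.
  ^±-lower : ∀ {d r s} → 0# ≤ s → 0# < r → r < d → exp (s * log r) ≤ [ d ] ^± s
  ^±-lower {d} {r} {s} 0≤s 0<r r<d = ≤-trans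
    (exp-mono-≤ (*-monoˡ-≤ s 0≤s (log-mono-≤ 0<r (<⇒≤ r<d))))
    (≤-reflexive (sym (^-pos s (<-trans 0<r r<d))))

  ^±-upper : ∀ v {r s} → 0# < s → 0# < r → [ 0# ] ≤± v ⊎ v ≡ ⊥± → v ≤± [ r ] → v ^± s ≤ exp (s * log r)
  ^±-upper ⊥±    0<s 0<r _        _   = <⇒≤ (0<exp _)
  ^±-upper ⊤±    0<s 0<r _        _   = <⇒≤ (0<exp _)
  ^±-upper [ d ] 0<s 0<r (inj₂ ()) _
  ^±-upper [ d ] {r} {s} 0<s 0<r (inj₁ 0≤d) d≤r = [ zero-case , positive-case ]′ (≤-or-> d 0#)
    where
    zero-case : d ≤ 0# → d ^ s ≤ exp (s * log r)
    zero-case d≤0 = ≤-trans (≤-reflexive (^-zero (≤-antisym d≤0 (≤±.[≤]-injective 0≤d)) (>⇒≉0 0<s))) (<⇒≤ (0<exp _))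

    positive-case : 0# < d → d ^ s ≤ exp (s * log r)
    positive-case 0<d = ≤-trans (≤-reflexive (^-pos s 0<d))
      (exp-mono-≤ (*-monoˡ-≤ s (<⇒≤ 0<s) (log-mono-≤ 0<d (≤±.[≤]-injective d≤r))))

  diam-nonNeg : ∀ (U : Pred ℝ 0ℓ) → [ 0# ] ≤± diam U ⊎ diam U ≡ ⊥±
  diam-nonNeg U with em {P = ∃ U}
  ... | yes (x , ux) = inj₁ (≤±-trans ≤±.[ 0≤∣x∣ (x - x) ] (diam-upper ux ux))
  ... | no empty = inj₂ (is-⊥ (diam U) (proj₂ (⨆-isSupremum {I = ∃ U × ∃ U} _) ⊥± λ { (p , _) → ⊥-elim (empty p) }))
    where
    is-⊥ : ∀ v → v ≤± ⊥± → v ≡ ⊥±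
    is-⊥ ⊥±    _ = ≡.refl
    is-⊥ [ x ] x≤⊥ = ⊥-elim ([]≰⊥ x≤⊥)
    is-⊥ ⊤±    ()

  -- This replaces an extended diameter by a real number. The empty set gets `d = 0`, which makes
  -- the last clause vacuous, as it must be because the empty set costs nothing.
  real-diameter : ∀ {s δ} (U : Pred ℝ 0ℓ) → 0# ≤ s → 0# ≤ δ → diam U ≤± [ δ ] →
    ∃ λ d → d ≤ δ × (∀ {x y} → U x → U y → ∣ x - y ∣ ≤ d)
          × (∀ {r} → 0# < r → r < d → exp (s * log r) ≤ diam U ^± s)
  real-diameter {s} {δ} U 0≤s 0≤δ = go (diam U) diam-upper
    where
    go : ∀ v → (∀ {x y} → U x → U y → [ ∣ x - y ∣ ] ≤± v) → v ≤± [ δ ] →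
         ∃ λ d → d ≤ δ × (∀ {x y} → U x → U y → ∣ x - y ∣ ≤ d) × (∀ {r} → 0# < r → r < d → exp (s * log r) ≤ v ^± s)
    go ⊥± upper _ = 0# , 0≤δ , (λ ux uy → ⊥-elim ([]≰⊥ (upper ux uy))) , λ 0<r r<0 → ⊥-elim (<⇒≱ 0<r (<⇒≤ r<0))
    go [ d ] upper d≤δ = d , ≤±.[≤]-injective d≤δ , (λ ux uy → ≤±.[≤]-injective (upper ux uy)) , ^±-lower 0≤s
    go ⊤±    upper ()

  cost-upper : ∀ {δ E s c} (𝒞 : Cover δ E) → (∀ n → ∑ n (λ i → diam (Cover.piece 𝒞 i) ^± s) ≤ c) → cost s 𝒞 ≤± [ c ]
  cost-upper {s = s} {c} 𝒞 sums≤c = proj₂ (⨆-isSupremum {I = ℕ} _) [ c ]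
    λ n → ≤±.[ ≤-trans (≤-reflexive (sum≈∑ n (λ i → diam (Cover.piece 𝒞 i) ^± s))) (sums≤c n) ]

  cost-lower : ∀ {δ E s c} (𝒞 : Cover δ E) → cost s 𝒞 ≤± [ c ] → ∀ n → ∑ n (λ i → diam (Cover.piece 𝒞 i) ^± s) ≤ c
  cost-lower {s = s} {c} 𝒞 cost≤c n = ≤-trans (≤-reflexive (sym (sum≈∑ n (λ i → diam (Cover.piece 𝒞 i) ^± s))))
    (≤±.[≤]-injective (≤±-trans (proj₁ (⨆-isSupremum {I = ℕ} _) n) cost≤c))

  null : ∀ {s} (E : Pred ℝ 0ℓ) →
    (∀ δ η → 0# < δ → 0# < η → ∃ λ (𝒞 : Cover δ E) → ∀ n → ∑ n (λ i → diam (Cover.piece 𝒞 i) ^± s) ≤ η) →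
    hausdorffMeasure s E ≈± [ 0# ]
  null {s} E covers = ≤±-antisym
    (proj₂ (⨆-isSupremum {I = ∃ λ δ → 0# < δ} _) [ 0# ] λ { (δ , 0<δ) → ≤±-by-ε _ λ η 0<η →
      let (𝒞 , sums≤η) = covers δ η 0<δ 0<η in
      ≤±-trans (proj₁ (⨅-isInfimum (cost s)) 𝒞)
        (≤±-trans (cost-upper 𝒞 sums≤η) ≤±.[ ≤-reflexive (sym (+-identityˡ η)) ]) })
    -- Nonnegativity: every cost is at least its empty partial sum, and the supremum over `δ` is at
    -- least its value at the arbitrary choice `δ = 1`.
    (≤±-trans (proj₂ (⨅-isInfimum (cost {1#} {E} s)) [ 0# ] (λ 𝒞 → proj₁ (⨆-isSupremum {I = ℕ} _) 0))
      (proj₁ (⨆-isSupremum {I = ∃ λ δ → 0# < δ} _) (1# , 0<1)))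

  cheap-cover : ∀ {s} (E : Pred ℝ 0ℓ) → hausdorffMeasure s E ≈± [ 0# ] → ∀ {δ η} → 0# < δ → 0# < η →
    ∃ λ (𝒞 : Cover δ E) → ∀ n → ∑ n (λ i → diam (Cover.piece 𝒞 i) ^± s) ≤ η
  cheap-cover {s} E H≈0 {δ} {η} 0<δ 0<η = go em
    where
    go : Dec (∃ λ (𝒞 : Cover δ E) → cost s 𝒞 ≤± [ η ]) →
         ∃ λ (𝒞 : Cover δ E) → ∀ n → ∑ n (λ i → diam (Cover.piece 𝒞 i) ^± s) ≤ η
    go (yes (𝒞 , cost≤η)) = 𝒞 , cost-lower 𝒞 cost≤η
    go (no ¬cheap) = ⊥-elim (<⇒≱ 0<η (≤±.[≤]-injective (≤±-trans
      (proj₂ (⨅-isInfimum (cost {δ} {E} s)) [ η ] expensive)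
      (≤±-trans (proj₁ (⨆-isSupremum {I = ∃ λ δ → 0# < δ} _) (δ , 0<δ)) (≤±-reflexive H≈0)))))
      where
      expensive : ∀ 𝒞 → [ η ] ≤± cost s 𝒞
      expensive 𝒞 = [ id , (λ ≤η → ⊥-elim (¬cheap (𝒞 , ≤η))) ]′ (≤±-total [ η ] (cost s 𝒞))

  -- Nullity in every dimension above 1 and in none below pins the infimum, whatever happens at
  -- `s = 1`.
  dimH≈1 : ∀ (E : Pred ℝ 0ℓ) →
    (∀ s → 0# ≤ s → s < 1# → ¬ (hausdorffMeasure s E ≈± [ 0# ])) →
    (∀ s → 1# < s → hausdorffMeasure s E ≈± [ 0# ]) →
    dimH E ≈± [ 1# ]
  dimH≈1 E positive zero-above = ≤±-antisym
    (≤±-by-ε _ λ ε 0<ε → let 1<1+ε = <-by (solve 1 (λ ε → :1 :+ ε :- :1 := ε) ε) 0<ε in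
      proj₁ inf (1# + ε , 0≤1 0≤+ <⇒≤ 0<ε , zero-above (1# + ε) 1<1+ε))
    (proj₂ inf [ 1# ] λ { (s , 0≤s , H≈0) → ≤±.[ ≮⇒≥ (λ s<1 → positive s 0≤s s<1 H≈0) ] })
    where
    inf = ⨅-isInfimum {I = ∃ λ s → 0# ≤ s × hausdorffMeasure s E ≈± [ 0# ]} (λ (s , _) → [ s ])

  -- Dimension at most one

  -- The two sequences exchange roles at each step, so the lemmas on it recurse with exchanged
  -- arguments and no parity is ever computed.
  interleave : ∀ {a} {A : Set a} → (ℕ → A) → (ℕ → A) → ℕ → A
  interleave f g zero    = f 0
  interleave f g (suc n) = interleave g (f ∘ suc) n

  interleave-left  : ∀ {a} {A : Set a} (f g : ℕ → A) j → ∃ λ i → interleave f g i ≡ f j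
  interleave-right : ∀ {a} {A : Set a} (f g : ℕ → A) j → ∃ λ i → interleave f g i ≡ g j
  interleave-left  f g zero    = 0 , ≡.refl
  interleave-left  f g (suc j) = let (i , eq) = interleave-right g (f ∘ suc) j in suc i , eq
  interleave-right f g j       = let (i , eq) = interleave-left g (f ∘ suc) j in suc i , eq

  interleave-all : ∀ {a p} {A : Set a} (P : A → Set p) f g → (∀ j → P (f j)) → (∀ j → P (g j)) → ∀ i → P (interleave f g i)
  interleave-all P f g Pf Pg zero    = Pf 0
  interleave-all P f g Pf Pg (suc i) = interleave-all P g (f ∘ suc) Pg (Pf ∘ suc) i

  ∑-interleave : ∀ {a} {A : Set a} (F : A → ℝ) → (∀ x → 0# ≤ F x) → ∀ n f g →
    ∑ n (F ∘ interleave f g) ≤ ∑ n (F ∘ f) + ∑ n (F ∘ g)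
  ∑-interleave F 0≤F zero    f g = ≤-reflexive (sym (+-identityˡ 0#))
  ∑-interleave F 0≤F (suc n) f g = begin
    ∑ (suc n) (F ∘ interleave f g)                            ≈⟨ ∑-front n _ ⟩
    F (f 0) + ∑ n (F ∘ interleave g (f ∘ suc)) ≤⟨ +-monoʳ-≤ _ (∑-interleave F 0≤F n g (f ∘ suc)) ⟩
    F (f 0) + (∑ n (F ∘ g) + ∑ n (F ∘ f ∘ suc)) ≈⟨ solve 3 (λ a b c → a :+ (b :+ c) := a :+ c :+ b) _ _ _ ⟩
    F (f 0) + ∑ n (F ∘ f ∘ suc) + ∑ n (F ∘ g)                 ≈⟨ +-congʳ (∑-front n (F ∘ f)) ⟨
    ∑ (suc n) (F ∘ f) + ∑ n (F ∘ g) ≤⟨ +-monoʳ-≤ _ (∑-monoˡ (ℕ.n≤1+n n) (λ i → 0≤F (g i))) ⟩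
    ∑ (suc n) (F ∘ f) + ∑ (suc n) (F ∘ g)                     ∎

  -- The tangent inequality at `y / x`. With the arguments exchanged it also bounds a gap from
  -- below, as `power-telescope` requires.
  log-gap-upper : ∀ {x y} → 0# < x → 0# < y → log y - log x ≤ x ⁻¹ * (y - x)
  log-gap-upper {x} {y} 0<x 0<y = begin
    log y - log x           ≈⟨ +-congˡ (sym (log-⁻¹ 0<x)) ⟩
    log y + log (x ⁻¹)      ≈⟨ log-* 0<y (0<⁻¹ 0<x) ⟨
    log (y * x ⁻¹)          ≤⟨ log≤x-1 (0<y 0<* 0<⁻¹ 0<x) ⟩
    y * x ⁻¹ - 1#           ≈⟨ +-congˡ (-‿cong (*-inverse-pos 0<x)) ⟨
    y * x ⁻¹ - x * x ⁻¹     ≈⟨ solve 3 (λ x y i → y :* i :- x :* i := i :* (y :- x)) x y _ ⟩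
    x ⁻¹ * (y - x)          ∎

  -- `t * (m + 1)^(-1 - t) ≤ m^(-t) - (m + 1)^(-t)`, which replaces the integral test for `Σ
  -- m^(-s)`. It follows from `1 + u ≤ exp u` at `u = t * (log (m + 1) - log
  -- m)`, a gap of at least `t / (m + 1)`.
  power-telescope : ∀ {t m} → 0# ≤ t → 0 ℕ.< m →
    t * exp ((1# + t) * log (fromℕ (suc m) ⁻¹)) ≤ exp (- (t * log (fromℕ m))) - exp (- (t * log (fromℕ (suc m))))
  power-telescope {t} {m} 0≤t 0<m = begin
    t * exp ((1# + t) * log (M′ ⁻¹))
      ≈⟨ *-congˡ (trans (exp-cong (trans (*-congˡ (log-⁻¹ 0<M′)) (solve 2 (λ t l → (:1 :+ t) :* (:- l) := :- (t :* l) :+ :- l) t (log M′))))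
           (trans (exp-+ _ _) (*-congˡ (trans (exp-cong (sym (log-⁻¹ 0<M′))) (exp-log (0<⁻¹ 0<M′)))))) ⟩
    t * (G′ * M′ ⁻¹) ≈⟨ solve 3 (λ t g i → t :* (g :* i) := g :* (:1 :+ t :* i) :- g) t G′ _ ⟩
    G′ * (1# + t * M′ ⁻¹) - G′ ≤⟨ +-monoˡ-≤ (- G′) (*-monoˡ-≤ G′ (<⇒≤ (0<exp _)) (+-monoʳ-≤ 1# (*-monoˡ-≤ t 0≤t gap))) ⟩
    G′ * (1# + t * (log M′ - log M)) - G′ ≤⟨ +-monoˡ-≤ (- G′) (*-monoˡ-≤ G′ (<⇒≤ (0<exp _)) (1+x≤exp _)) ⟩
    G′ * exp (t * (log M′ - log M)) - G′
      ≈⟨ +-congʳ (trans (sym (exp-+ _ _)) (exp-cong (solve 3 (λ t l k → :- (t :* l) :+ t :* (l :- k) := :- (t :* k)) t (log M′) (log M)))) ⟩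
    exp (- (t * log M)) - G′            ∎
    where
    M M′ G′ : ℝ
    M  = fromℕ m
    M′ = fromℕ (suc m)
    G′ = exp (- (t * log M′))

    0<M : 0# < M
    0<M = 0<fromℕ 0<m
    0<M′ : 0# < M′
    0<M′ = 0<fromℕ {suc m} (ℕ.s≤s ℕ.z≤n)

    gap : M′ ⁻¹ ≤ log M′ - log M
    gap = ≤-by (solve 3 (λ a b i → a :- b :- i := :- i :- (b :- a)) (log M′) (log M) _)
      (diff (≤-trans (log-gap-upper 0<M′ 0<M) (≤-reflexive
        (solve 2 (λ m i → i :* (m :- (:1 :+ m)) := :- i) M (M′ ⁻¹)))))

  -- The intervals [log m, log (m + 1)] for m > N have lengths below 1/m, so
  -- they exhaust a half-line although the sums of s-th powers are small.
  line-cover : ∀ (E : Pred ℝ 0ℓ) {s δ η} → 1# < s → 0# < δ → 0# < η →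
    ∃ λ (𝒞 : Cover δ E) → ∀ n → ∑ n (λ i → diam (Cover.piece 𝒞 i) ^± s) ≤ η
  line-cover E {s} {δ} {η} 1<s 0<δ 0<η = record { piece = piece ; covers = λ {x} _ → covering x ; small = pieces } , total
    where
    t w : ℝ
    t = s - 1#
    w = (t * η) ⁻¹ * fromℕ 2

    0<t : 0# < t
    0<t = diff-< 1<s
    0<tη : 0# < t * η
    0<tη = 0<t 0<* 0<η

    -- `N ≥ exp (w / t)` forces `N^t ≥ w = 2 / (t η)`, where the 2 pays for the two half-lines, and
    -- `N ≥ 1 / δ` makes the pieces small enough. The successor keeps `N + j` visibly positive.
    N = suc (proj₁ (archimedean (exp (t ⁻¹ * w) + δ ⁻¹)))

    e+δ⁻¹≤N : exp (t ⁻¹ * w) + δ ⁻¹ ≤ fromℕ N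
    e+δ⁻¹≤N = ≤-trans (proj₂ (archimedean (exp (t ⁻¹ * w) + δ ⁻¹))) (fromℕ-mono-≤ (ℕ.n≤1+n (proj₁ (archimedean (exp (t ⁻¹ * w) + δ ⁻¹)))))

    e≤N : exp (t ⁻¹ * w) ≤ fromℕ N
    e≤N = ≤-trans (≤-by (solve 2 (λ a b → a :+ b :- a := b) _ _) (0≤⁻¹ 0<δ)) e+δ⁻¹≤N

    δ⁻¹≤N : δ ⁻¹ ≤ fromℕ N
    δ⁻¹≤N = ≤-trans (≤-by (solve 2 (λ a b → a :+ b :- b := a) _ _) (<⇒≤ (0<exp _))) e+δ⁻¹≤N

    M : ℕ → ℝ
    M j = fromℕ (suc (N ℕ.+ j))

    0<M : ∀ j → 0# < M j
    0<M j = 0<fromℕ {suc (N ℕ.+ j)} (ℕ.s≤s ℕ.z≤n)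

    M⁻¹≤δ : ∀ j → M j ⁻¹ ≤ δ
    M⁻¹≤δ j = ≤-trans (⁻¹-antimono-≤ (0<⁻¹ 0<δ) (≤-trans δ⁻¹≤N (fromℕ-mono-≤ (ℕ.m≤n⇒m≤1+n (ℕ.m≤m+n N j)))))
      (≤-reflexive (⁻¹-involutive 0<δ))

    r : ℕ → ℝ
    r j = log (M j) - log (M 0)

    r-gap : ∀ j → r (suc j) - r j ≤ M j ⁻¹
    r-gap j = begin
      r (suc j) - r j ≈⟨ solve 3 (λ a b c → a :- c :- (b :- c) := a :- b) _ _ _ ⟩
      log (M (suc j)) - log (M j)             ≤⟨ log-gap-upper (0<M j) (0<M (suc j)) ⟩
      M j ⁻¹ * (M (suc j) - M j) ≈⟨ *-congˡ (+-congʳ (reflexive (≡.cong (λ k → fromℕ (suc k)) (ℕ.+-suc N j)))) ⟩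
      M j ⁻¹ * (1# + M j - M j) ≈⟨ solve 2 (λ m i → i :* (:1 :+ m :- m) := i) (M j) _ ⟩
      M j ⁻¹                                  ∎

    up down : ℕ → Pred ℝ 0ℓ
    up   j x = r j ≤ x × x ≤ r (suc j)
    down j x = up j (- x)

    piece : ℕ → Pred ℝ 0ℓ
    piece = interleave up down

    D : ℕ → ℝ
    D j = exp (s * log (M j ⁻¹))

    up-∣-∣≤ : ∀ j {x y} → up j x → up j y → ∣ x - y ∣ ≤ M j ⁻¹
    up-∣-∣≤ j {x} {y} (r≤x , x≤r) (r≤y , y≤r) = ≤-trans (∣∣-lub
      (≤-by (solve 4 (λ a b x y → b :- a :- (x :- y) := b :- x :+ (y :- a)) (r j) (r (suc j)) x y) (diff x≤r 0≤+ diff r≤y))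
      (≤-by (solve 4 (λ a b x y → b :- a :- :- (x :- y) := b :- y :+ (x :- a)) (r j) (r (suc j)) x y) (diff y≤r 0≤+ diff r≤x)))
      (r-gap j)

    Good : Pred ℝ 0ℓ → ℝ → Set
    Good U b = diam U ≤± [ b ]

    up-diam : ∀ j → Good (up j) (M j ⁻¹)
    up-diam j = diam-least (λ x y → up-∣-∣≤ j)

    down-diam : ∀ j → Good (down j) (M j ⁻¹)
    down-diam j = diam-least (λ x y ux uy → ≤-trans
      (≤-reflexive (trans (sym (∣-x∣≈∣x∣ (x - y))) (∣∣-cong (solve 2 (λ x y → :- (x :- y) := :- x :- :- y) x y))))
      (up-∣-∣≤ j ux uy))

    pieces : ∀ i → Good (piece i) δ
    pieces = interleave-all (λ U → Good U δ) up down
      (λ j → ≤±-trans (up-diam j) ≤±.[ M⁻¹≤δ j ]) (λ j → ≤±-trans (down-diam j) ≤±.[ M⁻¹≤δ j ])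

    0<s : 0# < s
    0<s = <-trans 0<1 1<s

    F : Pred ℝ 0ℓ → ℝ
    F U = diam U ^± s

    F-upper : ∀ U j → Good U (M j ⁻¹) → F U ≤ D j
    F-upper U j = ^±-upper (diam U) 0<s (0<⁻¹ (0<M j)) (diam-nonNeg U)

    G : ℕ → ℝ
    G j = exp (- (t * log (fromℕ (N ℕ.+ j))))

    ∑D≤ : ∀ n → t * ∑ n D ≤ G 0
    ∑D≤ n = begin
      t * ∑ n D               ≈⟨ ∑-*ˡ n t D ⟨
      ∑ n (λ j → t * D j)     ≤⟨ ∑-telescope n G (λ j _ → begin
        t * D j ≈⟨ *-congˡ (exp-cong (*-congʳ (solve 1 (λ s → s := :1 :+ (s :- :1)) s))) ⟩
        t * exp ((1# + t) * log (M j ⁻¹)) ≤⟨ power-telescope {m = N ℕ.+ j} (<⇒≤ 0<t) (ℕ.s≤s ℕ.z≤n) ⟩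
        G j - exp (- (t * log (fromℕ (suc (N ℕ.+ j))))) ≡⟨ ≡.cong (λ k → G j - exp (- (t * log (fromℕ k)))) (ℕ.+-suc N j) ⟨
        G j - G (suc j)                                   ∎) ⟩
      G 0 - G n ≤⟨ ≤-by (solve 2 (λ a b → a :- (a :- b) := b) (G 0) (G n)) (<⇒≤ (0<exp _)) ⟩
      G 0                     ∎

    2G≤tη : fromℕ 2 * G 0 ≤ t * η
    2G≤tη = *-cancelʳ-≤ (exp L) (0<exp L) (begin
      fromℕ 2 * G 0 * exp L ≡⟨ ≡.cong (λ k → fromℕ 2 * exp (- (t * log (fromℕ k))) * exp L) (ℕ.+-identityʳ N) ⟩
      fromℕ 2 * exp (- L) * exp L     ≈⟨ trans (*-assoc _ _ _) (*-congˡ (exp-neg L)) ⟩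
      fromℕ 2 * 1#                    ≈⟨ *-identityʳ _ ⟩
      fromℕ 2 ≈⟨ trans (sym (*-assoc _ _ _)) (trans (*-congʳ (*-inverse-pos 0<tη)) (*-identityˡ _)) ⟨
      t * η * w                       ≤⟨ *-monoˡ-≤ _ (<⇒≤ 0<tη) w≤ ⟩
      t * η * exp L                   ∎)
      where
      L = t * log (fromℕ N)

      w≤ : w ≤ exp L
      w≤ = begin
        w ≈⟨ trans (sym (*-assoc _ _ _)) (trans (*-congʳ (*-inverse-pos 0<t)) (*-identityˡ w)) ⟨
        t * (t ⁻¹ * w)            ≈⟨ *-congˡ (log-exp _) ⟨
        t * log (exp (t ⁻¹ * w))  ≤⟨ *-monoˡ-≤ t (<⇒≤ 0<t) (log-mono-≤ (0<exp _) e≤N) ⟩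
        L                         ≤⟨ ≤-by (solve 1 (λ l → :1 :+ l :- l := :1) L) 0≤1 ⟩
        1# + L                    ≤⟨ 1+x≤exp L ⟩
        exp L                     ∎

    total : ∀ n → ∑ n (F ∘ piece) ≤ η
    total n = *-cancelˡ-≤ t 0<t (begin
      t * ∑ n (F ∘ piece) ≤⟨ *-monoˡ-≤ t (<⇒≤ 0<t) (≤-trans (∑-interleave F (λ U → ^±-nonNeg (diam U) s) n up down)
                                                    (+-mono-≤ (∑-mono n (λ j _ → F-upper (up j) j (up-diam j)))
                                                              (∑-mono n (λ j _ → F-upper (down j) j (down-diam j))))) ⟩
      t * (∑ n D + ∑ n D) ≈⟨ solve 2 (λ t d → t :* (d :+ d) := con 2 :* (t :* d)) t _ ⟩
      fromℕ 2 * (t * ∑ n D)                     ≤⟨ *-monoˡ-≤ _ (0≤fromℕ 2) (∑D≤ n) ⟩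
      fromℕ 2 * G 0                             ≤⟨ 2G≤tη ⟩
      t * η                                     ∎)

    unbounded : ∀ x → ∃ λ n → x ≤ r n
    unbounded x = n , (begin
      x                                     ≈⟨ solve 2 (λ x l → x := l :+ x :- l) x (log (M 0)) ⟩
      log (M 0) + x - log (M 0)             ≤⟨ +-monoˡ-≤ _ (exp-cancel-≤ (begin
        exp (log (M 0) + x)                 ≤⟨ proj₂ big ⟩
        fromℕ n                             ≤⟨ fromℕ-mono-≤ (ℕ.m≤n⇒m≤1+n (ℕ.m≤n+m n N)) ⟩
        M n                                 ≈⟨ exp-log (0<M n) ⟨
        exp (log (M n))                     ∎)) ⟩
      r n                                   ∎)
      where
      big = archimedean (exp (log (M 0) + x))
      n = proj₁ big

    half-line : ∀ x → 0# ≤ x → ∃ λ j → up j x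
    half-line x 0≤x = first (least (λ n → x ≤ r n) (proj₁ (unbounded x)) (proj₂ (unbounded x)))
      where
      first : (∃ λ m → x ≤ r m × (∀ k → k ℕ.< m → ¬ (x ≤ r k))) → ∃ λ j → up j x
      first (zero  , x≤r₀ , _)  = 0 , ≤-trans (≤-reflexive (-‿inverseʳ (log (M 0)))) 0≤x
        , ≤-trans x≤r₀ (+-monoˡ-≤ _ (log-mono-≤ (0<M 0) (fromℕ-mono-≤ {suc (N ℕ.+ 0)} {suc (N ℕ.+ 1)} (ℕ.s≤s (ℕ.+-monoʳ-≤ N (ℕ.n≤1+n 0))))))
      first (suc j , x≤r , min) = j , <⇒≤ (≰⇒> (min j (ℕ.n<1+n j))) , x≤r

    covering : ∀ x → ∃ λ i → piece i x
    covering x = [ nonneg , nonpos ]′ (≤-total 0# x)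
      where
      nonneg : 0# ≤ x → ∃ λ i → piece i x
      nonneg 0≤x = let (j , u) = half-line x 0≤x ; (i , eq) = interleave-left up down j in
        i , ≡.subst (λ U → U x) (≡.sym eq) u

      nonpos : x ≤ 0# → ∃ λ i → piece i x
      nonpos x≤0 = let (j , u) = half-line (- x) (≤-trans (≤-reflexive (sym -0#≈0#)) (-‿mono-≤ x≤0))
                       (i , eq) = interleave-right up down j in
        i , ≡.subst (λ U → U x) (≡.sym eq) u

  null-above-1 : ∀ (E : Pred ℝ 0ℓ) s → 1# < s → hausdorffMeasure s E ≈± [ 0# ]
  null-above-1 E s 1<s = null E (λ δ η → line-cover E 1<s)

  -- Distance to the nearest integer

  fromℤ-⊖ : ∀ m n → fromℤ (m ℤ.⊖ n) ≈ fromℕ m - fromℕ n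
  fromℤ-⊖ m n with ℕ.≤-total n m
  ... | inj₁ n≤m = trans (reflexive (≡.cong fromℤ (ℤ.⊖-≥ n≤m))) (fromℕ-∸ n≤m)
  ... | inj₂ m≤n = trans (reflexive (≡.cong fromℤ (ℤ.⊖-≤ m≤n))) (trans (fromℤ-neg (n ℕ.∸ m))
    (trans (-‿cong (fromℕ-∸ m≤n)) (solve 2 (λ m n → :- (n :- m) := m :- n) _ _)))
    where
    fromℤ-neg : ∀ k → fromℤ (ℤ.- (ℤ.+ k)) ≈ - fromℕ k
    fromℤ-neg zero    = sym -0#≈0#
    fromℤ-neg (suc k) = refl

  fromℤ-ℕ-ℕ : ∀ z → ∃ λ m → ∃ λ n → fromℤ z ≈ fromℕ m - fromℕ n
  fromℤ-ℕ-ℕ (ℤ.+ m)    = m , 0 , solve 1 (λ m → m := m :- :0) _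
  fromℤ-ℕ-ℕ ℤ.-[1+ n ] = 0 , suc n , solve 1 (λ n → :- n := :0 :- n) _

  fromℤ-difference : ∀ y z → ∃ λ x → fromℤ x ≈ fromℤ y - fromℤ z
  fromℤ-difference y z =
    let (m , n , y≈) = fromℤ-ℕ-ℕ y ; (k , l , z≈) = fromℤ-ℕ-ℕ z in
    (m ℕ.+ l) ℤ.⊖ (n ℕ.+ k) , (begin-equality
      fromℤ ((m ℕ.+ l) ℤ.⊖ (n ℕ.+ k))                   ≈⟨ fromℤ-⊖ (m ℕ.+ l) (n ℕ.+ k) ⟩
      fromℕ (m ℕ.+ l) - fromℕ (n ℕ.+ k) ≈⟨ +-cong (fromℕ-+ m l) (-‿cong (fromℕ-+ n k)) ⟩
      fromℕ m + fromℕ l - (fromℕ n + fromℕ k)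
        ≈⟨ solve 4 (λ m l n k → m :+ l :- (n :+ k) := m :- n :- (k :- l)) (fromℕ m) (fromℕ l) (fromℕ n) (fromℕ k) ⟩
      fromℕ m - fromℕ n - (fromℕ k - fromℕ l)           ≈⟨ +-cong (sym y≈) (-‿cong (sym z≈)) ⟩
      fromℤ y - fromℤ z                                 ∎)

  -- The extended infimum exists; the lower bound 0 keeps it from being -∞ and the value at the
  -- integer 0 keeps it from being +∞.
  ‖‖-isInfimum : ∀ x → IsInfimum _≤_ (λ m → ∣ x - fromℤ m ∣) ‖ x ‖
  ‖‖-isInfimum x = the-spec 0# (IsInfimum _≤_ f) (let (v , inf) = infimum-exists ([_] ∘ f) in finite v inf)
    where
    f : ℤ → ℝ
    f m = ∣ x - fromℤ m ∣

    finite : ∀ v → IsInfimum _≤±_ ([_] ∘ f) v → ∃ (IsInfimum _≤_ f)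
    finite ⊥±    (_ , greatest)     = ⊥-elim ([]≰⊥ (greatest [ 0# ] (λ m → ≤±.[ 0≤∣x∣ _ ])))
    finite [ r ] (lower , greatest) = r , (λ m → ≤±.[≤]-injective (lower m)) ,
      λ l l≤f → ≤±.[≤]-injective (greatest [ l ] (λ m → ≤±.[ l≤f m ]))
    finite ⊤±    (lower , _) with () ← lower (ℤ.+ 0)

  ‖‖≤ : ∀ x m → ‖ x ‖ ≤ ∣ x - fromℤ m ∣
  ‖‖≤ x = proj₁ (‖‖-isInfimum x)

  ‖‖-greatest : ∀ {x l} → (∀ m → l ≤ ∣ x - fromℤ m ∣) → l ≤ ‖ x ‖
  ‖‖-greatest {x} {l} = proj₂ (‖‖-isInfimum x) l

  -- An integer beating any strictly larger bound stands in for a nearest integer, at the price of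
  -- the factor 2 in `Block.near`.
  ‖‖-approx : ∀ {x r} → ‖ x ‖ < r → ∃ λ m → ∣ x - fromℤ m ∣ < r
  ‖‖-approx {x} {r} ‖x‖<r = go em
    where
    go : Dec (∃ λ m → ∣ x - fromℤ m ∣ < r) → ∃ λ m → ∣ x - fromℤ m ∣ < r
    go (yes p) = p
    go (no ¬p) = ⊥-elim (<⇒≱ ‖x‖<r (‖‖-greatest (λ m → ≮⇒≥ (λ lt → ¬p (m , lt)))))

  ‖‖≤half : ∀ x → ‖ x ‖ ≤ half
  ‖‖≤half x = [ nonneg , nonpos ]′ (≤-total 0# x)
    where
    near : ∀ x → 0# ≤ x → ∃ λ n → ∣ x - fromℕ n ∣ ≤ half
    near x 0≤x = [ left , right ]′ (≤-or-> (x - fromℕ n) half)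
      where
      n = proj₁ (floor x 0≤x)
      n≤x = proj₁ (proj₂ (floor x 0≤x))
      x<1+n = proj₂ (proj₂ (floor x 0≤x))

      left : x - fromℕ n ≤ half → ∃ λ n → ∣ x - fromℕ n ∣ ≤ half
      left x-n≤½ = n , ∣∣-lub x-n≤½
        (≤-trans (≤-by (solve 2 (λ x n → :0 :- :- (x :- n) := x :- n) x (fromℕ n)) (diff n≤x)) (<⇒≤ 0<half))

      right : half < x - fromℕ n → ∃ λ n → ∣ x - fromℕ n ∣ ≤ half
      right ½<x-n = suc n , ∣∣-lub
        (≤-trans (≤-by (solve 2 (λ x n → :0 :- (x :- (:1 :+ n)) := :1 :+ n :- x) x (fromℕ n)) (diff (<⇒≤ x<1+n))) (<⇒≤ 0<half))
        (≤-by (solve 3 (λ x n h → h :- :- (x :- (:1 :+ n)) := h :+ (x :- n) :- :1) x (fromℕ n) half)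
          (diff (≤-trans (≤-reflexive (sym half+half)) (+-monoʳ-≤ half (<⇒≤ ½<x-n)))))

    nonneg : 0# ≤ x → ‖ x ‖ ≤ half
    nonneg 0≤x = let (n , close) = near x 0≤x in begin
      ‖ x ‖                         ≤⟨ ‖‖≤ x (ℤ.+ n) ⟩
      ∣ x - fromℕ n ∣               ≤⟨ close ⟩
      half                          ∎

    nonpos : x ≤ 0# → ‖ x ‖ ≤ half
    nonpos x≤0 = let (n , close) = near (- x) (≤-trans (≤-reflexive (sym -0#≈0#)) (-‿mono-≤ x≤0)) in begin
      ‖ x ‖                         ≤⟨ ‖‖≤ x (0 ℤ.⊖ n) ⟩
      ∣ x - fromℤ (0 ℤ.⊖ n) ∣       ≈⟨ ∣∣-cong (+-congˡ (-‿cong (fromℤ-⊖ 0 n))) ⟩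
      ∣ x - (0# - fromℕ n) ∣ ≈⟨ ∣∣-cong (solve 2 (λ x n → x :- (:0 :- n) := :- (:- x :- n)) x (fromℕ n)) ⟩
      ∣ - (- x - fromℕ n) ∣         ≈⟨ ∣-x∣≈∣x∣ (- x - fromℕ n) ⟩
      ∣ - x - fromℕ n ∣             ≤⟨ close ⟩
      half                          ∎

  -- Powers of two and sums of powers

  p2 : ℕ → ℝ
  p2 n = fromℕ (2 ℕ.^ n)

  0<p2 : ∀ n → 0# < p2 n
  0<p2 n = 0<fromℕ (ℕ.m^n>0 2 n)

  p2-suc : ∀ n → p2 (suc n) ≈ fromℕ 2 * p2 n
  p2-suc n = fromℕ-^ 2 n

  p2-+ : ∀ m n → p2 (m ℕ.+ n) ≈ p2 m * p2 n
  p2-+ m n = trans (fromℕ-cong (ℕ.^-distribˡ-+-* 2 m n)) (fromℕ-* (2 ℕ.^ m) (2 ℕ.^ n))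

  p2-mono-≤ : ∀ {m n} → m ℕ.≤ n → p2 m ≤ p2 n
  p2-mono-≤ m≤n = fromℕ-mono-≤ (ℕ.^-monoʳ-≤ 2 m≤n)

  n<2^n : ∀ n → n ℕ.< 2 ℕ.^ n
  n<2^n zero    = ℕ.s≤s ℕ.z≤n
  n<2^n (suc n) = ℕ.≤-trans (ℕ.+-mono-≤ (ℕ.m^n>0 2 n) (n<2^n n))
    (ℕ.≤-reflexive (≡.cong (2 ℕ.^ n ℕ.+_) (≡.sym (ℕ.+-identityʳ (2 ℕ.^ n)))))

  -- Telescoping: t j^{t-1} ≤ j^t - (j-1)^t by concavity.  The term 0^t = 0 is
  -- set by hand because log 0 is junk.
  power-sum : ∀ {t} → 0# ≤ t → t ≤ 1# → ∀ n →
    t * ∑ (suc n) (λ j → exp (- ((1# - t) * log (fromℕ (suc j))))) ≤ exp (t * log (fromℕ (suc n)))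
  power-sum {t} 0≤t t≤1 n = begin
    t * ∑ (suc n) (λ j → exp (- ((1# - t) * log (fromℕ (suc j)))))  ≈⟨ ∑-*ˡ (suc n) t _ ⟨
    ∑ (suc n) (λ j → t * exp (- ((1# - t) * log (fromℕ (suc j))))) ≤⟨ ∑-telescope (suc n) (λ j → - H j) (λ j _ → step j) ⟩
    - 0# - - exp (t * log (fromℕ (suc n))) ≈⟨ solve 1 (λ h → :- :0 :- :- h := h) _ ⟩
    exp (t * log (fromℕ (suc n)))                                   ∎
    where
    H : ℕ → ℝ
    H zero    = 0#
    H (suc j) = exp (t * log (fromℕ (suc j)))

    split-power : ∀ j → exp (- ((1# - t) * log (fromℕ (suc j)))) ≈ H (suc j) * fromℕ (suc j) ⁻¹
    split-power j = begin-equality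
      exp (- ((1# - t) * l)) ≈⟨ exp-cong (solve 2 (λ t l → :- ((:1 :- t) :* l) := t :* l :+ :- l) t l) ⟩
      exp (t * l + - l)         ≈⟨ exp-+ _ _ ⟩
      H (suc j) * exp (- l) ≈⟨ *-congˡ (trans (exp-cong (sym (log-⁻¹ 0<1+j))) (exp-log (0<⁻¹ 0<1+j))) ⟩
      H (suc j) * fromℕ (suc j) ⁻¹ ∎
      where
      l = log (fromℕ (suc j))
      0<1+j : 0# < fromℕ (suc j)
      0<1+j = 0<fromℕ {suc j} (ℕ.s≤s ℕ.z≤n)

    step : ∀ j → t * exp (- ((1# - t) * log (fromℕ (suc j)))) ≤ - H j - - H (suc j)
    step zero    = begin
      t * exp (- ((1# - t) * log (fromℕ 1))) ≈⟨ *-congˡ (trans (exp-cong (trans (-‿cong (trans (*-congˡ log1) (zeroʳ _))) -0#≈0#)) exp-0) ⟩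
      t * 1#                                  ≈⟨ *-identityʳ t ⟩
      t                                       ≤⟨ t≤1 ⟩
      1# ≈⟨ trans (exp-cong (trans (*-congˡ log1) (zeroʳ t))) exp-0 ⟨
      H 1                                     ≈⟨ solve 1 (λ h → h := :- :0 :- :- h) _ ⟩
      - 0# - - H 1                            ∎
      where
      log1 : log (fromℕ 1) ≈ 0#
      log1 = trans (log-cong (0<fromℕ {1} (ℕ.s≤s ℕ.z≤n)) (+-identityʳ 1#)) log-1
    step (suc j) = begin
      t * exp (- ((1# - t) * log M′))         ≈⟨ *-congˡ (split-power (suc j)) ⟩
      t * (H′ * M′ ⁻¹) ≈⟨ solve 3 (λ t h i → t :* (h :* i) := h :- h :* (:1 :+ t :* (:- i))) t H′ _ ⟩
      H′ - H′ * (1# + t * - (M′ ⁻¹)) ≈⟨ +-congˡ (-‿cong (*-congˡ (+-congˡ (*-congˡ ratio)))) ⟨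
      H′ - H′ * (1# + t * (exp u - 1#)) ≤⟨ +-monoʳ-≤ H′ (-‿mono-≤ (*-monoˡ-≤ H′ (<⇒≤ (0<exp _)) (exp-convex t u 0≤t t≤1))) ⟩
      H′ - H′ * exp (t * u) ≈⟨ +-congˡ (-‿cong (trans (sym (exp-+ _ _)) (exp-cong
                                                   (solve 3 (λ t k l → t :* l :+ t :* (k :- l) := t :* k) t (log M) (log M′))))) ⟩
      H′ - H (suc j)                          ≈⟨ solve 2 (λ h k → h :- k := :- k :- :- h) _ _ ⟩
      - H (suc j) - - H′                      ∎
      where
      M M′ H′ u : ℝ
      M  = fromℕ (suc j)
      M′ = fromℕ (suc (suc j))
      H′ = H (suc (suc j))
      u  = log M - log M′
      0<M : 0# < M
      0<M = 0<fromℕ {suc j} (ℕ.s≤s ℕ.z≤n)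
      0<M′ : 0# < M′
      0<M′ = 0<fromℕ {suc (suc j)} (ℕ.s≤s ℕ.z≤n)

      ratio : exp u - 1# ≈ - (M′ ⁻¹)
      ratio = begin-equality
        exp u - 1# ≈⟨ +-congʳ (exp-cong (trans (+-congˡ (sym (log-⁻¹ 0<M′))) (sym (log-* 0<M (0<⁻¹ 0<M′))))) ⟩
        exp (log (M * M′ ⁻¹)) - 1# ≈⟨ +-cong (exp-log (0<M 0<* 0<⁻¹ 0<M′)) (-‿cong (sym (*-inverse-pos 0<M′))) ⟩
        M * M′ ⁻¹ - M′ * M′ ⁻¹    ≈⟨ solve 2 (λ m i → m :* i :- (:1 :+ m) :* i := :- i) M _ ⟩
        - (M′ ⁻¹)                 ∎

  -- The weights attached to a badly approximable number

  weight : ℝ → ℝ → ℕ → ℝ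
  weight a α q =
    fromℕ q * log (fromℕ q) ^ ((1# + 1#) - a) * log (‖ fromℕ q * α ‖ ⁻¹) ^ a * ‖ fromℕ q * α ‖

  -- The constant of bad approximability is taken to be `2^(-e)`, so that it combines with dyadic
  -- sizes by adding exponents.
  module Weight (a α : ℝ) (0<a : 0# < a) (a<1 : a < 1#) (e : ℕ)
    (bad : ∀ q → 1 ℕ.≤ q → 1# ≤ p2 e * (fromℕ q * ‖ fromℕ q * α ‖)) where

    τ L M w : ℕ → ℝ
    τ q = ‖ fromℕ q * α ‖
    L q = log (fromℕ q) ^ ((1# + 1#) - a)
    M q = log (τ q ⁻¹) ^ a
    w = weight a α

    ℓ : ℝ
    ℓ = log (fromℕ 2)

    0<ℓ : 0# < ℓ
    0<ℓ = 0<log (<-by (solve 0 (con 2 :- :1 := :1)) 0<1)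

    0<τ : ∀ {q} → 1 ℕ.≤ q → 0# < τ q
    0<τ {q} 1≤q = ≰⇒> λ τ≤0 → <⇒≱ 0<1 (begin
      1#                          ≤⟨ bad q 1≤q ⟩
      p2 e * (fromℕ q * τ q)      ≤⟨ *-monoˡ-≤ _ (<⇒≤ (0<p2 e)) (*-monoˡ-≤ _ (0≤fromℕ q) τ≤0) ⟩
      p2 e * (fromℕ q * 0#)       ≈⟨ solve 2 (λ a b → a :* (b :* :0) := :0) _ _ ⟩
      0#                          ∎)

    τ⁻¹≥2 : ∀ {q} → 1 ℕ.≤ q → fromℕ 2 ≤ τ q ⁻¹
    τ⁻¹≥2 {q} 1≤q = ≤-trans (≤-reflexive (sym (⁻¹-involutive 0<2))) (⁻¹-antimono-≤ (0<τ 1≤q) (‖‖≤half (fromℕ q * α)))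

    -- The bound `(k ℓ)^s` is kept in exponential form so that later products of powers reduce to
    -- `exp-+`. `1 ≤ k` makes `x` positive, away from the special case of `_^_`.
    power-lower : ∀ {x s} k → 1 ℕ.≤ k → 0# ≤ s → fromℕ k * ℓ ≤ x → exp (s * log (fromℕ k) + s * log ℓ) ≤ x ^ s
    power-lower {x} {s} k 1≤k 0≤s kℓ≤x = begin
      exp (s * log (fromℕ k) + s * log ℓ) ≈⟨ exp-cong (trans (sym (distribˡ s _ _)) (*-congˡ (sym (log-* 0<k 0<ℓ)))) ⟩
      exp (s * log (fromℕ k * ℓ)) ≤⟨ exp-mono-≤ (*-monoˡ-≤ s 0≤s (log-mono-≤ 0<kℓ kℓ≤x)) ⟩
      exp (s * log x)                       ≈⟨ ^-pos s (<-≤-trans 0<kℓ kℓ≤x) ⟨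
      x ^ s                                 ∎
      where
      0<k : 0# < fromℕ k
      0<k = 0<fromℕ 1≤k
      0<kℓ : 0# < fromℕ k * ℓ
      0<kℓ = 0<k 0<* 0<ℓ

    0≤2-a : 0# ≤ (1# + 1#) - a
    0≤2-a = ≤-trans (0≤1 0≤+ diff (<⇒≤ a<1)) (≤-reflexive (solve 1 (λ a → :1 :+ (:1 :- a) := :1 :+ :1 :- a) a))

    log≥ : ∀ {x} k → p2 k ≤ x → fromℕ k * ℓ ≤ log x
    log≥ {x} k p2≤x = ≤-trans (≤-reflexive (sym (log-^ 2 k (ℕ.s≤s ℕ.z≤n)))) (log-mono-≤ (0<p2 k) p2≤x)

    0<w : ∀ {q} → 2 ℕ.≤ q → 0# < w q
    0<w {q} 2≤q = 0<fromℕ 1≤q 0<* 0<L 0<* 0<M 0<* 0<τ 1≤q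
      where
      1≤q : 1 ℕ.≤ q
      1≤q = ℕ.<⇒≤ 2≤q
      0<L : 0# < L q
      0<L = <-≤-trans (0<exp _) (power-lower 1 ℕ.≤-refl 0≤2-a (log≥ 1 (fromℕ-mono-≤ {2} 2≤q)))
      0<M : 0# < M q
      0<M = <-≤-trans (0<exp _) (power-lower 1 ℕ.≤-refl (<⇒≤ 0<a) (log≥ 1 (τ⁻¹≥2 1≤q)))

    Class : ℕ → ℕ → Set
    Class j q = p2 j * τ q ≤ 1# × 1# < p2 (suc j) * τ q

    -- `B = (e + 2)^(1 - a) / ℓ^2`. In `C`, 12 is the 6 of `class-count` times the 2 lost by
    -- rounding `τ` to a power of two; `1 / (1 - a)` comes from summing `j^(-a)`, and `e + 2` from
    -- the number of classes, at most `(e + 2) n`.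
    B C : ℝ
    B = exp ((1# - a) * log (fromℕ (e ℕ.+ 2)) - (log ℓ + log ℓ))
    C = (1# - a) ⁻¹ * (fromℕ 12 * p2 e * B)

    0<C : 0# < C
    0<C = 0<⁻¹ (diff-< a<1) 0<* (0<fromℕ {12} (ℕ.s≤s ℕ.z≤n) 0<* 0<p2 e 0<* 0<exp _)

    module Block (n : ℕ) (1≤n : 1 ℕ.≤ n) where

      q : ℕ → ℕ
      q i = 2 ℕ.^ n ℕ.+ i

      1≤q : ∀ i → 1 ℕ.≤ q i
      1≤q i = ℕ.≤-trans (ℕ.m^n>0 2 n) (ℕ.m≤m+n _ i)

      J : ℕ
      J = suc (e ℕ.+ n)

      -- Bad approximability and `q < 2^(n + 1)` keep `τ` above `2^(-e - n - 1)`, so `J` classes are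
      -- enough. Since `τ ≤ 1/2`, the least `k` with `1 < 2^k τ` is at least 2; hence class indices
      -- start at 1 and `log j` below is never taken at 0.
      classify : ∀ i → i ℕ.< 2 ℕ.^ n → ∃ λ j → j ℕ.< J × Class (suc j) (q i)
      classify i i<2^n = go (least (λ k → 1# < p2 k * t) (suc (suc (e ℕ.+ n))) big)
        where
        t = τ (q i)

        big : 1# < p2 (suc (suc (e ℕ.+ n))) * t
        big = begin-strict
          1#                                  ≤⟨ bad (q i) (1≤q i) ⟩
          p2 e * (fromℕ (q i) * t)            <⟨ *-monoˡ-< (p2 e) (0<p2 e) (diff-<⁻¹ (<-≤-trans
                                                  (diff-< (fromℕ-mono-< (ℕ.+-monoʳ-< (2 ℕ.^ n) i<2^n)) 0<* 0<τ (1≤q i))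
                                                  (≤-reflexive (solve 3 (λ a b t → (a :- b) :* t := a :* t :- b :* t) _ _ t)))) ⟩
          p2 e * (fromℕ (2 ℕ.^ n ℕ.+ 2 ℕ.^ n) * t) ≈⟨ *-congˡ (*-congʳ (fromℕ-+ (2 ℕ.^ n) (2 ℕ.^ n))) ⟩
          p2 e * ((p2 n + p2 n) * t) ≈⟨ solve 3 (λ e n t → e :* ((n :+ n) :* t) := con 2 :* (e :* n) :* t) (p2 e) (p2 n) t ⟩
          fromℕ 2 * (p2 e * p2 n) * t ≈⟨ *-congʳ (trans (*-congˡ (sym (p2-+ e n))) (sym (p2-suc (e ℕ.+ n)))) ⟩
          p2 (suc (e ℕ.+ n)) * t ≤⟨ *-monoʳ-≤ t (<⇒≤ (0<τ (1≤q i))) (p2-mono-≤ (ℕ.n≤1+n (suc (e ℕ.+ n)))) ⟩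
          p2 (suc (suc (e ℕ.+ n))) * t        ∎

        not-small : ∀ k → k ℕ.≤ 1 → ¬ (1# < p2 k * t)
        not-small k k≤1 lt = <⇒≱ lt (begin
          p2 k * t ≤⟨ *-mono-≤ (<⇒≤ (0<p2 k)) (<⇒≤ 0<half) (p2-mono-≤ k≤1) (‖‖≤half (fromℕ (q i) * α)) ⟩
          p2 1 * half           ≈⟨ *-inverse-pos 0<2 ⟩
          1#                    ∎)

        go : (∃ λ k → 1# < p2 k * t × (∀ m → m ℕ.< k → ¬ (1# < p2 m * t))) → ∃ λ j → j ℕ.< J × Class (suc j) (q i)
        go (0 , lt , _)   = ⊥-elim (not-small 0 ℕ.z≤n lt)
        go (1 , lt , _)   = ⊥-elim (not-small 1 ℕ.≤-refl lt)
        go (suc (suc j) , lt , min) = j , j<J , ≮⇒≥ (min (suc j) ℕ.≤-refl) , lt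
          where
          j<J : j ℕ.< J
          j<J = ℕ.≮⇒≥ λ J<1+j → min (suc (suc (e ℕ.+ n)))
            (ℕ.s≤s J<1+j) big

      near : ∀ i → ∃ λ m → ∣ fromℕ (q i) * α - fromℤ m ∣ < fromℕ 2 * τ (q i)
      near i = ‖‖-approx (<-by (solve 1 (λ t → con 2 :* t :- t := t) (τ (q i))) (0<τ (1≤q i)))

      f : ℕ → ℝ
      f i = fromℕ (q i) * α - fromℤ (proj₁ (near i))

      s : ℝ
      s = p2 (e ℕ.+ n) ⁻¹

      s≤‖‖ : ∀ k → 1 ℕ.≤ k → k ℕ.≤ 2 ℕ.^ n → s ≤ ‖ fromℕ k * α ‖
      s≤‖‖ k 1≤k k≤2^n = ≤-trans (≤-reflexive (sym (*-identityʳ s))) (y⁻¹*z≤x (0<p2 (e ℕ.+ n)) (begin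
        1#                                ≤⟨ bad k 1≤k ⟩
        p2 e * (fromℕ k * ‖ fromℕ k * α ‖) ≤⟨ *-monoˡ-≤ _ (<⇒≤ (0<p2 e)) (*-monoʳ-≤ _ (<⇒≤ (0<τ 1≤k)) (fromℕ-mono-≤ k≤2^n)) ⟩
        p2 e * (p2 n * ‖ fromℕ k * α ‖) ≈⟨ trans (sym (*-assoc _ _ _)) (*-congʳ (sym (p2-+ e n))) ⟩
        p2 (e ℕ.+ n) * ‖ fromℕ k * α ‖    ∎))

      -- `f j - f i` differs from `(j - i) * α` by an integer, and `0 < j - i ≤ 2^n`, so bad
      -- approximability applies at the difference of the indices.
      separated : ∀ i j → i ℕ.< j → j ℕ.< 2 ℕ.^ n → s ≤ ∣ f j - f i ∣
      separated i j i<j j<2^n = begin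
        s ≤⟨ s≤‖‖ k (ℕ.m<n⇒0<n∸m i<j) (ℕ.≤-trans (ℕ.m∸n≤m j i) (ℕ.<⇒≤ j<2^n)) ⟩
        ‖ fromℕ k * α ‖                 ≤⟨ ‖‖≤ _ z ⟩
        ∣ fromℕ k * α - fromℤ z ∣ ≈⟨ ∣∣-cong (+-cong (*-congʳ (fromℕ-∸ (ℕ.<⇒≤ i<j))) (-‿cong z≈)) ⟩
        ∣ (fromℕ j - fromℕ i) * α - (mⱼ - mᵢ) ∣
          ≈⟨ ∣∣-cong (solve 6 (λ n i j a x y → (j :- i) :* a :- (y :- x) := (n :+ j) :* a :- y :- ((n :+ i) :* a :- x))
               (p2 n) (fromℕ i) (fromℕ j) α mᵢ mⱼ) ⟩
        ∣ (p2 n + fromℕ j) * α - mⱼ - ((p2 n + fromℕ i) * α - mᵢ) ∣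
          ≈⟨ ∣∣-cong (+-cong (+-congʳ (*-congʳ (fromℕ-+ (2 ℕ.^ n) j))) (-‿cong (+-congʳ (*-congʳ (fromℕ-+ (2 ℕ.^ n) i))))) ⟨
        ∣ f j - f i ∣                   ∎
        where
        k = j ℕ.∸ i
        mᵢ = fromℤ (proj₁ (near i))
        mⱼ = fromℤ (proj₁ (near j))
        z  = proj₁ (fromℤ-difference (proj₁ (near j)) (proj₁ (near i)))
        z≈ = proj₂ (fromℤ-difference (proj₁ (near j)) (proj₁ (near i)))

      count : ℕ → ℝ
      count j = ∑ (2 ℕ.^ n) (λ i → 𝟙 (Class j (q i)))

      -- The residues of a class lie in `[- b, b]` with `b = 2 * 2^(-j)` and are `2^(-e - n)` apart,
      -- which allows `4 * 2^(e + n - j) + 1` of them. Since `j ≤ J`, the 1 is at most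
      -- `2 * 2^(e + n - j)`; hence 6 = 4 + 2.
      class-count : ∀ j → j ℕ.≤ J → p2 j * count j ≤ fromℕ 6 * p2 (e ℕ.+ n)
      class-count j j≤J = *-cancelˡ-≤ s 0<s (begin
        s * (p2 j * count j) ≈⟨ solve 3 (λ s p c → s :* (p :* c) := p :* (s :* c)) s _ _ ⟩
        p2 j * (s * count j) ≤⟨ *-monoˡ-≤ _ (<⇒≤ (0<p2 j)) (separated-count (2 ℕ.^ n) (λ i → Class j (q i)) f
                                                0<s -b≤b (λ i k i<k k<2^n _ _ → separated i k i<k k<2^n) (λ i _ → bounds i)) ⟩
        p2 j * (b - - b + s) ≈⟨ solve 3 (λ p i s → p :* (con 2 :* i :- :- (con 2 :* i) :+ s) := con 4 :* (p :* i) :+ p :* s) (p2 j) (p2 j ⁻¹) s ⟩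
        fromℕ 4 * (p2 j * p2 j ⁻¹) + p2 j * s ≤⟨ +-mono-≤ (≤-reflexive (*-congˡ (*-inverse-pos (0<p2 j)))) p2j*s≤2 ⟩
        fromℕ 4 * 1# + fromℕ 2              ≈⟨ solve 0 (con 4 :* :1 :+ con 2 := con 6) ⟩
        fromℕ 6 ≈⟨ trans (*-congˡ (*-inverse-pos (0<p2 (e ℕ.+ n)))) (*-identityʳ _) ⟨
        fromℕ 6 * (p2 (e ℕ.+ n) * s) ≈⟨ solve 2 (λ p s → con 6 :* (p :* s) := s :* (con 6 :* p)) _ s ⟩
        s * (fromℕ 6 * p2 (e ℕ.+ n))        ∎)
        where
        b : ℝ
        b = fromℕ 2 * p2 j ⁻¹

        0<s : 0# < s
        0<s = 0<⁻¹ (0<p2 (e ℕ.+ n))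

        0≤b : 0# ≤ b
        0≤b = 0≤fromℕ 2 0≤* 0≤⁻¹ (0<p2 j)

        -b≤b : - b ≤ b
        -b≤b = ≤-by (solve 1 (λ b → b :- :- b := b :+ b) b) (0≤b 0≤+ 0≤b)

        p2j*s≤2 : p2 j * s ≤ fromℕ 2
        p2j*s≤2 = begin
          p2 j * s                            ≤⟨ *-monoʳ-≤ s (<⇒≤ 0<s) (p2-mono-≤ j≤J) ⟩
          p2 (suc (e ℕ.+ n)) * s ≈⟨ trans (*-congʳ (p2-suc (e ℕ.+ n))) (*-assoc _ _ _) ⟩
          fromℕ 2 * (p2 (e ℕ.+ n) * s) ≈⟨ trans (*-congˡ (*-inverse-pos (0<p2 (e ℕ.+ n)))) (*-identityʳ _) ⟩
          fromℕ 2                             ∎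

        bounds : ∀ i → Class j (q i) → - b ≤ f i × f i ≤ b
        bounds i (pτ≤1 , _) = ≤-by (solve 2 (λ f b → f :- :- b := b :- :- f) (f i) b) (diff (≤-trans (-x≤∣x∣ _) ∣f∣≤b))
                            , ≤-trans (x≤∣x∣ _) ∣f∣≤b
          where
          ∣f∣≤b : ∣ f i ∣ ≤ b
          ∣f∣≤b = ≤-trans (<⇒≤ (proj₂ (near i))) (*-monoˡ-≤ _ (0≤fromℕ 2)
            (≤-trans (x≤y⁻¹*z (0<p2 j) pτ≤1) (≤-reflexive (*-identityʳ _))))

      -- `exp (X j)` is `(n ℓ)^(2 - a) * (j ℓ)^a`, the logarithmic part of the weight on class `j`
      -- of block `n`.
      X : ℕ → ℝ
      X j = ((1# + 1#) - a) * log (fromℕ n) + ((1# + 1#) - a) * log ℓ + (a * log (fromℕ j) + a * log ℓ)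

      w-lower : ∀ i j → 1 ℕ.≤ j → Class j (q i) → p2 n * exp (X j) ≤ w (q i) * p2 (suc j)
      w-lower i j 1≤j (pτ≤1 , 1<pτ) = begin
        p2 n * exp (X j)                              ≈⟨ *-congˡ (exp-+ _ _) ⟩
        p2 n * (exp Y * exp Z) ≈⟨ trans (sym (*-identityʳ _)) (*-congʳ (sym (*-assoc _ _ _))) ⟩
        p2 n * exp Y * exp Z * 1# ≤⟨ *-mono-≤ (<⇒≤ (0<p2 n 0<* 0<exp Y 0<* 0<exp Z)) (<⇒≤ (<-trans 0<1 1<pτ))
            (*-mono-≤ (<⇒≤ (0<p2 n 0<* 0<exp Y)) (≤-trans (<⇒≤ (0<exp Z)) Z≤)
              (*-mono-≤ (<⇒≤ (0<p2 n)) (≤-trans (<⇒≤ (0<exp Y)) Y≤) p2n≤q Y≤) Z≤) (<⇒≤ 1<pτ) ⟩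
        fromℕ (q i) * L (q i) * M (q i) * (p2 (suc j) * τ (q i))
          ≈⟨ solve 3 (λ a p t → a :* (p :* t) := a :* t :* p) _ (p2 (suc j)) (τ (q i)) ⟩
        w (q i) * p2 (suc j)                          ∎
        where
        Y Z : ℝ
        Y = ((1# + 1#) - a) * log (fromℕ n) + ((1# + 1#) - a) * log ℓ
        Z = a * log (fromℕ j) + a * log ℓ

        p2n≤q : p2 n ≤ fromℕ (q i)
        p2n≤q = fromℕ-mono-≤ (ℕ.m≤m+n (2 ℕ.^ n) i)

        Y≤ : exp Y ≤ L (q i)
        Y≤ = power-lower n 1≤n 0≤2-a (log≥ n p2n≤q)

        Z≤ : exp Z ≤ M (q i)
        Z≤ = power-lower j 1≤j (<⇒≤ 0<a) (log≥ j (≤-trans (≤-trans (≤-reflexive (sym (⁻¹-involutive (0<p2 j))))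
          (⁻¹-antimono-≤ (0<τ (1≤q i)) (≤-trans (x≤y⁻¹*z (0<p2 j) pτ≤1) (≤-reflexive (*-identityʳ _))))) ≤-refl))

      g : ℕ → ℝ
      g j = p2 (suc j) * exp (- X j) * p2 n ⁻¹

      0≤g : ∀ j → 0# ≤ g j
      0≤g j = <⇒≤ (0<p2 (suc j) 0<* 0<exp _ 0<* 0<⁻¹ (0<p2 n))

      w⁻¹≤g : ∀ i j → 1 ℕ.≤ j → Class j (q i) → w (q i) ⁻¹ ≤ g j
      w⁻¹≤g i j 1≤j class = ≤-trans (≤-reflexive (sym (*-identityʳ _))) (y⁻¹*z≤x 0<wq (begin
        1# ≈⟨ trans (*-cong (exp-neg (X j)) (*-inverse-pos (0<p2 n))) (*-identityʳ 1#) ⟨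
        exp (- X j) * exp (X j) * (p2 n * p2 n ⁻¹) ≈⟨ solve 4 (λ f e p i → f :* e :* (p :* i) := p :* e :* (f :* i)) (exp (- X j)) (exp (X j)) (p2 n) _ ⟩
        p2 n * exp (X j) * (exp (- X j) * p2 n ⁻¹) ≤⟨ *-monoʳ-≤ _ (<⇒≤ (0<exp (- X j) 0<* 0<⁻¹ (0<p2 n))) (w-lower i j 1≤j class) ⟩
        w (q i) * p2 (suc j) * (exp (- X j) * p2 n ⁻¹) ≈⟨ solve 4 (λ w p e i → w :* p :* (e :* i) := w :* (p :* e :* i)) (w (q i)) _ _ _ ⟩
        w (q i) * g j                                 ∎))
        where
        0<wq : 0# < w (q i)
        0<wq = 0<w (ℕ.≤-trans (ℕ.^-monoʳ-≤ 2 1≤n) (ℕ.m≤m+n (2 ℕ.^ n) i))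

      h : ℕ → ℕ → ℝ
      h i j = 𝟙 (Class (suc j) (q i)) * g (suc j)

      0≤h : ∀ i j → 0# ≤ h i j
      0≤h i j = 0≤𝟙 (Class (suc j) (q i)) 0≤* 0≤g (suc j)

      pick : ∀ i → i ℕ.< 2 ℕ.^ n → w (q i) ⁻¹ ≤ ∑ J (h i)
      pick i i<2^n = let (j , j<J , class) = classify i i<2^n in begin
        w (q i) ⁻¹                      ≤⟨ w⁻¹≤g i (suc j) (ℕ.s≤s ℕ.z≤n) class ⟩
        g (suc j)                       ≈⟨ *-identityˡ _ ⟨
        1# * g (suc j)                  ≈⟨ *-congʳ (𝟙-true class) ⟨
        h i j                           ≤⟨ term≤∑ {J} {h i} {j} j<J (0≤h i) ⟩
        ∑ J (h i)                       ∎

      block≤classes : ∑ (2 ℕ.^ n) (λ i → w (q i) ⁻¹) ≤ ∑ J (λ j → count (suc j) * g (suc j))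
      block≤classes = begin
        ∑ (2 ℕ.^ n) (λ i → w (q i) ⁻¹)                ≤⟨ ∑-mono (2 ℕ.^ n) pick ⟩
        ∑ (2 ℕ.^ n) (λ i → ∑ J (h i))                 ≈⟨ ∑-swap (2 ℕ.^ n) J h ⟩
        ∑ J (λ j → ∑ (2 ℕ.^ n) (λ i → h i j)) ≈⟨ ∑-cong J (λ j _ → ∑-*ʳ (2 ℕ.^ n) (g (suc j)) (λ i → 𝟙 (Class (suc j) (q i)))) ⟩
        ∑ J (λ j → count (suc j) * g (suc j))         ∎

      K : ℝ
      K = exp (- (((1# + 1#) - a) * log (fromℕ n) + (log ℓ + log ℓ)))

      -- The factor `2^j` in `g j` cancels the `2^(-j)` in the size of the class, so class `j`
      -- contributes `n^(a - 2) * j^(-a)` up to constants. `K` is `n^(a - 2) / ℓ^2`.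
      class-sum : ∀ j → j ℕ.≤ J → count j * g j ≤ fromℕ 12 * p2 e * (K * exp (- (a * log (fromℕ j))))
      class-sum j j≤J = begin
        count j * g j
          ≈⟨ trans (*-congˡ (*-congʳ (*-congʳ (p2-suc j)))) (solve 4 (λ c p x i → c :* (con 2 :* p :* x :* i) := con 2 :* x :* i :* (p :* c)) (count j) (p2 j) (exp (- X j)) (p2 n ⁻¹)) ⟩
        fromℕ 2 * exp (- X j) * p2 n ⁻¹ * (p2 j * count j)
          ≤⟨ *-monoˡ-≤ _ (<⇒≤ (0<2 0<* 0<exp _ 0<* 0<⁻¹ (0<p2 n))) (class-count j j≤J) ⟩
        fromℕ 2 * exp (- X j) * p2 n ⁻¹ * (fromℕ 6 * p2 (e ℕ.+ n))
          ≈⟨ trans (*-congˡ (*-congˡ (p2-+ e n))) (solve 4 (λ x i e n → con 2 :* x :* i :* (con 6 :* (e :* n)) := con 12 :* e :* x :* (n :* i)) (exp (- X j)) (p2 n ⁻¹) (p2 e) (p2 n)) ⟩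
        fromℕ 12 * p2 e * exp (- X j) * (p2 n * p2 n ⁻¹) ≈⟨ trans (*-congˡ (*-inverse-pos (0<p2 n))) (*-identityʳ _) ⟩
        fromℕ 12 * p2 e * exp (- X j) ≈⟨ *-congˡ (trans (exp-cong (solve 4 (λ a n l j →
            :- ((:1 :+ :1 :- a) :* n :+ (:1 :+ :1 :- a) :* l :+ (a :* j :+ a :* l)) := :- ((:1 :+ :1 :- a) :* n :+ (l :+ l)) :+ :- (a :* j)) a (log (fromℕ n)) (log ℓ) (log (fromℕ j)))) (exp-+ _ _)) ⟩
        fromℕ 12 * p2 e * (K * exp (- (a * log (fromℕ j))))   ∎

      -- `power-sum` with exponent `1 - a`; the number of classes is at most `(e + 2) n` because
      -- `n ≥ 1`.
      powers : (1# - a) * ∑ J (λ j → exp (- (a * log (fromℕ (suc j))))) ≤ exp ((1# - a) * (log (fromℕ (e ℕ.+ 2)) + log (fromℕ n)))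
      powers = begin
        (1# - a) * ∑ J (λ j → exp (- (a * log (fromℕ (suc j)))))
          ≈⟨ *-congˡ (∑-cong J (λ j _ → exp-cong (-‿cong (*-congʳ (solve 1 (λ a → a := :1 :- (:1 :- a)) a))))) ⟩
        (1# - a) * ∑ J (λ j → exp (- ((1# - (1# - a)) * log (fromℕ (suc j)))))
          ≤⟨ power-sum (diff (<⇒≤ a<1)) (≤-by (solve 1 (λ a → :1 :- (:1 :- a) := a) a) (<⇒≤ 0<a)) (e ℕ.+ n) ⟩
        exp ((1# - a) * log (fromℕ J))
          ≤⟨ exp-mono-≤ (*-monoˡ-≤ _ (diff (<⇒≤ a<1)) (≤-trans (log-mono-≤ (0<fromℕ {J} (ℕ.s≤s ℕ.z≤n)) (≤-trans (fromℕ-mono-≤ J≤) (≤-reflexive (fromℕ-* (e ℕ.+ 2) n))))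
               (≤-reflexive (log-* (0<fromℕ {e ℕ.+ 2} (ℕ.≤-trans (ℕ.s≤s ℕ.z≤n) (ℕ.m≤n+m 2 e))) (0<fromℕ 1≤n))))) ⟩
        exp ((1# - a) * (log (fromℕ (e ℕ.+ 2)) + log (fromℕ n))) ∎
        where
        J≤ : J ℕ.≤ (e ℕ.+ 2) ℕ.* n
        J≤ = ℕ.≤-trans (ℕ.≤-reflexive (≡.sym (ℕ.+-suc e n))) (ℕ.≤-trans
          (ℕ.+-mono-≤ (ℕ.≤-trans (ℕ.≤-reflexive (≡.sym (ℕ.*-identityʳ e))) (ℕ.*-monoʳ-≤ e 1≤n))
            (ℕ.≤-trans (ℕ.+-monoˡ-≤ n 1≤n) (ℕ.≤-reflexive (≡.cong (n ℕ.+_) (≡.sym (ℕ.+-identityʳ n))))))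
          (ℕ.≤-reflexive (≡.sym (ℕ.*-distribʳ-+ n e 2))))

      -- `n^(a - 2)` from `K` times `n^(1 - a)` from the sum over classes leaves `1 / n`: the
      -- exponents `2 - a` and `a` of the two logarithms balance here for every `a < 1`.
      block-sum : fromℕ n * ∑ (2 ℕ.^ n) (λ i → w (q i) ⁻¹) ≤ C
      block-sum = x≤y⁻¹*z (diff-< a<1) (begin
        (1# - a) * (fromℕ n * ∑ (2 ℕ.^ n) (λ i → w (q i) ⁻¹))
          ≤⟨ *-monoˡ-≤ _ (diff (<⇒≤ a<1)) (*-monoˡ-≤ _ (0≤fromℕ n) (≤-trans block≤classes (∑-mono J (λ j j<J → class-sum (suc j) j<J)))) ⟩
        (1# - a) * (fromℕ n * ∑ J (λ j → fromℕ 12 * p2 e * (K * exp (- (a * log (fromℕ (suc j)))))))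
          ≈⟨ *-congˡ (*-congˡ (trans (∑-*ˡ J _ _) (*-congˡ (∑-*ˡ J K _)))) ⟩
        (1# - a) * (fromℕ n * (fromℕ 12 * p2 e * (K * S)))
          ≈⟨ solve 5 (λ t n c k s → t :* (n :* (c :* (k :* s))) := c :* (n :* (k :* (t :* s)))) (1# - a) (fromℕ n) _ K S ⟩
        fromℕ 12 * p2 e * (fromℕ n * (K * ((1# - a) * S)))
          ≤⟨ *-monoˡ-≤ _ (<⇒≤ (0<fromℕ {12} (ℕ.s≤s ℕ.z≤n) 0<* 0<p2 e)) (*-monoˡ-≤ _ (0≤fromℕ n) (*-monoˡ-≤ K (<⇒≤ (0<exp _)) powers)) ⟩
        fromℕ 12 * p2 e * (fromℕ n * (K * exp ((1# - a) * (log (fromℕ (e ℕ.+ 2)) + log (fromℕ n)))))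
          ≈⟨ *-congˡ (*-congˡ (trans (sym (exp-+ _ _)) (trans (exp-cong (solve 4 (λ a n l k →
               :- ((:1 :+ :1 :- a) :* n :+ (l :+ l)) :+ (:1 :- a) :* (k :+ n) := :- n :+ ((:1 :- a) :* k :- (l :+ l))) a (log (fromℕ n)) (log ℓ) (log (fromℕ (e ℕ.+ 2))))) (exp-+ _ _)))) ⟩
        fromℕ 12 * p2 e * (fromℕ n * (exp (- log (fromℕ n)) * B))
          ≈⟨ *-congˡ (trans (sym (*-assoc _ _ _)) (trans (*-congʳ n*n⁻¹) (*-identityˡ B))) ⟩
        fromℕ 12 * p2 e * B ∎)
        where
        S : ℝ
        S = ∑ J (λ j → exp (- (a * log (fromℕ (suc j)))))

        n*n⁻¹ : fromℕ n * exp (- log (fromℕ n)) ≈ 1#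
        n*n⁻¹ = trans (*-comm _ _) (trans (*-congˡ (sym (exp-log (0<fromℕ 1≤n)))) (exp-neg _))

  -- Trees of cells

  p8 : ℕ → ℝ
  p8 n = fromℕ (8 ℕ.^ n)

  0<p8 : ∀ n → 0# < p8 n
  0<p8 n = 0<fromℕ (ℕ.m^n>0 8 n)

  p8-suc : ∀ n → p8 (suc n) ≈ fromℕ 8 * p8 n
  p8-suc n = fromℕ-^ 8 n

  p8-+ : ∀ m n → p8 (m ℕ.+ n) ≈ p8 m * p8 n
  p8-+ m n = trans (fromℕ-cong (ℕ.^-distribˡ-+-* 8 m n)) (fromℕ-* (8 ℕ.^ m) (8 ℕ.^ n))

  p8⁻¹ : ∀ n → p8 n ⁻¹ ≈ fromℕ 8 * p8 (suc n) ⁻¹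
  p8⁻¹ n = sym (⁻¹-unique (0<p8 n) (trans (solve 3 (λ a b c → a :* (b :* c) := b :* a :* c) (p8 n) (fromℕ 8) (p8 (suc n) ⁻¹))
    (trans (*-congʳ (sym (p8-suc n))) (*-inverse-pos (0<p8 (suc n))))))

  [x*8+r]/8 : ∀ x r → (x ℕ.* 8 ℕ.+ r) ℕ./ 8 ≡ x ℕ.+ r ℕ./ 8
  [x*8+r]/8 x r = ≡.trans (+-distrib-/-∣ˡ r (n∣m*n x)) (≡.cong (ℕ._+ r ℕ./ 8) (m*n/n≡m x 8))

  [d*8^[1+k]+r]/8 : ∀ d k r → (d ℕ.* 8 ℕ.^ suc k ℕ.+ r) ℕ./ 8 ≡ d ℕ.* 8 ℕ.^ k ℕ.+ r ℕ./ 8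
  [d*8^[1+k]+r]/8 d k r = ≡.trans (≡.cong (λ y → (y ℕ.+ r) ℕ./ 8) (≡.trans
    (≡.cong (d ℕ.*_) (ℕ.*-comm 8 (8 ℕ.^ k))) (≡.sym (ℕ.*-assoc d (8 ℕ.^ k) 8)))) ([x*8+r]/8 (d ℕ.* 8 ℕ.^ k) r)

  r/8<8^k : ∀ k {r} → r ℕ.< 8 ℕ.^ suc k → r ℕ./ 8 ℕ.< 8 ℕ.^ k
  r/8<8^k k r< = m<n*o⇒m/o<n (ℕ.≤-trans r< (ℕ.≤-reflexive (ℕ.*-comm 8 (8 ℕ.^ k))))

  -- If the last residue `b` fails at some `k₀`, then it fails at every later level, and looking at
  -- level `k ⊔ k₀` instead of `k` moves all witnesses to the smaller residues.
  pigeonhole : (Q : ℕ → ℕ → Set) → (∀ {r m n} → m ℕ.≤ n → Q r n → Q r m) →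
    ∀ b → (∀ k → ∃ λ r → r ℕ.< b × Q r k) → ∃ λ r → r ℕ.< b × ∀ k → Q r k
  pigeonhole Q anti zero    some with () ← proj₁ (proj₂ (some 0))
  pigeonhole Q anti (suc b) some with em {P = ∃ λ k → ¬ Q b k}
  ... | no  never = b , ℕ.≤-refl , always
    where
    always : ∀ k → Q b k
    always k with em {P = Q b k}
    ... | yes q = q
    ... | no ¬q = ⊥-elim (never (k , ¬q))
  ... | yes (k₀ , ¬q) =
    let (r , r<b , q) = pigeonhole Q anti b some′ in r , ℕ.m<n⇒m<1+n r<b , q
    where
    some′ : ∀ k → ∃ λ r → r ℕ.< b × Q r k
    some′ k = let (r , r<1+b , q) = some (k ℕ.⊔ k₀) in
      r , ℕ.≤∧≢⇒< (ℕ.≤-pred r<1+b) (λ r≡b → ¬q (≡.subst (λ r → Q r k₀) r≡b (anti (ℕ.m≤n⊔m k k₀) q))) , anti (ℕ.m≤m⊔n k k₀) q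

  nested-intervals : ∀ {l u : ℕ → ℝ} → (∀ n → l n ≤ l (suc n)) → (∀ n → u (suc n) ≤ u n) → (∀ n → l n ≤ u n) →
    ∃ λ x → ∀ n → l n ≤ x × x ≤ u n
  nested-intervals {l} {u} l-mono u-anti l≤u = proj₁ sup , λ n →
    proj₁ (proj₂ sup) (l n , n , refl) ,
    proj₂ (proj₂ sup) (u n) λ { (y , m , y≈l) → ≤-trans (≤-reflexive y≈l) (l≤u′ m n) }
    where
    l-mono′ : ∀ {m n} → m ℕ.≤′ n → l m ≤ l n
    l-mono′ ℕ.≤′-refl       = ≤-refl
    l-mono′ (ℕ.≤′-step m≤n) = ≤-trans (l-mono′ m≤n) (l-mono _)

    u-anti′ : ∀ {m n} → m ℕ.≤′ n → u n ≤ u m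
    u-anti′ ℕ.≤′-refl       = ≤-refl
    u-anti′ (ℕ.≤′-step m≤n) = ≤-trans (u-anti _) (u-anti′ m≤n)

    l≤u′ : ∀ m n → l m ≤ u n
    l≤u′ m n = ≤-trans (l-mono′ (ℕ.≤⇒≤′ (ℕ.m≤m⊔n m n)))
      (≤-trans (l≤u (m ℕ.⊔ n)) (u-anti′ (ℕ.≤⇒≤′ (ℕ.m≤n⊔m m n))))

    sup = complete (λ y → ∃ λ m → y ≈ l m) (l 0 , 0 , refl)
      (u 0 , λ { (y , m , y≈l) → ≤-trans (≤-reflexive y≈l) (l≤u′ m 0) })

  -- Octadic cells [c / 8^n, (c + 1) / 8^n]; those with Bad n c are removed
  -- at stage n, together with all their descendants.
  module Tree (Bad : ℕ → ℕ → Set) where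

    Survives : ℕ → ℕ → Set
    Survives zero    c = ⊤
    Survives (suc n) c = Survives n (c ℕ./ 8) × ¬ Bad (suc n) c

    survives-ancestor : ∀ k {m d r} → r ℕ.< 8 ℕ.^ k → Survives (k ℕ.+ m) (d ℕ.* 8 ℕ.^ k ℕ.+ r) → Survives m d
    survives-ancestor zero {m} {d} {zero} _ surv = ≡.subst (Survives m) (≡.trans (ℕ.+-identityʳ _) (ℕ.*-identityʳ d)) surv
    survives-ancestor zero    {m} {d} {suc r} (ℕ.s≤s ()) _
    survives-ancestor (suc k) {m} {d} {r} r< (surv , _) = survives-ancestor k (r/8<8^k k r<)
      (≡.subst (Survives (k ℕ.+ m)) ([d*8^[1+k]+r]/8 d k r) surv)

    S σ : ℕ → ℝ
    S n = ∑ (8 ℕ.^ n) (λ c → 𝟙 (Survives n c))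
    σ n = S n * p8 n ⁻¹

    0≤σ : ∀ n → 0# ≤ σ n
    0≤σ n = ∑-nonNeg (8 ℕ.^ n) (λ c _ → 0≤𝟙 (Survives n c)) 0≤* 0≤⁻¹ (0<p8 n)

    S-step : ∀ n → fromℕ 8 * S n ≤ S (suc n) + ∑ (8 ℕ.^ suc n) (λ c → 𝟙 (Survives n (c ℕ./ 8) × Bad (suc n) c))
    S-step n = begin
      fromℕ 8 * S n                                             ≈⟨ ∑-*ˡ (8 ℕ.^ n) _ _ ⟨
      ∑ (8 ℕ.^ n) (λ d → fromℕ 8 * 𝟙 (Survives n d)) ≈⟨ ∑-cong (8 ℕ.^ n) (λ d _ → sym (trans (∑-cong 8 (λ r r<8 → reflexive (≡.cong (𝟙 ∘ Survives n) (parent d r r<8)))) (∑-const 8 _))) ⟩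
      ∑ (8 ℕ.^ n) (λ d → ∑ 8 (λ r → F (d ℕ.* 8 ℕ.+ r)))         ≈⟨ ∑-blocks (8 ℕ.^ n) 8 F ⟨
      ∑ (8 ℕ.^ n ℕ.* 8) F ≡⟨ ≡.cong (λ k → ∑ k F) (ℕ.*-comm (8 ℕ.^ n) 8) ⟩
      ∑ (8 ℕ.^ suc n) F ≤⟨ ∑-mono (8 ℕ.^ suc n) (λ c _ → ≤-by
          (solve 3 (λ s b f → s :+ b :- f := s :- (f :- b)) (𝟙 (Survives (suc n) c)) (G c) (F c))
          (diff (𝟙-∖ (Survives n (c ℕ./ 8)) (Bad (suc n) c)))) ⟩
      ∑ (8 ℕ.^ suc n) (λ c → 𝟙 (Survives (suc n) c) + G c) ≈⟨ ∑-+ (8 ℕ.^ suc n) (λ c → 𝟙 (Survives (suc n) c)) G ⟩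
      S (suc n) + ∑ (8 ℕ.^ suc n) G                             ∎
      where
      F G : ℕ → ℝ
      F c = 𝟙 (Survives n (c ℕ./ 8))
      G c = 𝟙 (Survives n (c ℕ./ 8) × Bad (suc n) c)

      parent : ∀ d r → r ℕ.< 8 → (d ℕ.* 8 ℕ.+ r) ℕ./ 8 ≡ d
      parent d r r<8 = ≡.trans ([x*8+r]/8 d r) (≡.trans (≡.cong (d ℕ.+_) (m<n⇒m/n≡0 r<8)) (ℕ.+-identityʳ d))

    -- Cells are grouped by their ancestor `d` of level `m`, and of their survival only that of `d`
    -- is kept: `P` is controlled inside each full cell of level `m`, while nothing is known about
    -- how it meets the survivors at finer levels.
    local-count : ∀ {p} (P : ℕ → Set p) k m {K} →
      (∀ d → d ℕ.< 8 ℕ.^ m → ∑ (8 ℕ.^ suc k) (λ r → 𝟙 (P (d ℕ.* 8 ℕ.^ suc k ℕ.+ r))) ≤ K) →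
      ∑ (8 ℕ.^ suc (k ℕ.+ m)) (λ c → 𝟙 (Survives (k ℕ.+ m) (c ℕ./ 8) × P c)) ≤ S m * K
    local-count P k m {K} local = begin
      ∑ (8 ℕ.^ suc (k ℕ.+ m)) H
        ≡⟨ ≡.cong (λ b → ∑ b H) (≡.trans (ℕ.^-distribˡ-+-* 8 (suc k) m) (ℕ.*-comm (8 ℕ.^ suc k) (8 ℕ.^ m))) ⟩
      ∑ (8 ℕ.^ m ℕ.* 8 ℕ.^ suc k) H ≈⟨ ∑-blocks (8 ℕ.^ m) (8 ℕ.^ suc k) H ⟩
      ∑ (8 ℕ.^ m) (λ d → ∑ (8 ℕ.^ suc k) (λ r → H (d ℕ.* 8 ℕ.^ suc k ℕ.+ r))) ≤⟨ ∑-mono (8 ℕ.^ m) block ⟩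
      ∑ (8 ℕ.^ m) (λ d → 𝟙 (Survives m d) * K)                            ≈⟨ ∑-*ʳ (8 ℕ.^ m) K _ ⟩
      S m * K                                                             ∎
      where
      H : ℕ → ℝ
      H c = 𝟙 (Survives (k ℕ.+ m) (c ℕ./ 8) × P c)

      inherit : ∀ d r → r ℕ.< 8 ℕ.^ suc k → H (d ℕ.* 8 ℕ.^ suc k ℕ.+ r) ≤ 𝟙 (Survives m d) * 𝟙 (P (d ℕ.* 8 ℕ.^ suc k ℕ.+ r))
      inherit d r r< = ≤-trans (𝟙-mono λ { (surv , p) → survives-ancestor k (r/8<8^k k r<)
        (≡.subst (Survives (k ℕ.+ m)) ([d*8^[1+k]+r]/8 d k r) surv) , p }) (𝟙-× (Survives m d) (P (d ℕ.* 8 ℕ.^ suc k ℕ.+ r)))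

      block : ∀ d → d ℕ.< 8 ℕ.^ m → ∑ (8 ℕ.^ suc k) (λ r → H (d ℕ.* 8 ℕ.^ suc k ℕ.+ r)) ≤ 𝟙 (Survives m d) * K
      block d d< = ≤-trans (∑-mono (8 ℕ.^ suc k) (inherit d)) (≤-trans
        (≤-reflexive (∑-*ˡ (8 ℕ.^ suc k) (𝟙 (Survives m d)) (λ r → 𝟙 (P (d ℕ.* 8 ℕ.^ suc k ℕ.+ r))))) (*-monoˡ-≤ _ (0≤𝟙 (Survives m d)) (local d d<)))

    Alive : ℕ → ℕ → Set
    Alive n c = ∀ k → ∃ λ r → r ℕ.< 8 ℕ.^ k × Survives (k ℕ.+ n) (c ℕ.* 8 ℕ.^ k ℕ.+ r)

    alive-survives : ∀ {n c} → Alive n c → Survives n c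
    alive-survives {n} {c} alive = let (r , r<1 , surv) = alive 0 in survives-ancestor 0 r<1 surv

    -- The step of König's lemma: a cell with surviving descendants at every depth has, among its
    -- eight children, one with the same property.
    alive-child : ∀ {n c} → Alive n c → ∃ λ r → r ℕ.< 8 × Alive (suc n) (c ℕ.* 8 ℕ.+ r)
    alive-child {n} {c} alive = pigeonhole Q (λ m≤n → anti (ℕ.≤⇒≤′ m≤n)) 8 some
      where
      Q : ℕ → ℕ → Set
      Q r k = ∃ λ r′ → r′ ℕ.< 8 ℕ.^ k × Survives (k ℕ.+ suc n) ((c ℕ.* 8 ℕ.+ r) ℕ.* 8 ℕ.^ k ℕ.+ r′)

      anti : ∀ {r m k} → m ℕ.≤′ k → Q r k → Q r m
      anti ℕ.≤′-refl q = q
      anti {r} {m} {suc k} (ℕ.≤′-step m≤k) (r′ , r′< , surv , _) = anti m≤k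
        (r′ ℕ./ 8 , r/8<8^k k r′< , ≡.subst (Survives (k ℕ.+ suc n)) ([d*8^[1+k]+r]/8 (c ℕ.* 8 ℕ.+ r) k r′) surv)

      some : ∀ k → ∃ λ r → r ℕ.< 8 × Q r k
      some k = let (r₀ , r₀< , surv) = alive (suc k) in
        r₀ ℕ./ 8 ℕ.^ k , m<n*o⇒m/o<n r₀< , r₀ ℕ.% 8 ℕ.^ k , m%n<n r₀ (8 ℕ.^ k)
        , ≡.subst₂ Survives (≡.sym (ℕ.+-suc k n)) (regroup r₀) surv
        where
        instance
          8^k≢0 : ℕ.NonZero (8 ℕ.^ k)
          8^k≢0 = ℕ.>-nonZero (ℕ.m^n>0 8 k)

        regroup : ∀ r₀ → c ℕ.* 8 ℕ.^ suc k ℕ.+ r₀ ≡ (c ℕ.* 8 ℕ.+ r₀ ℕ./ 8 ℕ.^ k) ℕ.* 8 ℕ.^ k ℕ.+ r₀ ℕ.% 8 ℕ.^ k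
        regroup r₀ = ≡.trans (≡.cong₂ ℕ._+_ (≡.sym (ℕ.*-assoc c 8 (8 ℕ.^ k)))
            (≡.trans (m≡m%n+[m/n]*n r₀ (8 ℕ.^ k)) (ℕ.+-comm (r₀ ℕ.% 8 ℕ.^ k) _)))
          (≡.trans (≡.sym (ℕ.+-assoc (c ℕ.* 8 ℕ.* 8 ℕ.^ k) (r₀ ℕ./ 8 ℕ.^ k ℕ.* 8 ℕ.^ k) _))
            (≡.cong (ℕ._+ r₀ ℕ.% 8 ℕ.^ k) (≡.sym (ℕ.*-distribʳ-+ (8 ℕ.^ k) (c ℕ.* 8) (r₀ ℕ./ 8 ℕ.^ k)))))

    -- Cells are closed, so the limit point may be an endpoint shared by two cells. It suffices that
    -- one of them survives, because a cell is removed as soon as its closed interval meets a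
    -- forbidden set.
    limit-point : Alive 0 0 → ∃ λ x → 0# ≤ x × x ≤ 1# ×
      (∀ n → ∃ λ c → Survives n c × fromℕ c ≤ p8 n * x × p8 n * x ≤ fromℕ c + 1#)
    limit-point alive₀ = x ,
      ≤-trans (≤-reflexive (sym (zeroˡ _))) (proj₁ (x-bounds 0)) ,
      ≤-trans (proj₂ (x-bounds 0)) (≤-trans (≤-reflexive (*-cong (+-identityˡ 1#) (trans (⁻¹-cong (0<p8 0) (+-identityʳ 1#)) 1⁻¹≈1))) (≤-reflexive (*-identityˡ 1#))) ,
      λ n → c n , alive-survives {n} {c n} (proj₂ (branch n)) ,
        ≤-trans (≤-reflexive (sym (p8*[z*p8⁻¹] n))) (*-monoˡ-≤ _ (<⇒≤ (0<p8 n)) (proj₁ (x-bounds n))) ,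
        ≤-trans (*-monoˡ-≤ _ (<⇒≤ (0<p8 n)) (proj₂ (x-bounds n))) (≤-reflexive (p8*[z*p8⁻¹] n))
      where
      branch : ∀ n → ∃ (Alive n)
      branch zero    = 0 , alive₀
      branch (suc n) = let (r , _ , alive) = alive-child {n} {proj₁ (branch n)} (proj₂ (branch n)) in proj₁ (branch n) ℕ.* 8 ℕ.+ r , alive

      c : ℕ → ℕ
      c n = proj₁ (branch n)

      r : ℕ → ℕ
      r n = proj₁ (alive-child {n} {proj₁ (branch n)} (proj₂ (branch n)))

      r<8 : ∀ n → r n ℕ.< 8
      r<8 n = proj₁ (proj₂ (alive-child {n} {proj₁ (branch n)} (proj₂ (branch n))))

      l u : ℕ → ℝ
      l n = fromℕ (c n) * p8 n ⁻¹
      u n = (fromℕ (c n) + 1#) * p8 n ⁻¹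

      p8*[z*p8⁻¹] : ∀ n {z} → p8 n * (z * p8 n ⁻¹) ≈ z
      p8*[z*p8⁻¹] n {z} = trans (solve 3 (λ p z i → p :* (z :* i) := p :* i :* z) (p8 n) z _)
        (trans (*-congʳ (*-inverse-pos (0<p8 n))) (*-identityˡ z))

      c-suc : ∀ n → fromℕ (c (suc n)) ≈ fromℕ (c n) * fromℕ 8 + fromℕ (r n)
      c-suc n = trans (fromℕ-+ (c n ℕ.* 8) (r n)) (+-congʳ (fromℕ-* (c n) 8))

      nested : ∃ λ x → ∀ n → l n ≤ x × x ≤ u n
      nested = nested-intervals
        (λ n → begin
          l n ≈⟨ trans (*-congˡ (p8⁻¹ n)) (sym (*-assoc _ _ _)) ⟩
          fromℕ (c n) * fromℕ 8 * p8 (suc n) ⁻¹ ≤⟨ *-monoʳ-≤ _ (0≤⁻¹ (0<p8 (suc n))) (≤-trans (≤-by (solve 2 (λ a b → a :+ b :- a := b) _ _) (0≤fromℕ (r n))) (≤-reflexive (sym (c-suc n)))) ⟩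
          l (suc n)                                         ∎)
        (λ n → begin
          u (suc n)
            ≤⟨ *-monoʳ-≤ _ (0≤⁻¹ (0<p8 (suc n))) (≤-trans (+-monoˡ-≤ 1# (≤-reflexive (c-suc n))) (≤-by
                 (solve 2 (λ c r → (c :+ :1) :* con 8 :- (c :* con 8 :+ r :+ :1) := con 8 :- (:1 :+ r)) (fromℕ (c n)) (fromℕ (r n)))
                 (diff (fromℕ-mono-≤ (r<8 n))))) ⟩
          (fromℕ (c n) + 1#) * fromℕ 8 * p8 (suc n) ⁻¹ ≈⟨ trans (*-congˡ (p8⁻¹ n)) (sym (*-assoc _ _ _)) ⟨
          u n                                               ∎)
        (λ n → *-monoʳ-≤ _ (0≤⁻¹ (0<p8 n)) (≤-by (solve 1 (λ c → c :+ :1 :- c := :1) _) 0≤1))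
      x = proj₁ nested
      x-bounds = proj₂ nested

    V : ℕ → ℝ
    V n = fromℕ n * σ n

    -- `P` will be the removals by fractions, `U` those by the cover. `P-local` bounds the loss
    -- inside each cell of level `m` and is multiplied by the survivors of that level. `U-global`
    -- counts over the whole unit interval, survivors or not, and is weighed against `1 ≤ V n`.
    module Density (P U : ℕ → ℕ → Set) (N : ℕ) (4≤N : 4 ℕ.≤ N)
      (late  : ∀ n c → n ℕ.≤ N → ¬ Bad n c)
      (split : ∀ n c → Bad n c → P n c ⊎ U n c)
      (P-local : ∀ k m → N ℕ.≤ k ℕ.+ m → 3 ℕ.* m ℕ.≤ suc (k ℕ.+ m) → ∀ d → d ℕ.< 8 ℕ.^ m →
        fromℕ 8 * fromℕ (suc (k ℕ.+ m)) * ∑ (8 ℕ.^ suc k) (λ r → 𝟙 (P (suc (k ℕ.+ m)) (d ℕ.* 8 ℕ.^ suc k ℕ.+ r))) ≤ p8 (suc k))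
      (U-global : ∀ n → N ℕ.≤ n →
        fromℕ 2 * (fromℕ (suc n) * fromℕ (suc n)) * ∑ (8 ℕ.^ suc n) (λ c → 𝟙 (U (suc n) c)) ≤ p8 (suc n))
      where

      module Step (k m : ℕ) (N≤n : N ℕ.≤ k ℕ.+ m) (3m≤p : 3 ℕ.* m ℕ.≤ suc (k ℕ.+ m)) (n≤4m : k ℕ.+ m ℕ.≤ 4 ℕ.* m)
        (Vm≤Vn : V m ≤ V (k ℕ.+ m)) (1≤Vn : 1# ≤ V (k ℕ.+ m)) where

        n : ℕ
        n = k ℕ.+ m

        p i A B : ℝ
        p = fromℕ (suc n)
        i = p8 (suc n) ⁻¹
        A = ∑ (8 ℕ.^ suc n) (λ c → 𝟙 (Survives n (c ℕ./ 8) × P (suc n) c))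
        B = ∑ (8 ℕ.^ suc n) (λ c → 𝟙 (U (suc n) c))

        0<p : 0# < p
        0<p = 0<fromℕ {suc n} (ℕ.s≤s ℕ.z≤n)

        0≤i : 0# ≤ i
        0≤i = 0≤⁻¹ (0<p8 (suc n))

        0<m : 0 ℕ.< m
        0<m = ℕ.n≢0⇒n>0 λ m≡0 → ℕ.<⇒≱ (ℕ.≤-trans (ℕ.s≤s ℕ.z≤n) 4≤N)
          (ℕ.≤-trans N≤n (ℕ.≤-trans n≤4m (ℕ.≤-reflexive (≡.trans (≡.cong (4 ℕ.*_) m≡0) (ℕ.*-zeroʳ 4)))))

        removed≤ : ∑ (8 ℕ.^ suc n) (λ c → 𝟙 (Survives n (c ℕ./ 8) × Bad (suc n) c)) ≤ A + B
        removed≤ = ≤-trans (∑-mono (8 ℕ.^ suc n) (λ c _ → ≤-trans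
            (𝟙-mono (λ { (surv , bad) → [ (λ p → inj₁ (surv , p)) , inj₂ ]′ (split (suc n) c bad) }))
            (𝟙-⊎ (Survives n (c ℕ./ 8) × P (suc n) c) (U (suc n) c))))
          (≤-reflexive (∑-+ (8 ℕ.^ suc n) _ _))

        σn≤ : σ n ≤ σ (suc n) + A * i + B * i
        σn≤ = begin
          S n * p8 n ⁻¹ ≈⟨ trans (*-congˡ (p8⁻¹ n)) (solve 2 (λ s i → s :* (con 8 :* i) := con 8 :* s :* i) (S n) i) ⟩
          fromℕ 8 * S n * i ≤⟨ *-monoʳ-≤ i 0≤i (≤-trans (S-step n) (+-monoʳ-≤ _ removed≤)) ⟩
          (S (suc n) + (A + B)) * i ≈⟨ solve 4 (λ s a b i → (s :+ (a :+ b)) :* i := s :* i :+ a :* i :+ b :* i) (S (suc n)) A B i ⟩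
          σ (suc n) + A * i + B * i         ∎

        8p*A*i≤σm : fromℕ 8 * p * A * i ≤ σ m
        8p*A*i≤σm = begin
          fromℕ 8 * p * A * i ≤⟨ *-monoʳ-≤ i 0≤i (*-monoˡ-≤ _ (<⇒≤ 0<8p) (local-count (P (suc n)) k m
                                                (λ d d< → x≤y⁻¹*z 0<8p (P-local k m N≤n 3m≤p d d<)))) ⟩
          fromℕ 8 * p * (S m * ((fromℕ 8 * p) ⁻¹ * p8 (suc k))) * i
            ≈⟨ solve 5 (λ q s j c i → q :* (s :* (j :* c)) :* i := q :* j :* (s :* (c :* i))) (fromℕ 8 * p) (S m) _ (p8 (suc k)) i ⟩
          fromℕ 8 * p * (fromℕ 8 * p) ⁻¹ * (S m * (p8 (suc k) * i)) ≈⟨ trans (*-congʳ (*-inverse-pos 0<8p)) (*-identityˡ _) ⟩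
          S m * (p8 (suc k) * i) ≈⟨ *-congˡ (⁻¹-unique (0<p8 m) (trans (solve 3 (λ a b c → a :* (b :* c) := b :* a :* c) (p8 m) (p8 (suc k)) i)
                                                (trans (*-congʳ (sym (p8-+ (suc k) m))) (*-inverse-pos (0<p8 (suc n)))))) ⟩
          σ m                               ∎
          where
          0<8p : 0# < fromℕ 8 * p
          0<8p = 0<fromℕ {8} (ℕ.s≤s ℕ.z≤n) 0<* 0<p

        σm≤4σn : σ m ≤ fromℕ 4 * σ n
        σm≤4σn = *-cancelˡ-≤ (fromℕ m) (0<fromℕ 0<m) (begin
          fromℕ m * σ m               ≤⟨ Vm≤Vn ⟩
          fromℕ n * σ n ≤⟨ *-monoʳ-≤ _ (0≤σ n) (≤-trans (fromℕ-mono-≤ n≤4m) (≤-reflexive (fromℕ-* 4 m))) ⟩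
          fromℕ 4 * fromℕ m * σ n ≈⟨ solve 2 (λ m s → con 4 :* m :* s := m :* (con 4 :* s)) (fromℕ m) (σ n) ⟩
          fromℕ m * (fromℕ 4 * σ n)   ∎)

        2pAi≤σn : fromℕ 2 * (p * (A * i)) ≤ σ n
        2pAi≤σn = *-cancelˡ-≤ (fromℕ 4) (0<fromℕ {4} (ℕ.s≤s ℕ.z≤n)) (≤-trans
          (≤-reflexive (solve 3 (λ p a i → con 4 :* (con 2 :* (p :* (a :* i))) := con 8 :* p :* a :* i) p A i))
          (≤-trans 8p*A*i≤σm σm≤4σn))

        2pBi≤σn : fromℕ 2 * (p * (B * i)) ≤ σ n
        2pBi≤σn = *-cancelˡ-≤ p 0<p (begin
          p * (fromℕ 2 * (p * (B * i))) ≈⟨ solve 3 (λ p b i → p :* (con 2 :* (p :* (b :* i))) := con 2 :* (p :* p) :* b :* i) p B i ⟩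
          fromℕ 2 * (p * p) * B * i           ≤⟨ *-monoʳ-≤ i 0≤i (U-global n N≤n) ⟩
          p8 (suc n) * i                      ≈⟨ *-inverse-pos (0<p8 (suc n)) ⟩
          1#                                  ≤⟨ 1≤Vn ⟩
          fromℕ n * σ n                       ≤⟨ *-monoʳ-≤ _ (0≤σ n) (fromℕ-mono-≤ (ℕ.n≤1+n n)) ⟩
          p * σ n                             ∎)

        -- Each of the two losses is at most `σ n / (2 p)` with `p = n + 1`, so
        -- `p * σ p ≥ p * σ n - σ n = n * σ n`.
        Vn≤Vp : V n ≤ V (suc n)
        Vn≤Vp = *-cancelˡ-≤ (fromℕ 2) 0<2 (≤-by
          (solve 6 (λ n s t a b i → con 2 :* ((:1 :+ n) :* t) :- con 2 :* (n :* s) :=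
              con 2 :* ((:1 :+ n) :* (t :+ a :* i :+ b :* i :- s)) :+ (s :- con 2 :* ((:1 :+ n) :* (a :* i))) :+ (s :- con 2 :* ((:1 :+ n) :* (b :* i)))) (fromℕ n) (σ n) (σ (suc n)) A B i)
          (0≤fromℕ 2 0≤* (<⇒≤ 0<p 0≤* diff σn≤) 0≤+ diff 2pAi≤σn 0≤+ diff 2pBi≤σn))

      survives-early : ∀ n c → n ℕ.≤ N → Survives n c
      survives-early zero    c _   = tt
      survives-early (suc n) c n<N = survives-early n (c ℕ./ 8) (ℕ.<⇒≤ n<N) , late (suc n) c n<N

      V-early : ∀ n → n ℕ.≤ N → V n ≈ fromℕ n
      V-early n n≤N = trans (*-congˡ (trans (*-congʳ (trans (∑-cong (8 ℕ.^ n) (λ c _ → 𝟙-true (survives-early n c n≤N)))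
        (trans (∑-const (8 ℕ.^ n) 1#) (*-identityʳ _)))) (*-inverse-pos (0<p8 n)))) (*-identityʳ _)

      -- All `m ≤ n` are treated at once because the step to `n + 1` uses `V m′ ≤ V n` at
      -- `m′ = ⌊(n + 1) / 3⌋` as well as `1 ≤ V n`. Up to level `N` nothing is removed and
      -- `V n = n`. As `n + 1 ≤ 3 m′ + 2` and `m′ ≥ 1`, also `n ≤ 4 m′`.
      V-mono : ∀ n m → m ℕ.≤ n → V m ≤ V n
      V-mono zero    zero    _   = ≤-refl
      V-mono (suc n) m m≤1+n with ℕ.m≤n⇒m<n∨m≡n m≤1+n | ℕ.<-≤-connex n N
      ... | inj₂ ≡.refl | _        = ≤-refl
      ... | inj₁ m<1+n  | inj₁ n<N = ≤-trans (≤-reflexive (V-early m (ℕ.≤-trans m≤1+n n<N)))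
        (≤-trans (fromℕ-mono-≤ m≤1+n) (≤-reflexive (sym (V-early (suc n) n<N))))
      ... | inj₁ m<1+n  | inj₂ N≤n = ≤-trans (V-mono n m (ℕ.≤-pred m<1+n)) Vn≤Vp
        where
        m′ k′ : ℕ
        m′ = suc n ℕ./ 3
        k′ = n ℕ.∸ m′

        3≤p : 3 ℕ.≤ suc n
        3≤p = ℕ.≤-trans (ℕ.≤-trans (ℕ.n≤1+n 3) 4≤N) (ℕ.m≤n⇒m≤1+n N≤n)

        1≤m′ : 1 ℕ.≤ m′
        1≤m′ = /-monoˡ-≤ 3 3≤p

        3m′≤p : 3 ℕ.* m′ ℕ.≤ suc n
        3m′≤p = ℕ.≤-trans (ℕ.≤-reflexive (ℕ.*-comm 3 m′)) (m/n*n≤m (suc n) 3)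

        m′≤n : m′ ℕ.≤ n
        m′≤n = ℕ.≤-pred (m/n<m (suc n) 3 (ℕ.s≤s (ℕ.s≤s ℕ.z≤n)))

        k′+m′≡n : k′ ℕ.+ m′ ≡ n
        k′+m′≡n = ℕ.m∸n+n≡m m′≤n

        n≤4m′ : n ℕ.≤ 4 ℕ.* m′
        n≤4m′ = ℕ.≤-pred (ℕ.≤-trans (ℕ.≤-reflexive (m≡m%n+[m/n]*n (suc n) 3))
          (ℕ.≤-trans (ℕ.+-mono-≤ (ℕ.≤-pred (m%n<n (suc n) 3)) (ℕ.≤-reflexive (ℕ.*-comm m′ 3)))
            (ℕ.+-monoʳ-≤ 1 (ℕ.+-monoˡ-≤ (3 ℕ.* m′) 1≤m′))))

        1≤Vn : 1# ≤ V n
        1≤Vn = ≤-trans (≤-trans (1≤fromℕ {N} (ℕ.≤-trans (ℕ.s≤s ℕ.z≤n) 4≤N)) (≤-reflexive (sym (V-early N ℕ.≤-refl)))) (V-mono n N N≤n)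

        Vn≤Vp : V n ≤ V (suc n)
        Vn≤Vp = ≡.subst (λ n → V n ≤ V (suc n)) k′+m′≡n (Step.Vn≤Vp k′ m′
          (≡.subst (N ℕ.≤_) (≡.sym k′+m′≡n) N≤n) (≡.subst (λ n → 3 ℕ.* m′ ℕ.≤ suc n) (≡.sym k′+m′≡n) 3m′≤p)
          (≡.subst (ℕ._≤ 4 ℕ.* m′) (≡.sym k′+m′≡n) n≤4m′)
          (≡.subst (λ n → V m′ ≤ V n) (≡.sym k′+m′≡n) (V-mono n m′ m′≤n))
          (≡.subst (λ n → 1# ≤ V n) (≡.sym k′+m′≡n) 1≤Vn))

      -- Without survivors `V` would vanish, but it is at least `V 1 = 1`. Level 0 is left out
      -- because `V 0 = 0`.
      survivor : ∀ n → ∃ λ c → c ℕ.< 8 ℕ.^ suc n × Survives (suc n) c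
      survivor n with em {P = ∃ λ c → c ℕ.< 8 ℕ.^ suc n × Survives (suc n) c}
      ... | yes p = p
      ... | no ¬p = ⊥-elim (<⇒≱ 0<1 (begin
        1#                          ≈⟨ +-identityʳ 1# ⟨
        fromℕ 1                     ≈⟨ V-early 1 (ℕ.≤-trans (ℕ.s≤s ℕ.z≤n) 4≤N) ⟨
        V 1                         ≤⟨ V-mono (suc n) 1 (ℕ.s≤s ℕ.z≤n) ⟩
        V (suc n) ≈⟨ *-congˡ (*-congʳ (trans (∑-cong (8 ℕ.^ suc n) (λ c c< → 𝟙-false (λ surv → ¬p (c , c< , surv)))) (trans (∑-const (8 ℕ.^ suc n) 0#) (zeroʳ _)))) ⟩
        fromℕ (suc n) * (0# * p8 (suc n) ⁻¹)  ≈⟨ solve 2 (λ n i → n :* (:0 :* i) := :0) _ _ ⟩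
        0#                          ∎))

      alive : Alive 0 0
      alive zero    = 0 , ℕ.s≤s ℕ.z≤n , tt
      alive (suc k) = let (c , c< , surv) = survivor k in
        c , c< , ≡.subst (λ n → Survives n c) (≡.cong suc (≡.sym (ℕ.+-identityʳ k))) surv

  -- Neighbourhoods of fractions

  p8≈p2³ : ∀ n → p8 n ≈ p2 n * p2 n * p2 n
  p8≈p2³ zero    = solve 0 (con 1 := con 1 :* con 1 :* con 1)
  p8≈p2³ (suc n) = trans (p8-suc n) (trans (*-congˡ (p8≈p2³ n)) (trans
    (solve 1 (λ x → con 8 :* (x :* x :* x) := con 2 :* x :* (con 2 :* x) :* (con 2 :* x)) (p2 n))
    (sym (*-cong (*-cong (p2-suc n) (p2-suc n)) (p2-suc n)))))

  p8≤p2 : ∀ {m p} → 3 ℕ.* m ℕ.≤ p → p8 m ≤ p2 p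
  p8≤p2 {m} 3m≤p = fromℕ-mono-≤ (ℕ.≤-trans (ℕ.≤-reflexive (ℕ.^-*-assoc 2 3 m)) (ℕ.^-monoʳ-≤ 2 3m≤p))

  -- The threshold 12 of the construction comes from here: `192 * 12 = 2304 ≤ 4096`, while
  -- `192 * 11` exceeds `2^11`.
  192p≤2^p : ∀ {p} → 12 ℕ.≤′ p → 192 ℕ.* p ℕ.≤ 2 ℕ.^ p
  192p≤2^p ℕ.≤′-refl = ℕ.≤ᵇ⇒≤ 2304 4096 tt
  192p≤2^p {suc p} (ℕ.≤′-step 12≤p) = ℕ.≤-trans (ℕ.≤-reflexive (ℕ.*-suc 192 p)) (ℕ.≤-trans
    (ℕ.+-mono-≤ (ℕ.≤-trans (ℕ.*-monoʳ-≤ 192 (ℕ.≤-trans (ℕ.s≤s ℕ.z≤n) (ℕ.≤′⇒≤ 12≤p))) (192p≤2^p 12≤p)) (192p≤2^p 12≤p))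
    (ℕ.≤-reflexive (≡.cong (2 ℕ.^ p ℕ.+_) (≡.sym (ℕ.+-identityʳ (2 ℕ.^ p))))))

  192p≤p2 : ∀ {p} → 12 ℕ.≤ p → fromℕ 192 * fromℕ p ≤ p2 p
  192p≤p2 {p} 12≤p = ≤-trans (≤-reflexive (sym (fromℕ-* 192 p))) (fromℕ-mono-≤ (192p≤2^p (ℕ.≤⇒≤′ 12≤p)))

  module Fractions (w : ℕ → ℝ) (0<w : ∀ {q} → 2 ℕ.≤ q → 0# < w q) (C : ℝ) (0<C : 0# < C)
    (block-sum : ∀ n → 1 ℕ.≤ n → fromℕ n * ∑ (2 ℕ.^ n) (λ i → w (2 ℕ.^ n ℕ.+ i) ⁻¹) ≤ C) where

    -- The constant makes stage p remove at most the proportion 1/(8 p) of every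
    -- cell of level ⌊p/3⌋; see Count.local.
    ε : ℝ
    ε = (fromℕ 96 * C) ⁻¹

    ρ : ℕ → ℝ
    ρ q = ε * w q ⁻¹

    0<96C : 0# < fromℕ 96 * C
    0<96C = 0<fromℕ {96} (ℕ.s≤s ℕ.z≤n) 0<* 0<C

    0<ε : 0# < ε
    0<ε = 0<⁻¹ 0<96C

    2≤q : ∀ {p} i → 1 ℕ.≤ p → 2 ℕ.≤ 2 ℕ.^ p ℕ.+ i
    2≤q {p} i 1≤p = ℕ.≤-trans (ℕ.^-monoʳ-≤ 2 1≤p) (ℕ.m≤m+n (2 ℕ.^ p) i)

    Meets : ℕ → ℕ → ℕ → ℕ → Set
    Meets q j p c = ∃ λ x → (fromℕ c ≤ p8 p * x × p8 p * x ≤ fromℕ c + 1#) × ∣ fromℕ q * x - fromℕ j ∣ < ρ q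

    -- Numerators from 0 to `q` are enough because the limit point lies in `[0, 1]`; `‖‖-lower`
    -- deals with all other integers.
    Removed : ℕ → ℕ → Set
    Removed p c = ∃ λ i → i ℕ.< 2 ℕ.^ p × ∃ λ j → j ℕ.< suc (2 ℕ.^ p ℕ.+ i) × Meets (2 ℕ.^ p ℕ.+ i) j p c

    -- A single term of the block sum is at most `C`, and `ε * C = 1/96`.
    2ρ≤1 : ∀ {p} i → 1 ℕ.≤ p → i ℕ.< 2 ℕ.^ p → fromℕ 2 * ρ (2 ℕ.^ p ℕ.+ i) ≤ 1#
    2ρ≤1 {p} i 1≤p i<2^p = begin
      fromℕ 2 * (ε * W i) ≤⟨ *-monoˡ-≤ _ (0≤fromℕ 2) (*-monoˡ-≤ ε (<⇒≤ 0<ε) W≤C) ⟩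
      fromℕ 2 * (ε * C) ≤⟨ ≤-by (solve 2 (λ e c → con 96 :* c :* e :- con 2 :* (e :* c) := con 94 :* (e :* c)) ε C)
                                                (0≤fromℕ 94 0≤* (<⇒≤ 0<ε 0≤* <⇒≤ 0<C)) ⟩
      fromℕ 96 * C * ε                      ≈⟨ *-inverse-pos 0<96C ⟩
      1#                                    ∎
      where
      W : ℕ → ℝ
      W i = w (2 ℕ.^ p ℕ.+ i) ⁻¹

      0≤W : ∀ i → 0# ≤ W i
      0≤W i = 0≤⁻¹ (0<w (2≤q i 1≤p))

      W≤C : W i ≤ C
      W≤C = begin
        W i                         ≤⟨ term≤∑ {2 ℕ.^ p} {W} {i} i<2^p 0≤W ⟩
        ∑ (2 ℕ.^ p) W               ≈⟨ *-identityˡ _ ⟨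
        1# * ∑ (2 ℕ.^ p) W ≤⟨ *-monoʳ-≤ _ (∑-nonNeg (2 ℕ.^ p) (λ i _ → 0≤W i)) (1≤fromℕ {p} 1≤p) ⟩
        fromℕ p * ∑ (2 ℕ.^ p) W     ≤⟨ block-sum p 1≤p ⟩
        C                           ∎

    module Count (k m d : ℕ) (3m≤p : 3 ℕ.* m ℕ.≤ suc (k ℕ.+ m)) (12≤p : 12 ℕ.≤ suc (k ℕ.+ m)) where

      p K : ℕ
      p = suc (k ℕ.+ m)
      K = suc k

      1≤p : 1 ℕ.≤ p
      1≤p = ℕ.s≤s ℕ.z≤n

      cell : ℕ → ℕ
      cell r = d ℕ.* 8 ℕ.^ K ℕ.+ r

      cell≈ : ∀ r → fromℕ (cell r) ≈ fromℕ d * p8 K + fromℕ r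
      cell≈ r = trans (fromℕ-+ (d ℕ.* 8 ℕ.^ K) r) (+-congʳ (fromℕ-* d (8 ℕ.^ K)))

      module One (i : ℕ) (i<2^p : i ℕ.< 2 ℕ.^ p) where

        q : ℕ
        q = 2 ℕ.^ p ℕ.+ i

        Q t : ℝ
        Q = fromℕ q
        t = p8 m ⁻¹

        0<Q : 0# < Q
        0<Q = 0<fromℕ (ℕ.<⇒≤ (2≤q i 1≤p))

        0<ρ : 0# < ρ q
        0<ρ = 0<ε 0<* 0<⁻¹ (0<w (2≤q i 1≤p))

        Near : ℕ → Set
        Near j = ∃ λ x → (fromℕ d ≤ p8 m * x × p8 m * x ≤ fromℕ d + 1#) × ∣ Q * x - fromℕ j ∣ < ρ q

        meets⇒near : ∀ j r → r ℕ.< 8 ℕ.^ K → Meets q j p (cell r) → Near j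
        meets⇒near j r r< (x , (c≤ , ≤c+1) , close) = x ,
          ( *-cancelˡ-≤ (p8 K) (0<p8 K) (begin
              p8 K * fromℕ d ≤⟨ ≤-by (solve 3 (λ k d r → d :* k :+ r :- k :* d := r) (p8 K) (fromℕ d) (fromℕ r)) (0≤fromℕ r) ⟩
              fromℕ d * p8 K + fromℕ r          ≈⟨ cell≈ r ⟨
              fromℕ (cell r)                    ≤⟨ c≤ ⟩
              p8 p * x                          ≈⟨ trans (*-congʳ (p8-+ K m)) (*-assoc _ _ _) ⟩
              p8 K * (p8 m * x)                 ∎)
          , *-cancelˡ-≤ (p8 K) (0<p8 K) (begin
              p8 K * (p8 m * x)                 ≈⟨ trans (*-congʳ (p8-+ K m)) (*-assoc _ _ _) ⟨
              p8 p * x                          ≤⟨ ≤c+1 ⟩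
              fromℕ (cell r) + 1#               ≈⟨ +-congʳ (cell≈ r) ⟩
              fromℕ d * p8 K + fromℕ r + 1# ≤⟨ ≤-by (solve 3 (λ k d r → k :* (d :+ :1) :- (d :* k :+ r :+ :1) := k :- (:1 :+ r)) (p8 K) (fromℕ d) (fromℕ r))
                                                    (diff (fromℕ-mono-≤ r<)) ⟩
              p8 K * (fromℕ d + 1#)             ∎))
          , close

        b : ℝ
        b = Q ⁻¹ * (fromℕ 2 * p8 p * ρ q + fromℕ 2 * Q)

        0≤b : 0# ≤ b
        0≤b = 0≤⁻¹ 0<Q 0≤* (0≤fromℕ 2 0≤* <⇒≤ (0<p8 p) 0≤* <⇒≤ 0<ρ 0≤+ 0≤fromℕ 2 0≤* <⇒≤ 0<Q)

        -- The neighbourhood of `j / q` has length `2 ρ / q`, which is `2 * 8^p * ρ / q` cells, and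
        -- 2 more are allowed for its ends. Positions are multiplied by `Q`, so the separation is
        -- `Q` and no division enters the count.
        meets-count : ∀ j → ∑ (8 ℕ.^ K) (λ r → 𝟙 (Meets q j p (cell r))) ≤ 𝟙 (Near j) * b
        meets-count j = ≤𝟙* (λ _ → x≤y⁻¹*z 0<Q count)
          (λ ¬near → ≤-reflexive (trans (∑-cong (8 ℕ.^ K) (λ r r< → 𝟙-false (λ meets → ¬near (meets⇒near j r r< meets))))
            (trans (∑-const (8 ℕ.^ K) 0#) (zeroʳ _))))
          where
          J : ℝ
          J = fromℕ j

          lo hi : ℝ
          lo = p8 p * (J - ρ q) - Q
          hi = p8 p * (J + ρ q)

          hi-lo : hi - lo ≈ fromℕ 2 * p8 p * ρ q + Q
          hi-lo = solve 4 (λ p j r q → p :* (j :+ r) :- (p :* (j :- r) :- q) := con 2 :* p :* r :+ q) (p8 p) J (ρ q) Q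

          apart : ∀ r r′ → r ℕ.< r′ → Q ≤ ∣ Q * fromℕ (cell r′) - Q * fromℕ (cell r) ∣
          apart r r′ r<r′ = begin
            Q                                             ≈⟨ *-identityʳ Q ⟨
            Q * 1# ≤⟨ *-monoˡ-≤ Q (<⇒≤ 0<Q) (≤-by (solve 2 (λ x y → y :- x :- :1 := y :- (:1 :+ x)) (fromℕ r) (fromℕ r′)) (diff (fromℕ-mono-≤ r<r′))) ⟩
            Q * (fromℕ r′ - fromℕ r) ≈⟨ solve 4 (λ q e x y → q :* (y :- x) := q :* (e :+ y) :- q :* (e :+ x)) Q (fromℕ d * p8 K) (fromℕ r) (fromℕ r′) ⟩
            Q * (fromℕ d * p8 K + fromℕ r′) - Q * (fromℕ d * p8 K + fromℕ r) ≈⟨ +-cong (*-congˡ (cell≈ r′)) (-‿cong (*-congˡ (cell≈ r))) ⟨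
            Q * fromℕ (cell r′) - Q * fromℕ (cell r)      ≤⟨ x≤∣x∣ _ ⟩
            ∣ Q * fromℕ (cell r′) - Q * fromℕ (cell r) ∣  ∎

          bounds : ∀ r → Meets q j p (cell r) → lo ≤ Q * fromℕ (cell r) × Q * fromℕ (cell r) ≤ hi
          bounds r (x , (c≤ , ≤c+1) , close) =
            ≤-by (solve 6 (λ p j r q x c → q :* c :- (p :* (j :- r) :- q) := q :* (c :+ :1 :- p :* x) :+ p :* (q :* x :+ r :- j)) (p8 p) J (ρ q) Q x (fromℕ (cell r)))
              (<⇒≤ 0<Q 0≤* diff ≤c+1 0≤+ <⇒≤ (0<p8 p) 0≤* diff (∣∣<-lower close)) ,
            ≤-by (solve 6 (λ p j r q x c → p :* (j :+ r) :- q :* c := q :* (p :* x :- c) :+ p :* (j :+ r :- q :* x)) (p8 p) J (ρ q) Q x (fromℕ (cell r)))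
              (<⇒≤ 0<Q 0≤* diff c≤ 0≤+ <⇒≤ (0<p8 p) 0≤* diff (∣∣<-upper close))

          count : Q * ∑ (8 ℕ.^ K) (λ r → 𝟙 (Meets q j p (cell r))) ≤ fromℕ 2 * p8 p * ρ q + fromℕ 2 * Q
          count = ≤-trans (separated-count (8 ℕ.^ K) (λ r → Meets q j p (cell r)) (λ r → Q * fromℕ (cell r)) 0<Q
              (≤-by hi-lo (0≤fromℕ 2 0≤* <⇒≤ (0<p8 p) 0≤* <⇒≤ 0<ρ 0≤+ <⇒≤ 0<Q))
              (λ r r′ r<r′ _ _ _ → apart r r′ r<r′) (λ r _ → bounds r))
            (≤-reflexive (trans (+-congʳ hi-lo) (solve 2 (λ a q → a :+ q :+ q := a :+ con 2 :* q) _ Q)))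

        -- The numerators lie in an interval of length `Q t + 2 ρ`. Here `3 m ≤ p` enters:
        -- `8^m ≤ 2^p ≤ q` gives `1 ≤ Q t`, so the terms `2 ρ` and 1 are each absorbed by another
        -- `Q t`.
        near-count : ∑ (suc q) (λ j → 𝟙 (Near j)) ≤ fromℕ 3 * (Q * t)
        near-count = begin
          ∑ (suc q) (λ j → 𝟙 (Near j))          ≈⟨ *-identityˡ _ ⟨
          1# * ∑ (suc q) (λ j → 𝟙 (Near j))     ≤⟨ separated-count (suc q) Near fromℕ 0<1
            (≤-by hi-lo (<⇒≤ 0<Q 0≤* 0≤t 0≤+ 0≤fromℕ 2 0≤* <⇒≤ 0<ρ)) (λ j j′ j<j′ _ _ _ → apart j j′ j<j′) (λ j _ → bounds j) ⟩
          hi - lo + 1#                          ≈⟨ +-congʳ hi-lo ⟩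
          Q * t + fromℕ 2 * ρ q + 1# ≤⟨ ≤-by (solve 2 (λ x r → con 3 :* x :- (x :+ con 2 :* r :+ :1) := (x :- :1) :+ (x :- :1) :+ (:1 :- con 2 :* r)) (Q * t) (ρ q))
                                                    (diff 1≤Qt 0≤+ diff 1≤Qt 0≤+ diff (2ρ≤1 {p} i 1≤p i<2^p)) ⟩
          fromℕ 3 * (Q * t)                     ∎
          where
          0≤t : 0# ≤ t
          0≤t = 0≤⁻¹ (0<p8 m)

          lo hi : ℝ
          lo = Q * (fromℕ d * t) - ρ q
          hi = Q * ((fromℕ d + 1#) * t) + ρ q

          hi-lo : hi - lo ≈ Q * t + fromℕ 2 * ρ q
          hi-lo = solve 4 (λ q d t r → q :* ((d :+ :1) :* t) :+ r :- (q :* (d :* t) :- r) := q :* t :+ con 2 :* r) Q (fromℕ d) t (ρ q)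

          1≤Qt : 1# ≤ Q * t
          1≤Qt = ≤-trans (≤-reflexive (sym (*-inverse-pos (0<p8 m)))) (*-monoʳ-≤ t 0≤t
            (≤-trans (p8≤p2 {m} 3m≤p) (fromℕ-mono-≤ (ℕ.m≤m+n (2 ℕ.^ p) i))))

          apart : ∀ j j′ → j ℕ.< j′ → 1# ≤ ∣ fromℕ j′ - fromℕ j ∣
          apart j j′ j<j′ = ≤-trans (≤-by (solve 2 (λ x y → y :- x :- :1 := y :- (:1 :+ x)) (fromℕ j) (fromℕ j′)) (diff (fromℕ-mono-≤ j<j′))) (x≤∣x∣ _)

          bounds : ∀ j → Near j → lo ≤ fromℕ j × fromℕ j ≤ hi
          bounds j (x , (d≤ , ≤d+1) , close) =
            ≤-trans (+-monoˡ-≤ (- ρ q) (*-monoˡ-≤ Q (<⇒≤ 0<Q) dt≤x)) (≤-by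
              (solve 3 (λ j y r → j :- (y :- r) := j :+ r :- y) (fromℕ j) (Q * x) (ρ q)) (diff (∣∣<-upper close))) ,
            ≤-trans (∣∣<-lower close) (+-monoˡ-≤ (ρ q) (*-monoˡ-≤ Q (<⇒≤ 0<Q) x≤))
            where
            dt≤x : fromℕ d * t ≤ x
            dt≤x = ≤-trans (≤-reflexive (*-comm _ _)) (y⁻¹*z≤x (0<p8 m) d≤)
            x≤ : x ≤ (fromℕ d + 1#) * t
            x≤ = ≤-trans (x≤y⁻¹*z (0<p8 m) ≤d+1) (≤-reflexive (*-comm _ _))

        total : ∑ (suc q) (λ j → ∑ (8 ℕ.^ K) (λ r → 𝟙 (Meets q j p (cell r)))) ≤ t * (fromℕ 6 * p8 p * ρ q + fromℕ 6 * Q)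
        total = begin
          ∑ (suc q) (λ j → ∑ (8 ℕ.^ K) (λ r → 𝟙 (Meets q j p (cell r)))) ≤⟨ ∑-mono (suc q) (λ j _ → meets-count j) ⟩
          ∑ (suc q) (λ j → 𝟙 (Near j) * b) ≈⟨ ∑-*ʳ (suc q) b (λ j → 𝟙 (Near j)) ⟩
          ∑ (suc q) (λ j → 𝟙 (Near j)) * b ≤⟨ *-monoʳ-≤ b 0≤b near-count ⟩
          fromℕ 3 * (Q * t) * b
            ≈⟨ solve 5 (λ q t i a r → con 3 :* (q :* t) :* (i :* (con 2 :* a :* r :+ con 2 :* q)) := q :* i :* (t :* (con 6 :* a :* r :+ con 6 :* q))) Q t (Q ⁻¹) (p8 p) (ρ q) ⟩
          Q * Q ⁻¹ * (t * (fromℕ 6 * p8 p * ρ q + fromℕ 6 * Q)) ≈⟨ trans (*-congʳ (*-inverse-pos 0<Q)) (*-identityˡ _) ⟩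
          t * (fromℕ 6 * p8 p * ρ q + fromℕ 6 * Q)                        ∎

      q : ℕ → ℕ
      q i = 2 ℕ.^ p ℕ.+ i

      W : ℝ
      W = ∑ (2 ℕ.^ p) (λ i → w (q i) ⁻¹)

      Θ : ℝ
      Θ = ∑ (8 ℕ.^ K) (λ r → 𝟙 (Removed p (cell r)))

      Θ≤ : Θ ≤ p8 m ⁻¹ * (fromℕ 6 * p8 p * (ε * W) + fromℕ 12 * p2 p * p2 p)
      Θ≤ = begin
        Θ
          ≤⟨ ∑-mono (8 ℕ.^ K) (λ r _ → ≤-trans (𝟙-∃ (2 ℕ.^ p) (λ i → ∃ λ j → j ℕ.< suc (q i) × Meets (q i) j p (cell r)))
               (∑-mono (2 ℕ.^ p) (λ i _ → 𝟙-∃ (suc (q i)) (λ j → Meets (q i) j p (cell r))))) ⟩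
        ∑ (8 ℕ.^ K) (λ r → ∑ (2 ℕ.^ p) (λ i → ∑ (suc (q i)) (λ j → 𝟙 (Meets (q i) j p (cell r)))))
          ≈⟨ ∑-swap (8 ℕ.^ K) (2 ℕ.^ p) (λ r i → ∑ (suc (q i)) (λ j → 𝟙 (Meets (q i) j p (cell r)))) ⟩
        ∑ (2 ℕ.^ p) (λ i → ∑ (8 ℕ.^ K) (λ r → ∑ (suc (q i)) (λ j → 𝟙 (Meets (q i) j p (cell r)))))
          ≈⟨ ∑-cong (2 ℕ.^ p) (λ i _ → ∑-swap (8 ℕ.^ K) (suc (q i)) (λ r j → 𝟙 (Meets (q i) j p (cell r)))) ⟩
        ∑ (2 ℕ.^ p) (λ i → ∑ (suc (q i)) (λ j → ∑ (8 ℕ.^ K) (λ r → 𝟙 (Meets (q i) j p (cell r)))))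
          ≤⟨ ∑-mono (2 ℕ.^ p) (λ i i<2^p → ≤-trans (One.total i i<2^p) (*-monoˡ-≤ _ (0≤⁻¹ (0<p8 m)) (+-monoʳ-≤ _ (Q≤ i i<2^p)))) ⟩
        ∑ (2 ℕ.^ p) (λ i → p8 m ⁻¹ * (fromℕ 6 * p8 p * ρ (q i) + fromℕ 12 * p2 p))
          ≈⟨ trans (∑-*ˡ (2 ℕ.^ p) _ _) (*-congˡ (trans (∑-+ (2 ℕ.^ p) (λ i → fromℕ 6 * p8 p * ρ (q i)) (λ _ → fromℕ 12 * p2 p))
               (+-cong (trans (∑-*ˡ (2 ℕ.^ p) _ _) (*-congˡ (∑-*ˡ (2 ℕ.^ p) ε (λ i → w (q i) ⁻¹)))) (trans (∑-const (2 ℕ.^ p) _) (*-comm _ _))))) ⟩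
        p8 m ⁻¹ * (fromℕ 6 * p8 p * (ε * W) + fromℕ 12 * p2 p * p2 p) ∎
        where
        Q≤ : ∀ i → i ℕ.< 2 ℕ.^ p → fromℕ 6 * fromℕ (q i) ≤ fromℕ 12 * p2 p
        Q≤ i i<2^p = ≤-trans (*-monoˡ-≤ _ (0≤fromℕ 6) (≤-trans (≤-reflexive (fromℕ-+ (2 ℕ.^ p) i)) (+-monoʳ-≤ _ (fromℕ-mono-≤ (ℕ.<⇒≤ i<2^p)))))
          (≤-reflexive (solve 1 (λ x → con 6 :* (x :+ x) := con 12 :* x) (p2 p)))

      -- After doubling, the lengths of the neighbourhoods contribute `8^p`, by `block-sum` and the
      -- choice of `ε` (96 = 2 * 8 * 6), and the rounding to whole cells contributes
      -- `192 * p * 4^p ≤ 8^p` (192 = 2 * 8 * 12). Dividing `2 * 8^p` by `8^m` leaves twice the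
      -- claim.
      local : fromℕ 8 * fromℕ p * Θ ≤ p8 K
      local = *-cancelˡ-≤ (fromℕ 2) 0<2 (begin
        fromℕ 2 * (fromℕ 8 * fromℕ p * Θ)
          ≤⟨ *-monoˡ-≤ _ (0≤fromℕ 2) (*-monoˡ-≤ _ (0≤fromℕ 8 0≤* 0≤fromℕ p) Θ≤) ⟩
        fromℕ 2 * (fromℕ 8 * fromℕ p * (p8 m ⁻¹ * (fromℕ 6 * p8 p * (ε * W) + fromℕ 12 * p2 p * p2 p)))
          ≈⟨ solve 6 (λ p i a e w x → con 2 :* (con 8 :* p :* (i :* (con 6 :* a :* (e :* w) :+ con 12 :* x :* x))) :=
               i :* (a :* (con 96 :* e :* (p :* w)) :+ con 192 :* p :* (x :* x))) (fromℕ p) (p8 m ⁻¹) (p8 p) ε W (p2 p) ⟩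
        p8 m ⁻¹ * (p8 p * (fromℕ 96 * ε * (fromℕ p * W)) + fromℕ 192 * fromℕ p * (p2 p * p2 p))
          ≤⟨ *-monoˡ-≤ _ (0≤⁻¹ (0<p8 m)) (+-mono-≤
               (*-monoˡ-≤ _ (<⇒≤ (0<p8 p)) (*-monoˡ-≤ _ (0≤fromℕ 96 0≤* <⇒≤ 0<ε) (block-sum p 1≤p)))
               (*-monoʳ-≤ _ (<⇒≤ (0<p2 p 0<* 0<p2 p)) (192p≤p2 12≤p))) ⟩
        p8 m ⁻¹ * (p8 p * (fromℕ 96 * ε * C) + p2 p * (p2 p * p2 p))
          ≈⟨ *-congˡ (+-cong (trans (*-congˡ (trans (solve 2 (λ e c → con 96 :* e :* c := con 96 :* c :* e) ε C) (*-inverse-pos 0<96C))) (*-identityʳ _))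
               (trans (sym (*-assoc _ _ _)) (sym (p8≈p2³ p)))) ⟩
        p8 m ⁻¹ * (p8 p + p8 p) ≈⟨ *-congˡ (+-cong (p8-+ K m) (p8-+ K m)) ⟩
        p8 m ⁻¹ * (p8 K * p8 m + p8 K * p8 m) ≈⟨ solve 3 (λ i k m → i :* (k :* m :+ k :* m) := con 2 :* k :* (m :* i)) (p8 m ⁻¹) (p8 K) (p8 m) ⟩
        fromℕ 2 * p8 K * (p8 m * p8 m ⁻¹) ≈⟨ trans (*-congˡ (*-inverse-pos (0<p8 m))) (*-identityʳ _) ⟩
        fromℕ 2 * p8 K                                        ∎)

  -- Members of a cover

  -- Finitely many cells need only finitely many members of the cover as witnesses, so `hit-count`
  -- can exchange two finite sums.
  bounded-witnesses : ∀ (Q : ℕ → ℕ → Set) M → ∃ λ K → ∀ c → c ℕ.< M → (∃ λ i → Q c i) → ∃ λ i → i ℕ.< K × Q c i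
  bounded-witnesses Q zero    = 0 , λ _ ()
  bounded-witnesses Q (suc M) with bounded-witnesses Q M | em {P = ∃ λ i → Q M i}
  ... | K , below | no none = K , bounded
    where
    bounded : ∀ c → c ℕ.< suc M → (∃ λ i → Q c i) → ∃ λ i → i ℕ.< K × Q c i
    bounded c c<1+M q with ℕ.m≤n⇒m<n∨m≡n (ℕ.≤-pred c<1+M)
    ... | inj₁ c<M    = below c c<M q
    ... | inj₂ ≡.refl = ⊥-elim (none q)
  ... | K , below | yes (i₀ , q₀) = suc i₀ ℕ.⊔ K , bounded
    where
    bounded : ∀ c → c ℕ.< suc M → (∃ λ i → Q c i) → ∃ λ i → i ℕ.< suc i₀ ℕ.⊔ K × Q c i
    bounded c c<1+M q with ℕ.m≤n⇒m<n∨m≡n (ℕ.≤-pred c<1+M)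
    ... | inj₁ c<M = let (i , i<K , qᵢ) = below c c<M q in i , ℕ.≤-trans i<K (ℕ.m≤n⊔m (suc i₀) K) , qᵢ
    ... | inj₂ ≡.refl = i₀ , ℕ.m≤m⊔n (suc i₀) K , q₀

  dyadic : ∀ q → 1 ℕ.≤ q → ∃ λ p → ∃ λ i → i ℕ.< 2 ℕ.^ p × q ≡ 2 ℕ.^ p ℕ.+ i
  dyadic q 1≤q = go (least (λ p → q ℕ.< 2 ℕ.^ suc p) q (ℕ.≤-trans (n<2^n q) (ℕ.^-monoʳ-≤ 2 (ℕ.n≤1+n q))))
    where
    from : ∀ p → 2 ℕ.^ p ℕ.≤ q → q ℕ.< 2 ℕ.^ suc p → ∃ λ p → ∃ λ i → i ℕ.< 2 ℕ.^ p × q ≡ 2 ℕ.^ p ℕ.+ i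
    from p 2^p≤q q<2^1+p = p , q ℕ.∸ 2 ℕ.^ p
      , ℕ.+-cancelˡ-< (2 ℕ.^ p) _ _ (ℕ.≤-trans (ℕ.s≤s (ℕ.≤-reflexive (ℕ.m+[n∸m]≡n 2^p≤q)))
          (ℕ.≤-trans q<2^1+p (ℕ.≤-reflexive (≡.cong (2 ℕ.^ p ℕ.+_) (ℕ.+-identityʳ (2 ℕ.^ p))))))
      , ≡.sym (ℕ.m+[n∸m]≡n 2^p≤q)

    go : (∃ λ p → q ℕ.< 2 ℕ.^ suc p × (∀ k → k ℕ.< p → ¬ (q ℕ.< 2 ℕ.^ suc k))) → ∃ λ p → ∃ λ i → i ℕ.< 2 ℕ.^ p × q ≡ 2 ℕ.^ p ℕ.+ i
    go (zero  , q< , _)   = from 0 1≤q q<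
    go (suc p , q< , min) = from (suc p) (ℕ.≮⇒≥ (min p ℕ.≤-refl)) q<

  module Exponent (s : ℝ) (0≤s : 0# ≤ s) (s<1 : s < 1#) where

    -- `exp (p * g) = 8^((1 - s) p)`, and `A` is chosen so that `p^2 ≤ A * 8^((1 - s) p)`, from
    -- `y^2 ≤ exp (2 y)` at `y = p g / 2`. In `η`, 128 = 16 * 8, where 16 is the factor needed in
    -- `global` and 8 bounds the `8^s` in `ξ p = 8^(s (p + 1))`.
    l g A η : ℝ
    l = log (fromℕ 8)
    g = (1# - s) * l
    A = fromℕ 4 * (g ⁻¹ * g ⁻¹)
    η = (fromℕ 128 * A) ⁻¹

    0<l : 0# < l
    0<l = 0<log (<-by (solve 0 (con 8 :- :1 := con 7)) (0<fromℕ {7} (ℕ.s≤s ℕ.z≤n)))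

    0<g : 0# < g
    0<g = diff-< s<1 0<* 0<l

    0<A : 0# < A
    0<A = 0<fromℕ {4} (ℕ.s≤s ℕ.z≤n) 0<* (0<⁻¹ 0<g 0<* 0<⁻¹ 0<g)

    0<128A : 0# < fromℕ 128 * A
    0<128A = 0<fromℕ {128} (ℕ.s≤s ℕ.z≤n) 0<* 0<A

    0<η : 0# < η
    0<η = 0<⁻¹ 0<128A

    square≤exp : ∀ p → fromℕ p * fromℕ p ≤ A * exp (fromℕ p * g)
    square≤exp p = begin
      P * P ≈⟨ solve 1 (λ p → p :* p := p :* p :* (:1 :* :1) :* (:1 :* :1)) P ⟩
      P * P * (1# * 1#) * (1# * 1#) ≈⟨ *-cong (*-congˡ (*-cong g*g⁻¹≈1 g*g⁻¹≈1)) (*-cong 2*half≈1 2*half≈1) ⟨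
      P * P * (g * g ⁻¹ * (g * g ⁻¹)) * (fromℕ 2 * half * (fromℕ 2 * half))
        ≈⟨ solve 4 (λ p g i h → p :* p :* (g :* i :* (g :* i)) :* (con 2 :* h :* (con 2 :* h)) := con 4 :* (i :* i) :* (h :* (p :* g) :* (h :* (p :* g)))) P g (g ⁻¹) half ⟩
      A * (half * (P * g) * (half * (P * g))) ≤⟨ *-monoˡ-≤ A (<⇒≤ 0<A) (*-mono-≤ 0≤y (<⇒≤ (0<exp _)) y≤exp y≤exp) ⟩
      A * (exp (half * (P * g)) * exp (half * (P * g))) ≈⟨ *-congˡ (trans (sym (exp-+ _ _)) (exp-cong (ε/2+ε/2 (P * g)))) ⟩
      A * exp (P * g)                                         ∎
      where
      P : ℝ
      P = fromℕ p

      g*g⁻¹≈1 : g * g ⁻¹ ≈ 1#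
      g*g⁻¹≈1 = *-inverse-pos 0<g

      2*half≈1 : fromℕ 2 * half ≈ 1#
      2*half≈1 = *-inverse-pos 0<2

      0≤y : 0# ≤ half * (P * g)
      0≤y = <⇒≤ 0<half 0≤* (0≤fromℕ p 0≤* <⇒≤ 0<g)

      y≤exp : half * (P * g) ≤ exp (half * (P * g))
      y≤exp = ≤-trans (≤-by (solve 1 (λ y → :1 :+ y :- y := :1) _) 0≤1) (1+x≤exp (half * (P * g)))

    ξ : ℕ → ℝ
    ξ p = exp (s * log (p8 (suc p)))

    16p²ηξ≤p8 : ∀ p → fromℕ 16 * (fromℕ p * fromℕ p) * (η * ξ p) ≤ p8 p
    16p²ηξ≤p8 p = begin
      fromℕ 16 * (P * P) * (η * ξ p)
        ≤⟨ *-mono-≤ (0≤fromℕ 16 0≤* (0≤fromℕ p 0≤* 0≤fromℕ p)) (<⇒≤ 0<η 0≤* (0≤fromℕ 8 0≤* <⇒≤ (0<exp _)))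
             (*-monoˡ-≤ _ (0≤fromℕ 16) (square≤exp p)) (*-monoˡ-≤ η (<⇒≤ 0<η) ξ≤) ⟩
      fromℕ 16 * (A * exp (P * g)) * (η * (fromℕ 8 * exp (s * (P * l))))
        ≈⟨ solve 4 (λ a x e y → con 16 :* (a :* x) :* (e :* (con 8 :* y)) := con 128 :* a :* e :* (x :* y)) A (exp (P * g)) η (exp (s * (P * l))) ⟩
      fromℕ 128 * A * η * (exp (P * g) * exp (s * (P * l))) ≈⟨ trans (*-congʳ (*-inverse-pos 0<128A)) (*-identityˡ _) ⟩
      exp (P * g) * exp (s * (P * l))                         ≈⟨ exp-+ _ _ ⟨
      exp (P * g + s * (P * l)) ≈⟨ exp-cong (solve 3 (λ p s l → p :* ((:1 :- s) :* l) :+ s :* (p :* l) := p :* l) P s l) ⟩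
      exp (P * l) ≈⟨ exp-cong (log-^ 8 p (ℕ.s≤s ℕ.z≤n)) ⟨
      exp (log (p8 p))                                        ≈⟨ exp-log (0<p8 p) ⟩
      p8 p                                                    ∎
      where
      P : ℝ
      P = fromℕ p

      ξ≤ : ξ p ≤ fromℕ 8 * exp (s * (P * l))
      ξ≤ = begin
        exp (s * log (p8 (suc p)))        ≈⟨ exp-cong (*-congˡ (log-^ 8 (suc p) (ℕ.s≤s ℕ.z≤n))) ⟩
        exp (s * (fromℕ (suc p) * l)) ≈⟨ exp-cong (solve 3 (λ p s l → s :* ((:1 :+ p) :* l) := s :* l :+ s :* (p :* l)) P s l) ⟩
        exp (s * l + s * (P * l))         ≈⟨ exp-+ _ _ ⟩
        exp (s * l) * exp (s * (P * l)) ≤⟨ *-monoʳ-≤ _ (<⇒≤ (0<exp _)) (≤-trans (exp-mono-≤ (≤-trans (*-monoʳ-≤ l (<⇒≤ 0<l) (<⇒≤ s<1)) (≤-reflexive (*-identityˡ l))))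
                                              (≤-reflexive (exp-log (0<fromℕ {8} (ℕ.s≤s ℕ.z≤n))))) ⟩
        fromℕ 8 * exp (s * (P * l))       ∎

    -- This pays for the 1 in `stage-count`, as `16p²ηξ≤p8` pays for the other summand.
    16p²≤p8 : ∀ {p} → 12 ℕ.≤ p → fromℕ 16 * (fromℕ p * fromℕ p) ≤ p8 p
    16p²≤p8 {p} 12≤p = begin
      fromℕ 16 * (P * P) ≈⟨ solve 1 (λ p → con 16 :* (p :* p) := :1 :* (con 16 :* p) :* p) P ⟩
      1# * (fromℕ 16 * P) * P ≤⟨ *-mono-≤ (0≤1 0≤* (0≤fromℕ 16 0≤* 0≤fromℕ p)) (<⇒≤ (0<p2 p))
                                  (*-mono-≤ 0≤1 (<⇒≤ (0<p2 p)) (1≤fromℕ {2 ℕ.^ p} (ℕ.m^n>0 2 p)) (≤-trans (*-monoʳ-≤ P (0≤fromℕ p) (fromℕ-mono-≤ {16} {192} (ℕ.≤ᵇ⇒≤ 16 192 tt))) (192p≤p2 12≤p)))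
                                  (fromℕ-mono-≤ (ℕ.<⇒≤ (n<2^n p))) ⟩
      p2 p * p2 p * p2 p      ≈⟨ p8≈p2³ p ⟨
      p8 p                    ∎
      where
      P : ℝ
      P = fromℕ p

    -- The covering sets are removed as well: a set of diameter d at the stage p
    -- with 8^{-p-1} < d ≤ 8^{-p}.  Sets of diameter 0 have no such stage, hence
    -- the alternative p = N + 1 + i.
    module Pieces (N : ℕ) (12≤N : 12 ℕ.≤ N) (piece : ℕ → Pred ℝ 0ℓ) (d κ : ℕ → ℝ)
      (d≤δ     : ∀ i → d i ≤ p8 (suc N) ⁻¹)
      (∣x-y∣≤d : ∀ i {x y} → piece i x → piece i y → ∣ x - y ∣ ≤ d i)
      (0≤κ     : ∀ i → 0# ≤ κ i)
      (κ-lower : ∀ i {r} → 0# < r → r < d i → exp (s * log r) ≤ κ i)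
      (∑κ≤η    : ∀ n → ∑ n κ ≤ η)
      where

      Large : ℕ → ℕ → Set
      Large p i = p8 (suc p) ⁻¹ < d i

      Stage : ℕ → ℕ → Set
      Stage p i = d i ≤ p8 p ⁻¹ × (Large p i ⊎ p ≡ suc (N ℕ.+ i))

      HitBy : ℕ → ℕ → ℕ → Set
      HitBy p c i = ∃ λ v → piece i v × fromℕ c ≤ p8 p * v × p8 p * v ≤ fromℕ c + 1#

      Hit : ℕ → ℕ → Set
      Hit p c = ∃ λ i → Stage p i × HitBy p c i

      p8-anti : ∀ {m n} → m ℕ.≤ n → p8 n ⁻¹ ≤ p8 m ⁻¹
      p8-anti {m} m≤n = ⁻¹-antimono-≤ (0<p8 m) (fromℕ-mono-≤ (ℕ.^-monoʳ-≤ 8 m≤n))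

      -- For positive `d i`, the stage is the predecessor of the least `k` with `8^(-k) < d i`. The
      -- mesh `8^(-N - 1)` of the cover forces it beyond `N`, where removal has begun.
      stage : ∀ i → ∃ λ p → N ℕ.< p × Stage p i
      stage i = [ flat , (λ 0<d → thick 0<d (least (λ k → p8 k ⁻¹ < d i) (suc (big 0<d)) (small-scale 0<d))) ]′ (≤-or-> (d i) 0#)
        where
        flat : d i ≤ 0# → ∃ λ p → N ℕ.< p × Stage p i
        flat d≤0 = suc (N ℕ.+ i) , ℕ.s≤s (ℕ.m≤m+n N i) , ≤-trans d≤0 (0≤⁻¹ (0<p8 (suc (N ℕ.+ i)))) , inj₂ ≡.refl

        big : 0# < d i → ℕ
        big 0<d = proj₁ (archimedean (d i ⁻¹))

        n<8^n : ∀ n → suc n ℕ.≤ 8 ℕ.^ n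
        n<8^n n = ℕ.≤-trans (n<2^n n) (ℕ.^-monoˡ-≤ n (ℕ.s≤s (ℕ.s≤s ℕ.z≤n)))

        small-scale : ∀ 0<d → p8 (suc (big 0<d)) ⁻¹ < d i
        small-scale 0<d = ≰⇒> λ d≤ → <⇒≱ (fromℕ-mono-< {big 0<d} {8 ℕ.^ suc (big 0<d)} (ℕ.≤-trans (n<8^n (big 0<d)) (ℕ.^-monoʳ-≤ 8 (ℕ.n≤1+n (big 0<d))))) (begin
          p8 (suc (big 0<d))          ≈⟨ ⁻¹-involutive (0<p8 (suc (big 0<d))) ⟨
          p8 (suc (big 0<d)) ⁻¹ ⁻¹    ≤⟨ ⁻¹-antimono-≤ 0<d d≤ ⟩
          d i ⁻¹                      ≤⟨ proj₂ (archimedean (d i ⁻¹)) ⟩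
          fromℕ (big 0<d)             ∎)

        thick : 0# < d i → (∃ λ k → p8 k ⁻¹ < d i × (∀ j → j ℕ.< k → ¬ (p8 j ⁻¹ < d i))) → ∃ λ p → N ℕ.< p × Stage p i
        thick 0<d (zero , lt , _) = ⊥-elim (<⇒≱ lt (≤-trans (d≤δ i) (p8-anti {0} {suc N} ℕ.z≤n)))
        thick 0<d (suc p , lt , min) = p , ℕ.≰⇒> (λ p≤N → <⇒≱ lt (≤-trans (d≤δ i) (p8-anti {suc p} {suc N} (ℕ.s≤s p≤N))))
          , ≮⇒≥ (min p ℕ.≤-refl) , inj₁ lt

      -- In units of a cell all points of the piece are within 1 of a fixed point `u`, so the left
      -- ends of the closed cells that it meets lie in `[u - 2, u + 1]`, which holds at most four
      -- integers.
      hit-by-count : ∀ p i → ∑ (8 ℕ.^ p) (λ c → 𝟙 (Stage p i × HitBy p c i)) ≤ 𝟙 (Stage p i) * fromℕ 4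
      hit-by-count p i = ≤𝟙* (λ { (d≤ , _) → count d≤ em })
        (λ ¬stage → ≤-reflexive (trans (∑-cong (8 ℕ.^ p) (λ c _ → 𝟙-false (¬stage ∘ proj₁))) (trans (∑-const (8 ℕ.^ p) 0#) (zeroʳ _))))
        where
        count : d i ≤ p8 p ⁻¹ → Dec (∃ (piece i)) → ∑ (8 ℕ.^ p) (λ c → 𝟙 (Stage p i × HitBy p c i)) ≤ fromℕ 4
        count d≤ (no empty) = ≤-trans (≤-reflexive (trans (∑-cong (8 ℕ.^ p) (λ c _ → 𝟙-false λ { (_ , v , pv , _) → empty (v , pv) }))
          (trans (∑-const (8 ℕ.^ p) 0#) (zeroʳ _)))) (0≤fromℕ 4)
        count d≤ (yes (u , pu)) = begin
          ∑ (8 ℕ.^ p) (λ c → 𝟙 (Stage p i × HitBy p c i))         ≈⟨ *-identityˡ _ ⟨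
          1# * ∑ (8 ℕ.^ p) (λ c → 𝟙 (Stage p i × HitBy p c i)) ≤⟨ separated-count (8 ℕ.^ p) (λ c → Stage p i × HitBy p c i) fromℕ 0<1
              (≤-by hi-lo (0≤fromℕ 3)) (λ c c′ c<c′ _ _ _ → apart c c′ c<c′) (λ c _ → bounds c) ⟩
          hi - lo + 1# ≈⟨ trans (+-congʳ hi-lo) (solve 0 (con 3 :+ :1 := con 4)) ⟩
          fromℕ 4                                                 ∎
          where
          lo hi : ℝ
          lo = p8 p * u - fromℕ 2
          hi = p8 p * u + 1#

          hi-lo : hi - lo ≈ fromℕ 3
          hi-lo = solve 1 (λ u → u :+ :1 :- (u :- con 2) := con 3) _

          apart : ∀ c c′ → c ℕ.< c′ → 1# ≤ ∣ fromℕ c′ - fromℕ c ∣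
          apart c c′ c<c′ = ≤-trans (≤-by (solve 2 (λ x y → y :- x :- :1 := y :- (:1 :+ x)) (fromℕ c) (fromℕ c′)) (diff (fromℕ-mono-≤ c<c′))) (x≤∣x∣ _)

          close : ∀ {x y} → piece i x → piece i y → p8 p * (x - y) ≤ 1#
          close px py = ≤-trans (*-monoˡ-≤ _ (<⇒≤ (0<p8 p)) (≤-trans (x≤∣x∣ _) (≤-trans (∣x-y∣≤d i px py) d≤))) (≤-reflexive (*-inverse-pos (0<p8 p)))

          bounds : ∀ c → Stage p i × HitBy p c i → lo ≤ fromℕ c × fromℕ c ≤ hi
          bounds c (_ , v , pv , c≤ , ≤c+1) =
            ≤-by (solve 4 (λ c p u v → c :- (p :* u :- con 2) := c :+ :1 :- p :* v :+ (:1 :- p :* (u :- v))) (fromℕ c) (p8 p) u v) (diff ≤c+1 0≤+ diff (close pu pv)) ,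
            ≤-by (solve 4 (λ c p u v → p :* u :+ :1 :- c := p :* v :- c :+ (:1 :- p :* (v :- u))) (fromℕ c) (p8 p) u v) (diff c≤ 0≤+ diff (close pv pu))

      -- A piece with `8^(-p - 1) < d i` costs at least `1 / ξ p`, so a total cost of at most `η`
      -- allows `η * ξ p` of them. The alternative `p = N + 1 + i` determines `i`, which gives the
      -- 1.
      stage-count : ∀ p K → ∑ K (λ i → 𝟙 (Stage p i)) ≤ η * ξ p + 1#
      stage-count p K = begin
        ∑ K (λ i → 𝟙 (Stage p i)) ≤⟨ ∑-mono K (λ i _ → ≤-trans (𝟙-mono proj₂) (𝟙-⊎ (Large p i) (p ≡ suc (N ℕ.+ i)))) ⟩
        ∑ K (λ i → 𝟙 (Large p i) + 𝟙 (p ≡ suc (N ℕ.+ i))) ≈⟨ ∑-+ K (λ i → 𝟙 (Large p i)) (λ i → 𝟙 (p ≡ suc (N ℕ.+ i))) ⟩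
        ∑ K (λ i → 𝟙 (Large p i)) + ∑ K (λ i → 𝟙 (p ≡ suc (N ℕ.+ i))) ≤⟨ +-mono-≤ (∑-mono K (λ i _ → large i))
            (∑𝟙≤1 K (λ i → p ≡ suc (N ℕ.+ i)) (λ i j i<j _ p≡i p≡j → ℕ.<⇒≢ i<j (ℕ.+-cancelˡ-≡ N i j (ℕ.suc-injective (≡.trans (≡.sym p≡i) p≡j))))) ⟩
        ∑ K (λ i → κ i * ξ p) + 1# ≈⟨ +-congʳ (∑-*ʳ K (ξ p) κ) ⟩
        ∑ K κ * ξ p + 1# ≤⟨ +-monoˡ-≤ 1# (*-monoʳ-≤ (ξ p) (<⇒≤ (0<exp _)) (∑κ≤η K)) ⟩
        η * ξ p + 1#                                                    ∎
        where
        large : ∀ i → 𝟙 (Large p i) ≤ κ i * ξ p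
        large i = 𝟙≤ (0≤κ i 0≤* <⇒≤ (0<exp _)) λ lt → begin
          1#                                                ≈⟨ exp-neg _ ⟨
          exp (- (s * log (p8 (suc p)))) * ξ p ≈⟨ *-congʳ (exp-cong (trans (-‿distribʳ-* s _) (*-congˡ (sym (log-⁻¹ (0<p8 (suc p))))))) ⟩
          exp (s * log (p8 (suc p) ⁻¹)) * ξ p ≤⟨ *-monoʳ-≤ (ξ p) (<⇒≤ (0<exp _)) (κ-lower i (0<⁻¹ (0<p8 (suc p))) lt) ⟩
          κ i * ξ p                                         ∎

      hit-count : ∀ p → ∑ (8 ℕ.^ p) (λ c → 𝟙 (Hit p c)) ≤ fromℕ 4 * (η * ξ p + 1#)
      hit-count p = begin
        ∑ (8 ℕ.^ p) (λ c → 𝟙 (Hit p c)) ≤⟨ ∑-mono (8 ℕ.^ p) (λ c c< → ≤-trans (𝟙-mono (witness c c<)) (𝟙-∃ K (λ i → Stage p i × HitBy p c i))) ⟩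
        ∑ (8 ℕ.^ p) (λ c → ∑ K (λ i → 𝟙 (Stage p i × HitBy p c i))) ≈⟨ ∑-swap (8 ℕ.^ p) K (λ c i → 𝟙 (Stage p i × HitBy p c i)) ⟩
        ∑ K (λ i → ∑ (8 ℕ.^ p) (λ c → 𝟙 (Stage p i × HitBy p c i))) ≤⟨ ∑-mono K (λ i _ → hit-by-count p i) ⟩
        ∑ K (λ i → 𝟙 (Stage p i) * fromℕ 4) ≈⟨ trans (∑-*ʳ K (fromℕ 4) (λ i → 𝟙 (Stage p i))) (*-comm _ _) ⟩
        fromℕ 4 * ∑ K (λ i → 𝟙 (Stage p i)) ≤⟨ *-monoˡ-≤ _ (0≤fromℕ 4) (stage-count p K) ⟩
        fromℕ 4 * (η * ξ p + 1#)                                                    ∎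
        where
        bounded : ∃ λ K → ∀ c → c ℕ.< 8 ℕ.^ p → Hit p c → ∃ λ i → i ℕ.< K × (Stage p i × HitBy p c i)
        bounded = bounded-witnesses (λ c i → Stage p i × HitBy p c i) (8 ℕ.^ p)
        K = proj₁ bounded
        witness = proj₂ bounded

      global : ∀ n → N ℕ.≤ n → fromℕ 2 * (fromℕ (suc n) * fromℕ (suc n)) * ∑ (8 ℕ.^ suc n) (λ c → 𝟙 (Hit (suc n) c)) ≤ p8 (suc n)
      global n N≤n = *-cancelˡ-≤ (fromℕ 2) 0<2 (begin
        fromℕ 2 * (fromℕ 2 * (P * P) * ∑ (8 ℕ.^ p) (λ c → 𝟙 (Hit p c)))
          ≤⟨ *-monoˡ-≤ _ (0≤fromℕ 2) (*-monoˡ-≤ _ (0≤fromℕ 2 0≤* (0≤fromℕ p 0≤* 0≤fromℕ p)) (hit-count p)) ⟩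
        fromℕ 2 * (fromℕ 2 * (P * P) * (fromℕ 4 * (η * ξ p + 1#)))
          ≈⟨ solve 2 (λ p x → con 2 :* (con 2 :* (p :* p) :* (con 4 :* (x :+ :1))) := con 16 :* (p :* p) :* x :+ con 16 :* (p :* p)) P (η * ξ p) ⟩
        fromℕ 16 * (P * P) * (η * ξ p) + fromℕ 16 * (P * P)
          ≤⟨ +-mono-≤ (16p²ηξ≤p8 p) (16p²≤p8 (ℕ.≤-trans 12≤N (ℕ.m≤n⇒m≤1+n N≤n))) ⟩
        p8 p + p8 p                       ≈⟨ solve 1 (λ x → x :+ x := con 2 :* x) (p8 p) ⟩
        fromℕ 2 * p8 p                    ∎)
        where
        p = suc n
        P : ℝ
        P = fromℕ p

  -- Dimension at least one

  -- `E-contains` is the interface to the liminf set: a uniform positive lower bound on a tail of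
  -- the sequence puts a point into `E`.
  module Assembly (w : ℕ → ℝ) (0<w : ∀ {q} → 2 ℕ.≤ q → 0# < w q) (C : ℝ) (0<C : 0# < C)
    (block-sum : ∀ n → 1 ℕ.≤ n → fromℕ n * ∑ (2 ℕ.^ n) (λ i → w (2 ℕ.^ n ℕ.+ i) ⁻¹) ≤ C)
    (E : Pred ℝ 0ℓ)
    (E-contains : ∀ {x c} N → 0# < c → (∀ q → N ℕ.≤ q → c ≤ w q * ‖ fromℕ q * x ‖) → E x) where

    open Fractions w 0<w C 0<C block-sum

    -- The integers 0 to `q` are kept away because the cell was not removed. Negative integers and
    -- those above `q` are at distance at least 1 from `q * x`, as `x` lies in `[0, 1]`, and
    -- `ρ ≤ 1`.
    ‖‖-lower : ∀ {p x c} i → 1 ℕ.≤ p → i ℕ.< 2 ℕ.^ p → 0# ≤ x → x ≤ 1# →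
      ¬ Removed p c → fromℕ c ≤ p8 p * x → p8 p * x ≤ fromℕ c + 1# →
      ρ (2 ℕ.^ p ℕ.+ i) ≤ ‖ fromℕ (2 ℕ.^ p ℕ.+ i) * x ‖
    ‖‖-lower {p} {x} {c} i 1≤p i<2^p 0≤x x≤1 kept c≤ ≤c+1 = ‖‖-greatest far
      where
      q = 2 ℕ.^ p ℕ.+ i

      0<ρ : 0# < ρ q
      0<ρ = 0<ε 0<* 0<⁻¹ (0<w (2≤q i 1≤p))

      ρ≤1 : ρ q ≤ 1#
      ρ≤1 = ≤-trans (≤-by (solve 1 (λ r → con 2 :* r :- r := r) (ρ q)) (<⇒≤ 0<ρ)) (2ρ≤1 {p} i 1≤p i<2^p)

      far : ∀ z → ρ q ≤ ∣ fromℕ q * x - fromℤ z ∣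
      far ℤ.-[1+ j ] = ≤-trans ρ≤1 (≤-trans (≤-by
        (solve 3 (λ q x j → q :* x :- (:- (:1 :+ j)) :- :1 := q :* x :+ j) (fromℕ q) x (fromℕ j)) (0≤fromℕ q 0≤* 0≤x 0≤+ 0≤fromℕ j)) (x≤∣x∣ _))
      far (ℤ.+ j) = ≮⇒≥ λ close → [ (λ j<1+q → kept (i , i<2^p , j , j<1+q , x , (c≤ , ≤c+1) , close)) , (λ q<j → <⇒≱ close (beyond q<j)) ]′
        (ℕ.<-≤-connex j (suc q))
        where
        beyond : suc q ℕ.≤ j → ρ q ≤ ∣ fromℕ q * x - fromℕ j ∣
        beyond q<j = ≤-trans ρ≤1 (≤-trans (≤-by
          (solve 3 (λ q x j → :- (q :* x :- j) :- :1 := j :- (:1 :+ q) :+ q :* (:1 :- x)) (fromℕ q) x (fromℕ j))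
          (diff (fromℕ-mono-≤ q<j) 0≤+ 0≤fromℕ q 0≤* diff x≤1)) (-x≤∣x∣ _))

    member : ∀ N x → 0# ≤ x → x ≤ 1# →
      (∀ p → N ℕ.< p → ∃ λ c → ¬ Removed p c × fromℕ c ≤ p8 p * x × p8 p * x ≤ fromℕ c + 1#) → E x
    -- From `2^(N + 1)` on, the dyadic block of `q` has an index `p > N`; that index is also the
    -- stage at which the fractions with denominator `q` were removed.
    member N x 0≤x x≤1 cells = E-contains (2 ℕ.^ suc N) 0<ε λ q N≤q →
      let (p , i , i<2^p , q≡) = dyadic q (ℕ.≤-trans (ℕ.m^n>0 2 (suc N)) N≤q)
          N<p = ℕ.≰⇒> λ p≤N → ℕ.<⇒≱ (ℕ.+-monoʳ-< (2 ℕ.^ p) i<2^p) (ℕ.≤-trans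
            (ℕ.≤-trans (ℕ.≤-reflexive (≡.cong (2 ℕ.^ p ℕ.+_) (≡.sym (ℕ.+-identityʳ (2 ℕ.^ p))))) (ℕ.^-monoʳ-≤ 2 (ℕ.s≤s p≤N)))
            (ℕ.≤-trans N≤q (ℕ.≤-reflexive q≡)))
          (c , kept , c≤ , ≤c+1) = cells p N<p
          1≤p = ℕ.≤-trans (ℕ.s≤s ℕ.z≤n) N<p
      in ≡.subst (λ q → ε ≤ w q * ‖ fromℕ q * x ‖) (≡.sym q≡) (scale (2≤q i 1≤p) (‖‖-lower {c = c} i 1≤p i<2^p 0≤x x≤1 kept c≤ ≤c+1))
      where
      scale : ∀ {q y} → 2 ℕ.≤ q → ρ q ≤ y → ε ≤ w q * y
      scale {q} {y} 2≤q ρ≤y = begin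
        ε                       ≈⟨ trans (*-congˡ (*-inverse-pos (0<w 2≤q))) (*-identityʳ ε) ⟨
        ε * (w q * w q ⁻¹)      ≈⟨ solve 3 (λ e w i → e :* (w :* i) := w :* (e :* i)) ε (w q) _ ⟩
        w q * ρ q               ≤⟨ *-monoˡ-≤ _ (<⇒≤ (0<w 2≤q)) ρ≤y ⟩
        w q * y                 ∎

    module Avoid (N : ℕ) (12≤N : 12 ℕ.≤ N) (s : ℝ) (0≤s : 0# ≤ s) (s<1 : s < 1#) where

      open Exponent s 0≤s s<1

      escape : (𝒞 : Cover (p8 (suc N) ⁻¹) E) → (∀ n → ∑ n (λ i → diam (Cover.piece 𝒞 i) ^± s) ≤ η) → ⊥
      escape 𝒞 cheap = let (p , N<p , staged) = stage index in contradict N<p staged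
        where
        open Cover 𝒞

        real : ∀ i → ∃ λ d → d ≤ p8 (suc N) ⁻¹ × (∀ {x y} → piece i x → piece i y → ∣ x - y ∣ ≤ d)
                            × (∀ {r} → 0# < r → r < d → exp (s * log r) ≤ diam (piece i) ^± s)
        real i = real-diameter (piece i) 0≤s (0≤⁻¹ (0<p8 (suc N))) (small i)

        open Pieces N 12≤N piece (λ i → proj₁ (real i)) (λ i → diam (piece i) ^± s)
          (λ i → proj₁ (proj₂ (real i))) (λ i → proj₁ (proj₂ (proj₂ (real i)))) (λ i → ^±-nonNeg (diam (piece i)) s)
          (λ i → proj₂ (proj₂ (proj₂ (real i)))) cheap

        Bad : ℕ → ℕ → Set
        Bad p c = N ℕ.< p × (Removed p c ⊎ Hit p c)

        open Tree Bad
        open Density Removed Hit N (ℕ.≤-trans (ℕ.≤ᵇ⇒≤ 4 12 tt) 12≤N)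
          (λ n c n≤N bad → ℕ.<⇒≱ (proj₁ bad) n≤N) (λ n c → proj₂)
          (λ k m N≤n 3m≤p d _ → Count.local k m d 3m≤p (ℕ.≤-trans 12≤N (ℕ.m≤n⇒m≤1+n N≤n)))
          global

        point : ∃ λ x → 0# ≤ x × x ≤ 1# × (∀ n → ∃ λ c → Survives n c × fromℕ c ≤ p8 n * x × p8 n * x ≤ fromℕ c + 1#)
        point = limit-point alive

        x = proj₁ point

        cells : ∀ p → N ℕ.< p → ∃ λ c → ¬ Bad p c × fromℕ c ≤ p8 p * x × p8 p * x ≤ fromℕ c + 1#
        cells (suc n) _ = let (c , (_ , kept) , bounds) = proj₂ (proj₂ (proj₂ point)) (suc n) in c , kept , bounds

        x∈E : E x
        x∈E = member N x (proj₁ (proj₂ point)) (proj₁ (proj₂ (proj₂ point)))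
          λ p N<p → let (c , kept , bounds) = cells p N<p in c , (λ removed → kept (N<p , inj₁ removed)) , bounds

        index : ℕ
        index = proj₁ (covers x∈E)

        contradict : ∀ {p} → N ℕ.< p → Stage p index → ⊥
        contradict {p} N<p staged = let (c , kept , bounds) = cells p N<p in
          -- The point `x` itself witnesses that its kept cell at stage `p` is hit.
          kept (N<p , inj₂ (index , staged , x , proj₂ (covers x∈E) , bounds))

      positive : ¬ (hausdorffMeasure s E ≈± [ 0# ])
      positive H≈0 = let (𝒞 , cheap) = cheap-cover E H≈0 (0<⁻¹ (0<p8 (suc N))) 0<η in escape 𝒞 cheap

    dimension : dimH E ≈± [ 1# ]
    -- The single mesh `8^(-13)` serves for every `s < 1`; only the bound `η` on the cost depends on
    -- `s`.
    dimension = dimH≈1 E (Avoid.positive 12 ℕ.≤-refl) (null-above-1 E)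

  -- Conclusion for badly approximable numbers

  badlyApproximable-dyadic : ∀ {α} → BadlyApproximable α →
    ∃ λ e → ∀ q → 1 ℕ.≤ q → 1# ≤ p2 e * (fromℕ q * ‖ fromℕ q * α ‖)
  badlyApproximable-dyadic {α} α-bad = dyadic-const (badlyApproximable-const α-bad)
    where
    dyadic-const : (∃ λ κ → 0# < κ × (∀ q → 1 ℕ.≤ q → κ ≤ fromℕ q * ‖ fromℕ q * α ‖)) →
      ∃ λ e → ∀ q → 1 ℕ.≤ q → 1# ≤ p2 e * (fromℕ q * ‖ fromℕ q * α ‖)
    dyadic-const (κ , 0<κ , κ≤) = let (e , κ⁻¹≤e) = archimedean (κ ⁻¹) in e , λ q 1≤q → begin
      1#                                      ≈⟨ *-inverse-pos 0<κ ⟨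
      κ * κ ⁻¹ ≤⟨ *-mono-≤ (<⇒≤ 0<κ) (<⇒≤ (0<p2 e)) (κ≤ q 1≤q) (≤-trans κ⁻¹≤e (fromℕ-mono-≤ (ℕ.<⇒≤ (n<2^n e)))) ⟩
      fromℕ q * ‖ fromℕ q * α ‖ * p2 e        ≈⟨ *-comm _ _ ⟩
      p2 e * (fromℕ q * ‖ fromℕ q * α ‖)      ∎

  dimension-one : ∀ {a α} → 0# < a → a < 1# → BadlyApproximable α → (E : Pred ℝ 0ℓ) →
    (∀ {x c} N → 0# < c → (∀ q → N ℕ.≤ q → c ≤ weight a α q * ‖ fromℕ q * x ‖) → E x) → dimH E ≈± [ 1# ]
  dimension-one {a} {α} 0<a a<1 α-bad E E-contains = from (badlyApproximable-dyadic α-bad)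
    where
    from : (∃ λ e → ∀ q → 1 ℕ.≤ q → 1# ≤ p2 e * (fromℕ q * ‖ fromℕ q * α ‖)) → dimH E ≈± [ 1# ]
    from (e , bad) = Assembly.dimension w 0<w C 0<C Block.block-sum E E-contains
      where open Weight a α 0<a a<1 e bad

theorem3 : (em : ∀ {ℓ} → ExcludedMiddle ℓ) (R : CompleteOrderedField) →
    let open RealAnalysis em R in
    (a α : ℝ) → 0# < a → a < 1# → BadlyApproximable α →
    dimH (λ β → [ 0# ] <± liminf (λ q →
    fromℕ q
    * log (fromℕ q) ^ ((1# + 1#) - a)
    * log (‖ fromℕ q * α ‖ ⁻¹) ^ a
    * ‖ fromℕ q * α ‖
    * ‖ fromℕ q * β ‖))
    ≈± [ 1# ]
theorem3 em R a α 0<a a<1 α-bad =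
  Proof.dimension-one em R 0<a a<1 α-bad _ (λ N 0<c c≤ → Proof.liminf-positive em R N 0<c c≤)
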